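{- Let $\Gamma$ be a dual polar graph with base vertex $x$, with $D$, $e$, $q$ as in the context, and let $L,F,R,K$ be as defined in the context. Then $$KL=q^2LK,\quad KF=FK,\quad KR=q^{ -2}RK,$$ $$LF-q^2FL=(q^{2e}-1)L,\qquad FR-q^2RF=(q^{2e}-1)R,$$ $$\frac{q^4}{q^2+1}RL^2-LRL+\frac{q^{ -2}}{q^2+1}L^2R=-q^{2e+2D-2}L,\qquad \frac{q^4}{q^2+1}R^2L-RLR+\frac{q^{ -2}}{q^2+1}LR^2=-q^{2e+2D-2}R.$$
   Context: Let $b$ be a prime power, $D\ge3$ an integer, and $U$ a finite-dimensional vector space over $\mathbb{F}_b$ with one of the following nondegenerate forms, with attached number $e$: symplectic, $\dim U=2D$ ($e=1$); quadratic, $\dim U=2D+1$ ($e=1$); quadratic of Witt index $D$, $\dim U=2D$ ($e=0$); quadratic of Witt index $D$, $\dim U=2D+2$ ($e=2$); Hermitean, $\dim U=2D+1$, $b$ a square ($e=3/2$); Hermitean, $\dim U=2D$, $b$ a square ($e=1/2$). The dual polar graph $\Gamma$ has vertex set $X$ = maximal isotropic subspaces (dimension $D$), $y\sim z$ iff $\dim(y\cap z)=D-1$, with path-length distance $\partial(y,z)=D-\dim(y\cap z)$. Let $q=\sqrt b>0$. Fix $x\in X$. Let $A$ be the adjacency matrix and for $0\le i\le D$ let $E^*_i$ be the diagonal matrix in $\mathrm{Mat}_X(\mathbb{C})$ with $(y,y)$-entry $1$ if $\partial(x,y)=i$ and $0$ otherwise. Define $L=\sum_{i=1}^DE^*_{i-1}AE^*_i$,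 $F=\sum_{i=0}^DE^*_iAE^*_i$, $R=\sum_{i=0}^{D-1}E^*_{i+1}AE^*_i$, $K=\sum_{i=0}^Dq^{ -2i}E^*_i$. (Equivalently, $L_{yz}$, $F_{yz}$, $R_{yz}$ equal $1$ iff $y,z$ are adjacent and $\partial(x,z)-\partial(x,y)$ is $1$, $0$, $-1$ respectively, and $0$ otherwise.) -}

module Defs where

open import Data.Nat as ℕ using (ℕ; zero; suc; _≤_; _∸_; _^_; _≡ᵇ_)
open import Data.Nat.Properties using (m^n≢0)
open import Data.Nat.Primality using (Prime)
open import Data.Fin using (Fin) renaming (zero to fzero; suc to fsuc)
import Data.Fin as Fin
open import Data.Vec using (Vec; []; _∷_; zipWith; map; replicate)
open import Data.Bool using (Bool; true; false; _∧_; if_then_else_)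
open import Data.List using (List; length)
open import Data.List.Membership.Propositional using (_∈_)
open import Data.List.Relation.Unary.Unique.Propositional using (Unique)
open import Data.Product using (Σ; ∃; ∃-syntax; _×_; _,_)
open import Data.Integer using (+_)
open import Data.Rational as ℚ using (ℚ; 0ℚ; 1ℚ; _/_)
open import Relation.Binary.PropositionalEquality using (_≡_; _≢_)
open import Relation.Nullary using (¬_; yes; no)
open import Algebra.Structures using (IsCommutativeRing)

IsPrimePower : ℕ → Set
IsPrimePower b = ∃[ p ] ∃[ k ] (Prime p × b ≡ p ^ suc k)

record FiniteField (b : ℕ) : Set₁ where
  infixl 6 _+_
  infixl 7 _*_
  field
    K                 : Set
    _+_ _*_           : K → K → K
    -_                : K → K
    0# 1#             : K
    isCommutativeRing : IsCommutativeRing _≡_ _+_ _*_ -_ 0# 1#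
    0≢1               : 0# ≢ 1#
    inverse           : ∀ x → x ≢ 0# → ∃[ y ] (x * y ≡ 1#)
    elements          : List K
    elements-unique   : Unique elements
    elements-complete : ∀ x → x ∈ elements
    elements-count    : length elements ≡ b

module LinAlg {b : ℕ} (𝔽 : FiniteField b) where
  open FiniteField 𝔽

  _^ᶠ_ : K → ℕ → K
  x ^ᶠ zero  = 1#
  x ^ᶠ suc k = x * (x ^ᶠ k)

  Vect : ℕ → Set
  Vect n = Vec K n

  0v : ∀ {n} → Vect n
  0v = replicate _ 0#

  infixl 6 _⊕_
  infixr 7 _·_
  _⊕_ : ∀ {n} → Vect n → Vect n → Vect n
  _⊕_ = zipWith _+_

  _·_ : ∀ {n} → K → Vect n → Vect n
  c · u = map (c *_) u

  lincomb : ∀ {n d} → Vec K d → Vec (Vect n) d → Vect n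
  lincomb []       []       = 0v
  lincomb (c ∷ cs) (v ∷ vs) = c · v ⊕ lincomb cs vs

  LinIndep : ∀ {n d} → Vec (Vect n) d → Set
  LinIndep vs = ∀ cs → lincomb cs vs ≡ 0v → cs ≡ replicate _ 0#

  SubsetV : ℕ → Set
  SubsetV n = Vect n → Bool

  _∩_ : ∀ {n} → SubsetV n → SubsetV n → SubsetV n
  (S ∩ T) u = S u ∧ T u

  HasDim : ∀ {n} → SubsetV n → ℕ → Set
  HasDim {n} S d =
    ∃[ vs ] (LinIndep {n} {d} vs ×
             (∀ u → (S u ≡ true → ∃[ cs ] (u ≡ lincomb cs vs)) ×
                    (∃[ cs ] (u ≡ lincomb cs vs) → S u ≡ true)))

  record Bilinear {n} (B : Vect n → Vect n → K) : Set where
    field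
      addˡ : ∀ u u′ v → B (u ⊕ u′) v ≡ B u v + B u′ v
      mulˡ : ∀ c u v → B (c · u) v ≡ c * B u v
      addʳ : ∀ u v v′ → B u (v ⊕ v′) ≡ B u v + B u v′
      mulʳ : ∀ c u v → B u (c · v) ≡ c * B u v

  record SymplecticForm (n : ℕ) : Set where
    field
      B             : Vect n → Vect n → K
      bilinear      : Bilinear B
      alternating   : ∀ u → B u u ≡ 0#
      nondegenerate : ∀ u → (∀ v → B u v ≡ 0#) → u ≡ 0v

  record QuadraticForm (n : ℕ) : Set where
    field
      Q             : Vect n → K
      homogeneous   : ∀ c u → Q (c · u) ≡ c * c * Q u
    polar : Vect n → Vect n → K
    polar u v = Q (u ⊕ v) + - Q u + - Q v
    field
      polarBilinear : Bilinear polar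
      nondegenerate : ∀ u → Q u ≡ 0# → (∀ v → polar u v ≡ 0#) → u ≡ 0v

  -- nondegenerate Hermitean form on K^n, w.r.t. the involution x ↦ x^r
  -- where r * r ≡ b (so r = q = √b)
  record HermiteanForm (r n : ℕ) : Set where
    σ : K → K
    σ x = x ^ᶠ r
    field
      H             : Vect n → Vect n → K
      addˡ          : ∀ u u′ v → H (u ⊕ u′) v ≡ H u v + H u′ v
      mulˡ          : ∀ c u v → H (c · u) v ≡ c * H u v
      hermitean     : ∀ u v → H u v ≡ σ (H v u)
      nondegenerate : ∀ u → (∀ v → H u v ≡ 0#) → u ≡ 0v

  TotallyIsotropicB : ∀ {n} → (Vect n → Vect n → K) → SubsetV n → Set
  TotallyIsotropicB B S = ∀ u v → S u ≡ true → S v ≡ true → B u v ≡ 0#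

  TotallySingular : ∀ {n} → QuadraticForm n → SubsetV n → Set
  TotallySingular Q S = ∀ u → S u ≡ true → QuadraticForm.Q Q u ≡ 0#

  WittIndex : ∀ {n} → QuadraticForm n → ℕ → Set
  WittIndex Q w =
    (∃[ S ] (HasDim S w × TotallySingular Q S)) ×
    ¬ (∃[ S ] (HasDim S (suc w) × TotallySingular Q S))

  data PolarSpace (D : ℕ) : ℕ → Set where
    symplectic  : SymplecticForm (2 ℕ.* D) → PolarSpace D (2 ℕ.* D)
    quadOdd     : QuadraticForm (suc (2 ℕ.* D)) → PolarSpace D (suc (2 ℕ.* D))
    quadHyp     : (Q : QuadraticForm (2 ℕ.* D)) → WittIndex Q D →
                  PolarSpace D (2 ℕ.* D)
    quadEll     : (Q : QuadraticForm (2 ℕ.* D ℕ.+ 2)) → WittIndex Q D →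
                  PolarSpace D (2 ℕ.* D ℕ.+ 2)
    hermOdd     : (r : ℕ) → r ℕ.* r ≡ b → HermiteanForm r (suc (2 ℕ.* D)) →
                  PolarSpace D (suc (2 ℕ.* D))
    hermEven    : (r : ℕ) → r ℕ.* r ≡ b → HermiteanForm r (2 ℕ.* D) →
                  PolarSpace D (2 ℕ.* D)

  Isotropic : ∀ {D n} → PolarSpace D n → SubsetV n → Set
  Isotropic (symplectic f)  S = TotallyIsotropicB (SymplecticForm.B f) S
  Isotropic (quadOdd Q)     S = TotallySingular Q S
  Isotropic (quadHyp Q _)   S = TotallySingular Q S
  Isotropic (quadEll Q _)   S = TotallySingular Q S
  Isotropic (hermOdd _ _ h) S = TotallyIsotropicB (HermiteanForm.H h) S
  Isotropic (hermEven _ _ h) S = TotallyIsotropicB (HermiteanForm.H h) S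

  -- q^(2e) as a rational number (q = √b)
  q^2e : ∀ {D n} → PolarSpace D n → ℚ
  q^2e (symplectic _)   = + b / 1                  -- e = 1
  q^2e (quadOdd _)      = + b / 1                  -- e = 1
  q^2e (quadHyp _ _)    = 1ℚ                       -- e = 0
  q^2e (quadEll _ _)    = + (b ^ 2) / 1            -- e = 2
  q^2e (hermOdd r _ _)  = + (r ^ 3) / 1            -- e = 3/2
  q^2e (hermEven r _ _) = + (r ^ 1) / 1            -- e = 1/2

  -- X ≅ Fin m is the set of maximal isotropic subspaces (of dimension D),
  -- via the map sub (a bijection up to extensional equality of subsets)
  record DualPolarVertices {D n} (P : PolarSpace D n) (m : ℕ)
                           (sub : Fin m → SubsetV n) : Set where
    field
      vertex-dim  : ∀ y → HasDim (sub y) D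
      vertex-iso  : ∀ y → Isotropic P (sub y)
      injective   : ∀ y z → (∀ u → sub y u ≡ sub z u) → y ≡ z
      surjective  : ∀ S → HasDim S D → Isotropic P S →
                    ∃[ y ] (∀ u → S u ≡ sub y u)

  IsDistance : ∀ {n} (D m : ℕ) → (Fin m → SubsetV n) → (Fin m → Fin m → ℕ) → Set
  IsDistance D m sub dist =
    ∀ y z → dist y z ≤ D × HasDim (sub y ∩ sub z) (D ∸ dist y z)

Mat : ℕ → Set
Mat m = Fin m → Fin m → ℚ

sumFin : ∀ m → (Fin m → ℚ) → ℚ
sumFin zero    f = 0ℚ
sumFin (suc m) f = f fzero ℚ.+ sumFin m (λ i → f (fsuc i))

infixl 7 _⊗_
infixr 7 _⊙_
infixl 6 _⊞_ _⊟_
infix 4 _≐_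

_⊗_ : ∀ {m} → Mat m → Mat m → Mat m
_⊗_ {m} M N y z = sumFin m (λ w → M y w ℚ.* N w z)

_⊙_ : ∀ {m} → ℚ → Mat m → Mat m
(c ⊙ M) y z = c ℚ.* M y z

_⊞_ : ∀ {m} → Mat m → Mat m → Mat m
(M ⊞ N) y z = M y z ℚ.+ N y z

_⊟_ : ∀ {m} → Mat m → Mat m → Mat m
(M ⊟ N) y z = M y z ℚ.- N y z

_≐_ : ∀ {m} → Mat m → Mat m → Set
M ≐ N = ∀ y z → M y z ≡ N y z

-- 1 / b^i  (b ≥ 2 in our application; value for b = 0 is irrelevant)
invPow : ℕ → ℕ → ℚ
invPow zero    i = 0ℚ
invPow (suc c) i = _/_ (+ 1) (suc c ^ i) {{m^n≢0 (suc c) i}}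

ℕtoℚ : ℕ → ℚ
ℕtoℚ k = + k / 1

module Matrices (b m : ℕ) (dist : Fin m → Fin m → ℕ) (x : Fin m) where

  adj : Fin m → Fin m → Bool
  adj y z = dist y z ≡ᵇ 1

  Lm : Mat m
  Lm y z = if adj y z ∧ (dist x z ≡ᵇ suc (dist x y)) then 1ℚ else 0ℚ

  Fm : Mat m
  Fm y z = if adj y z ∧ (dist x z ≡ᵇ dist x y) then 1ℚ else 0ℚ

  Rm : Mat m
  Rm y z = if adj y z ∧ (suc (dist x z) ≡ᵇ dist x y) then 1ℚ else 0ℚ

  -- K = Σ_i q^{-2i} E*_i,  q^{-2i} = b^{-i}
  Km : Mat m
  Km y z with y Fin.≟ z
  ... | yes _ = invPow b (dist x y)
  ... | no _  = 0ℚ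

{-# OPTIONS --safe #-}

-- Write ∂ for the distance, d y = ∂(x, y) and s = q^{2e}.  Maximality of y shows
-- that x ∩ z meets y in codimension at most dim (y / (x ∩ y + y ∩ z)), that is,
-- 2 codim (x ∩ y ∩ z) ≤ ∂(x, y) + ∂(y, z) + ∂(x, z), which leaves few possibilities
-- for the relative position of x, y, z.  A singular vector a ∉ y lies in exactly one
-- neighbour of y, namely ⟨a⟩ + (y ∩ a^⊥), so neighbours of y are counted by counting
-- vectors: for a subspace T of y, those that are closer to z and contain T number
-- 1 + b + ⋯ + b^{k-1} with k = ∂(y, z) - dim (T / (T ∩ z)).  This yields the entries
-- of LF and FL.  For the cubic relation put N = L²/(q²+1), the indicator of
-- ∂(y, z) = 2 and d z = d y + 2.  The entry of LRL at (y, z) is a valency if y ~ z, plus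
-- b κ (RN)(y, z), where κ is b if x ∩ z ⊆ y and b + 1 otherwise.  In the first case
-- (NR)(y, z) vanishes unless y ~ z; in the second it equals b² (RN)(y, z).  The two
-- remaining relations are transposes.
module Submission where

open import Defs

-- The number s enters through a single count: for a singular v ≠ 0 there are s b^(2D-2) singular f
-- with form f v = 1. To obtain it, move f along v inside this hyperplane. Among the b vectors f + c
-- v, all are singular for a symplectic form, one for a quadratic form, and r for a Hermitean form;
-- in the last case bounds on numbers of roots and b = r² force equality. The count gives the
-- valencies: with [k] = 1 + b + ⋯ + b^(k-1), exactly s ([D] - [k]) neighbours of y fail to contain
-- a given subspace of y of codimension k. Subspaces are measured by cardinality. Counting
-- orthogonal pairs in two ways gives |S ∩ T^⊥| |T| = |T ∩ S^⊥| |S|, the main substitute for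
-- dimension formulas. Entries of matrix products stay natural numbers: identities are stated with
-- negative terms moved across and denominators cleared. The right side of the cubic relation comes
-- from the valencies u(y) = s ([D] - [d y]) away from x: if d z = d y + 1, then b u(y) - u(z) = s
-- b^D.

module Combinatorics where

  open import Data.Nat hiding (_≟_)
  open import Data.Nat.Properties
  open import Data.Nat.Tactic.RingSolver using (solve-∀)
  open import Data.Bool using (Bool; true; false)
  import Data.Bool.Properties as Bool
  open import Data.Fin using (Fin)
  import Data.Fin.Properties as Fin
  open import Data.List using (List; []; _∷_; length; cartesianProductWith; allFin)
  import Data.List as List
  import Data.List.Properties as List
  open import Data.List.Membership.Propositional using (_∈_; lose)
  open import Data.List.Membership.Propositional.Properties using (∈-cartesianProductWith⁺; ∈-allFin)
  open import Data.List.Relation.Unary.All as All using (All; []; _∷_)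
  open import Data.List.Relation.Unary.AllPairs using ([]; _∷_)
  open import Data.List.Relation.Unary.Any as Any using (here; there; any?; index)
  open import Data.List.Relation.Unary.Any.Properties using (lookup-index)
  open import Data.List.Relation.Unary.Unique.Propositional using (Unique)
  import Data.List.Relation.Unary.Unique.Propositional.Properties as Unique
  open import Data.Product using (∃; ∃-syntax; _×_; _,_; proj₁; proj₂)
  open import Data.Sum using (_⊎_; inj₁; inj₂)
  open import Data.Unit using (⊤; tt)
  open import Data.Vec using (Vec; []; _∷_; replicate)
  import Data.Vec.Properties as Vec
  open import Algebra.Bundles using (CommutativeRing)
  open import Relation.Binary.Definitions using (DecidableEquality)
  open import Relation.Binary.PropositionalEquality
  open import Relation.Nullary using (¬_; Dec; yes; no; contradiction; does)
  open import Relation.Nullary.Decidable using (_×-dec_; _→-dec_; ¬?; map′; dec-true; decidable-stable)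

  -- Counting in finite types

  record Finite (A : Set) : Set where
    field
      list     : List A
      unique   : Unique list
      complete : ∀ a → a ∈ list

  open Finite

  ⟦_⟧ : {P : Set} → Dec P → ℕ
  ⟦ yes _ ⟧ = 1
  ⟦ no _ ⟧  = 0

  module _ {P : Set} where

    ⟦⟧-yes : P → (p : Dec P) → ⟦ p ⟧ ≡ 1
    ⟦⟧-yes h (yes _) = refl
    ⟦⟧-yes h (no ¬h) = contradiction h ¬h

    ⟦⟧-no : ¬ P → (p : Dec P) → ⟦ p ⟧ ≡ 0
    ⟦⟧-no ¬h (yes h) = contradiction h ¬h
    ⟦⟧-no ¬h (no _)  = refl

  module _ {P Q : Set} where

    ⟦⟧-mono : (P → Q) → (p : Dec P) (q : Dec Q) → ⟦ p ⟧ ≤ ⟦ q ⟧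
    ⟦⟧-mono f (no _)  q = z≤n
    ⟦⟧-mono f (yes h) q = ≤-reflexive (sym (⟦⟧-yes (f h) q))

    ⟦⟧-cong : (P → Q) → (Q → P) → (p : Dec P) (q : Dec Q) → ⟦ p ⟧ ≡ ⟦ q ⟧
    ⟦⟧-cong f g (yes h) q = sym (⟦⟧-yes (f h) q)
    ⟦⟧-cong f g (no ¬h) q = sym (⟦⟧-no (λ k → ¬h (g k)) q)

    ⟦⟧-× : (p : Dec P) (q : Dec Q) → ⟦ p ×-dec q ⟧ ≡ ⟦ p ⟧ * ⟦ q ⟧
    ⟦⟧-× (yes _) (yes _) = refl
    ⟦⟧-× (yes _) (no _)  = refl
    ⟦⟧-× (no _)  q       = refl

    ⟦⟧-split : (p : Dec P) (q : Dec Q) → ⟦ p ⟧ ≡ ⟦ p ×-dec q ⟧ + ⟦ p ×-dec ¬? q ⟧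
    ⟦⟧-split (yes _) (yes _) = refl
    ⟦⟧-split (yes _) (no _)  = refl
    ⟦⟧-split (no _)  q       = refl

  sumOver : {A : Set} → List A → (A → ℕ) → ℕ
  sumOver []       f = 0
  sumOver (a ∷ as) f = f a + sumOver as f

  module _ {A : Set} where

    sumOver-cong : ∀ as {f g : A → ℕ} → (∀ a → f a ≡ g a) → sumOver as f ≡ sumOver as g
    sumOver-cong []       eq = refl
    sumOver-cong (a ∷ as) eq = cong₂ _+_ (eq a) (sumOver-cong as eq)

    sumOver-mono : ∀ as {f g : A → ℕ} → (∀ a → f a ≤ g a) → sumOver as f ≤ sumOver as g
    sumOver-mono []       le = z≤n
    sumOver-mono (a ∷ as) le = +-mono-≤ (le a) (sumOver-mono as le)

    sumOver-0 : ∀ as {f : A → ℕ} → All (λ a → f a ≡ 0) as → sumOver as f ≡ 0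
    sumOver-0 []       []         = refl
    sumOver-0 (a ∷ as) (eq ∷ eqs) = cong₂ _+_ eq (sumOver-0 as eqs)

    sumOver-+ : ∀ as (f g : A → ℕ) → sumOver as (λ a → f a + g a) ≡ sumOver as f + sumOver as g
    sumOver-+ []       f g = refl
    sumOver-+ (a ∷ as) f g = trans (cong (f a + g a +_) (sumOver-+ as f g))
      (interchange (f a) (g a) (sumOver as f) (sumOver as g))
      where
      interchange : ∀ i j k l → i + j + (k + l) ≡ i + k + (j + l)
      interchange = solve-∀

    sumOver-*ʳ : ∀ as (f : A → ℕ) k → sumOver as (λ a → f a * k) ≡ sumOver as f * k
    sumOver-*ʳ []       f k = refl
    sumOver-*ʳ (a ∷ as) f k =
      trans (cong (f a * k +_) (sumOver-*ʳ as f k)) (sym (*-distribʳ-+ k (f a) (sumOver as f)))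

    sumOver-∈ : ∀ {as} {f : A → ℕ} {a} → a ∈ as → f a ≤ sumOver as f
    sumOver-∈ {a ∷ as} {f} (here refl) = m≤m+n (f a) _
    sumOver-∈ {a ∷ as} {f} (there i)   = ≤-trans (sumOver-∈ i) (m≤n+m _ (f a))

    sumOver-single : ∀ {as} {f : A → ℕ} {a₀} → Unique as → a₀ ∈ as →
                     (∀ a → a ≢ a₀ → f a ≡ 0) → sumOver as f ≡ f a₀
    sumOver-single {a ∷ as} {f} (a∉ ∷ _) (here refl) zero-off =
      trans (cong (f a +_) (sumOver-0 as (All.map (λ a≢ → zero-off _ (≢-sym a≢)) a∉))) (+-identityʳ _)
    sumOver-single {a ∷ as} {f} (a∉ ∷ u) (there i) zero-off =
      trans (cong (_+ sumOver as f) (zero-off a (All.lookup a∉ i))) (sumOver-single u i zero-off)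

    sumOver-1 : ∀ as → sumOver as (λ (_ : A) → 1) ≡ length as
    sumOver-1 []       = refl
    sumOver-1 (a ∷ as) = cong suc (sumOver-1 as)

  sumOver-swap : {A B : Set} (as : List A) (bs : List B) (f : A → B → ℕ) →
                 sumOver as (λ a → sumOver bs (f a)) ≡ sumOver bs (λ b → sumOver as (λ a → f a b))
  sumOver-swap []       bs f = sym (sumOver-0 bs (All.universal (λ _ → refl) bs))
  sumOver-swap (a ∷ as) bs f =
    trans (cong (sumOver bs (f a) +_) (sumOver-swap as bs f))
          (sym (sumOver-+ bs (f a) (λ b → sumOver as (λ a → f a b))))

  ∑ : {A : Set} ⦃ E : Finite A ⦄ → (A → ℕ) → ℕ
  ∑ ⦃ E ⦄ = sumOver (list E)

  -- Opaque so that P? can be recovered from # P? by unification.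
  opaque
    # : {A : Set} ⦃ E : Finite A ⦄ {P : A → Set} → (∀ a → Dec (P a)) → ℕ
    # P? = ∑ (λ a → ⟦ P? a ⟧)

    #-∑ : {A : Set} ⦃ E : Finite A ⦄ {P : A → Set} (P? : ∀ a → Dec (P a)) → # P? ≡ ∑ (λ a → ⟦ P? a ⟧)
    #-∑ P? = refl

  module _ {A : Set} ⦃ E : Finite A ⦄ where

    ∑-cong : {f g : A → ℕ} → (∀ a → f a ≡ g a) → ∑ f ≡ ∑ g
    ∑-cong = sumOver-cong (list E)

    ∑-mono : {f g : A → ℕ} → (∀ a → f a ≤ g a) → ∑ f ≤ ∑ g
    ∑-mono = sumOver-mono (list E)

    ∑-0 : {f : A → ℕ} → (∀ a → f a ≡ 0) → ∑ f ≡ 0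
    ∑-0 eq = sumOver-0 (list E) (All.universal eq (list E))

    ∑-+ : (f g : A → ℕ) → ∑ (λ a → f a + g a) ≡ ∑ f + ∑ g
    ∑-+ = sumOver-+ (list E)

    ∑-*ʳ : (f : A → ℕ) (k : ℕ) → ∑ (λ a → f a * k) ≡ ∑ f * k
    ∑-*ʳ = sumOver-*ʳ (list E)

    ∑-*ˡ : (k : ℕ) (f : A → ℕ) → ∑ (λ a → k * f a) ≡ k * ∑ f
    ∑-*ˡ k f = trans (∑-cong (λ a → *-comm k (f a))) (trans (∑-*ʳ f k) (*-comm _ k))

    ∑-∈ : (f : A → ℕ) (a : A) → f a ≤ ∑ f
    ∑-∈ f a = sumOver-∈ (complete E a)

    ∑-single : {f : A → ℕ} (a₀ : A) → (∀ a → a ≢ a₀ → f a ≡ 0) → ∑ f ≡ f a₀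
    ∑-single a₀ = sumOver-single (unique E) (complete E a₀)

    ∃? : {P : A → Set} → (∀ a → Dec (P a)) → Dec (∃ P)
    ∃? P? = map′ Any.satisfied (λ (a , p) → lose (complete E a) p) (any? P? (list E))

    ∀? : {P : A → Set} → (∀ a → Dec (P a)) → Dec (∀ a → P a)
    ∀? P? = map′ (λ ps a → All.lookup ps (complete E a)) (λ p → All.universal p (list E)) (All.all? P? (list E))

    module _ {P : A → Set} {P? : ∀ a → Dec (P a)} where

      opaque
        unfolding #

        #-none : (∀ a → ¬ P a) → # P? ≡ 0
        #-none none = ∑-0 (λ a → ⟦⟧-no (none a) (P? a))

        #-one : ∀ a₀ → P a₀ → (∀ a → P a → a ≡ a₀) → # P? ≡ 1
        #-one a₀ p uniq =
          trans (∑-single a₀ (λ a a≢ → ⟦⟧-no (λ q → a≢ (uniq a q)) (P? a))) (⟦⟧-yes p (P? a₀))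

        #-∈ : ∀ a → P a → 1 ≤ # P?
        #-∈ a p = ≤-trans (≤-reflexive (sym (⟦⟧-yes p (P? a)))) (∑-∈ (λ a → ⟦ P? a ⟧) a)

      #-∃ : 1 ≤ # P? → ∃ P
      #-∃ pos = decidable-stable (∃? P?) λ none →
        contradiction pos (≤⇒≯ (≤-reflexive (#-none λ a p → none (a , p))))

      #-empty : # P? ≡ 0 → ∀ a → ¬ P a
      #-empty eq a p = contradiction (#-∈ a p) (≤⇒≯ (≤-reflexive eq))

    module _ {P Q : A → Set} {P? : ∀ a → Dec (P a)} {Q? : ∀ a → Dec (Q a)} where

      opaque
        unfolding #

        #-cong : (∀ a → P a → Q a) → (∀ a → Q a → P a) → # P? ≡ # Q?
        #-cong f g = ∑-cong (λ a → ⟦⟧-cong (f a) (g a) (P? a) (Q? a))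

        #-mono : (∀ a → P a → Q a) → # P? ≤ # Q?
        #-mono f = ∑-mono (λ a → ⟦⟧-mono (f a) (P? a) (Q? a))

    opaque
      unfolding #

      #-split : {P Q : A → Set} (P? : ∀ a → Dec (P a)) (Q? : ∀ a → Dec (Q a)) →
                # P? ≡ # (λ a → P? a ×-dec Q? a) + # (λ a → P? a ×-dec ¬? (Q? a))
      #-split P? Q? = trans (∑-cong (λ a → ⟦⟧-split (P? a) (Q? a)))
                            (∑-+ (λ a → ⟦ P? a ×-dec Q? a ⟧) (λ a → ⟦ P? a ×-dec ¬? (Q? a) ⟧))

    #-⊆-≥⇒⊇ : {P Q : A → Set} (P? : ∀ a → Dec (P a)) (Q? : ∀ a → Dec (Q a)) →
              (∀ a → P a → Q a) → # Q? ≤ # P? → ∀ a → Q a → P a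
    #-⊆-≥⇒⊇ P? Q? P⊆Q ≥ a q = decidable-stable (P? a) λ ¬p →
      -- An element of `Q` outside `P` would make `Q` strictly larger. This replaces the comparison
      -- of dimensions when nested subspaces are identified.
      contradiction (≤-trans (+-mono-≤ P≤ (#-∈ {P? = λ a → Q? a ×-dec ¬? (P? a)} a (q , ¬p)))
                             (≤-trans (≤-reflexive (sym (#-split Q? P?))) ≥))
                    (m+1+n≰m _)
      where
      P≤ : # P? ≤ # (λ a → Q? a ×-dec P? a)
      P≤ = #-mono (λ a p → P⊆Q a p , p)

  module _ {A B : Set} ⦃ EA : Finite A ⦄ ⦃ EB : Finite B ⦄ where

    ∑-swap : (f : A → B → ℕ) → ∑ (λ a → ∑ (f a)) ≡ ∑ (λ b → ∑ (λ a → f a b))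
    ∑-swap = sumOver-swap (list EA) (list EB)

    opaque
      unfolding #

      -- Row and column counts are often known only after multiplication by a power of `b`; the
      -- weights `i` and `j` clear these denominators. Columns outside `R` are empty.
      weighted-double-count : {P : A → Set} {Q : A → B → Set} {R : B → Set}
        (P? : ∀ a → Dec (P a)) (Q? : ∀ a b → Dec (Q a b)) (R? : ∀ b → Dec (R b)) (i j : ℕ) {k l : ℕ} →
        (∀ a b → P a → Q a b → R b) →
        (∀ a → P a → i * # (Q? a) ≡ k) →
        (∀ b → R b → j * # (λ a → P? a ×-dec Q? a b) ≡ l) →
        j * (# P? * k) ≡ i * (# R? * l)
      weighted-double-count {P} {Q} {R} P? Q? R? i j {k} {l} PQ⇒R rows columns = begin
        j * (# P? * k)
          ≡⟨ cong (j *_) (∑-*ʳ (λ a → ⟦ P? a ⟧) k) ⟨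
        j * ∑ (λ a → ⟦ P? a ⟧ * k)
          ≡⟨ cong (j *_) (∑-cong (λ a → row a (P? a))) ⟩
        j * ∑ (λ a → i * ∑ (λ b → ⟦ P? a ×-dec Q? a b ⟧))
          ≡⟨ cong (j *_) (∑-*ˡ i (λ a → ∑ (λ b → ⟦ P? a ×-dec Q? a b ⟧))) ⟩
        j * (i * ∑ (λ a → ∑ (λ b → ⟦ P? a ×-dec Q? a b ⟧)))
          ≡⟨ cong (λ t → j * (i * t)) (∑-swap (λ a b → ⟦ P? a ×-dec Q? a b ⟧)) ⟩
        j * (i * ∑ (λ b → # (λ a → P? a ×-dec Q? a b)))
          ≡⟨ *-swap j i _ ⟩
        i * (j * ∑ (λ b → # (λ a → P? a ×-dec Q? a b)))
          ≡⟨ cong (i *_) (∑-*ˡ j (λ b → # (λ a → P? a ×-dec Q? a b))) ⟨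
        i * ∑ (λ b → j * # (λ a → P? a ×-dec Q? a b))
          ≡⟨ cong (i *_) (∑-cong (λ b → column b (R? b))) ⟩
        i * ∑ (λ b → ⟦ R? b ⟧ * l)
          ≡⟨ cong (i *_) (∑-*ʳ (λ b → ⟦ R? b ⟧) l) ⟩
        i * (# R? * l) ∎
        where
        open ≡-Reasoning
        *-swap : ∀ x y z → x * (y * z) ≡ y * (x * z)
        *-swap = solve-∀
        row : ∀ a (p : Dec (P a)) → ⟦ p ⟧ * k ≡ i * ∑ (λ b → ⟦ p ×-dec Q? a b ⟧)
        row a (yes p) = trans (+-identityʳ k) (trans (sym (rows a p))
          (cong (i *_) (∑-cong (λ b → ⟦⟧-cong (p ,_) proj₂ (Q? a b) (yes p ×-dec Q? a b)))))
        row a (no ¬p) = sym (trans (cong (i *_) (∑-0 {A = B} (λ b → refl))) (*-zeroʳ i))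
        column : ∀ b (r : Dec (R b)) → j * # (λ a → P? a ×-dec Q? a b) ≡ ⟦ r ⟧ * l
        column b (yes r) = trans (columns b r) (sym (+-identityʳ l))
        column b (no ¬r) = trans (cong (j *_)
          (#-none {P? = λ a → P? a ×-dec Q? a b} (λ a (p , q) → ¬r (PQ⇒R a b p q)))) (*-zeroʳ j)

    double-count : {P : A → Set} {Q : A → B → Set} {R : B → Set}
      (P? : ∀ a → Dec (P a)) (Q? : ∀ a b → Dec (Q a b)) (R? : ∀ b → Dec (R b)) {k l : ℕ} →
      (∀ a b → P a → Q a b → R b) →
      (∀ a → P a → # (Q? a) ≡ k) →
      (∀ b → R b → # (λ a → P? a ×-dec Q? a b) ≡ l) →
      # P? * k ≡ # R? * l
    double-count P? Q? R? PQ⇒R rows columns = trans (sym (+-identityʳ _)) (trans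
      (weighted-double-count P? Q? R? 1 1 PQ⇒R (λ a p → trans (+-identityʳ _) (rows a p))
        (λ b r → trans (+-identityʳ _) (columns b r)))
      (+-identityʳ _))

    opaque
      unfolding #

      #-inj : {P : A → Set} {Q : B → Set} (P? : ∀ a → Dec (P a)) (Q? : ∀ b → Dec (Q b)) →
        (_≟_ : (b b′ : B) → Dec (b ≡ b′)) (f : A → B) → (∀ a → P a → Q (f a)) →
        (∀ a a′ → P a → P a′ → f a ≡ f a′ → a ≡ a′) → # P? ≤ # Q?
      #-inj {P} {Q} P? Q? _≟_ f to inj = begin
        # P?                                         ≡⟨ ∑-cong (λ a → row a (P? a)) ⟩
        ∑ (λ a → ∑ (λ b → ⟦ P? a ×-dec f a ≟ b ⟧))   ≡⟨ ∑-swap _ ⟩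
        ∑ (λ b → # (λ a → P? a ×-dec f a ≟ b))       ≤⟨ ∑-mono column ⟩
        # Q?                                         ∎
        where
        open ≤-Reasoning
        row : ∀ a (p : Dec (P a)) → ⟦ p ⟧ ≡ ∑ (λ b → ⟦ p ×-dec f a ≟ b ⟧)
        row a (yes p) = sym (#-one {P? = λ b → yes p ×-dec f a ≟ b} (f a) (p , refl) (λ _ (_ , eq) → sym eq))
        row a (no _)  = sym (∑-0 {A = B} (λ b → refl))
        column : ∀ b → # (λ a → P? a ×-dec f a ≟ b) ≤ ⟦ Q? b ⟧
        column b with ∃? (λ a → P? a ×-dec f a ≟ b)
        ... | no none = ≤-trans (≤-reflexive (#-none (λ a h → none (a , h)))) z≤n
        ... | yes (a₀ , p₀ , refl) =
          ≤-trans (≤-reflexive (#-one a₀ (p₀ , refl) (λ a (p , eq) → inj a a₀ p p₀ eq)))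
                  (≤-reflexive (sym (⟦⟧-yes (to a₀ p₀) (Q? (f a₀)))))

    #-bij : {P : A → Set} {Q : B → Set} (P? : ∀ a → Dec (P a)) (Q? : ∀ b → Dec (Q b)) →
      (_≟_ : (b b′ : B) → Dec (b ≡ b′)) (f : A → B) → (∀ a → P a → Q (f a)) →
      (∀ a a′ → P a → P a′ → f a ≡ f a′ → a ≡ a′) → (∀ b → Q b → ∃[ a ] (P a × f a ≡ b)) → # P? ≡ # Q?
    #-bij P? Q? _≟_ f to inj sur = trans (sym (*-identityʳ _)) (trans
      (double-count P? (λ a b → f a ≟ b) Q? (λ { a _ p refl → to a p })
        (λ a p → #-one (f a) refl (λ _ eq → sym eq))
        λ b q → let (a₀ , p₀ , eq₀) = sur b q in
                #-one a₀ (p₀ , eq₀) (λ a (p , eq) → inj a a₀ p p₀ (trans eq (sym eq₀))))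
      (*-identityʳ _))

    #-fibres : {P : A → Set} {R : B → Set} (P? : ∀ a → Dec (P a)) (R? : ∀ b → Dec (R b))
      (_≟_ : (b b′ : B) → Dec (b ≡ b′)) (f : A → B) {k : ℕ} → (∀ a → P a → R (f a)) →
      (∀ b → # (λ a → f a ≟ b) ≤ k) → # P? ≤ # R? * k
    #-fibres {P} {R} P? R? _≟_ f {k} to bound = begin
      # P?                                             ≡⟨ #-∑ P? ⟩
      ∑ (λ a → ⟦ P? a ⟧)                               ≤⟨ ∑-mono (λ a → row a (P? a)) ⟩
      ∑ (λ a → ∑ (λ b → ⟦ R? b ⟧ * ⟦ f a ≟ b ⟧))       ≡⟨ ∑-swap (λ a b → ⟦ R? b ⟧ * ⟦ f a ≟ b ⟧) ⟩
      ∑ (λ b → ∑ (λ a → ⟦ R? b ⟧ * ⟦ f a ≟ b ⟧))       ≡⟨ ∑-cong (λ b → ∑-*ˡ ⟦ R? b ⟧ (λ a → ⟦ f a ≟ b ⟧)) ⟩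
      ∑ (λ b → ⟦ R? b ⟧ * ∑ (λ a → ⟦ f a ≟ b ⟧))       ≤⟨ ∑-mono (λ b → *-monoʳ-≤ ⟦ R? b ⟧
                                                            (≤-trans (≤-reflexive (sym (#-∑ (λ a → f a ≟ b)))) (bound b))) ⟩
      ∑ (λ b → ⟦ R? b ⟧ * k)                           ≡⟨ ∑-*ʳ (λ b → ⟦ R? b ⟧) k ⟩
      ∑ (λ b → ⟦ R? b ⟧) * k                           ≡⟨ cong (_* k) (#-∑ R?) ⟨
      # R? * k                                         ∎
      where
      open ≤-Reasoning
      row : ∀ a (p : Dec (P a)) → ⟦ p ⟧ ≤ ∑ (λ b → ⟦ R? b ⟧ * ⟦ f a ≟ b ⟧)
      row a (no _)  = z≤n
      row a (yes p) = ≤-trans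
        (≤-reflexive (sym (cong₂ _*_ (⟦⟧-yes (to a p) (R? (f a))) (⟦⟧-yes refl (f a ≟ f a)))))
        (∑-∈ (λ b → ⟦ R? b ⟧ * ⟦ f a ≟ b ⟧) (f a))

  -- Linear algebra over a finite field by cardinalities

  length-cartesianProductWith : {A B C : Set} (f : A → B → C) (as : List A) (bs : List B) →
    length (cartesianProductWith f as bs) ≡ length as * length bs
  length-cartesianProductWith f []       bs = refl
  length-cartesianProductWith f (a ∷ as) bs = trans (List.length-++ (List.map (f a) bs))
    (cong₂ _+_ (List.length-map (f a) bs) (length-cartesianProductWith f as bs))

  does⁻ : {P : Set} (p : Dec P) → does p ≡ true → P
  does⁻ (yes p) _ = p

  module FieldProperties {b : ℕ} (𝔽 : FiniteField b) where

    open FiniteField 𝔽 renaming (_+_ to _+ᶠ_; _*_ to _*ᶠ_; -_ to -ᶠ_)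
    open LinAlg 𝔽

    commutativeRing : CommutativeRing _ _
    commutativeRing = record { isCommutativeRing = isCommutativeRing }

    module F where
      open CommutativeRing commutativeRing public
      open import Algebra.Properties.Ring (CommutativeRing.ring commutativeRing) public

    infix 4 _≟ᶠ_ _≟ᵛ_
    -- The field comes without a decision procedure; elements are compared through their positions
    -- in the enumeration.
    _≟ᶠ_ : DecidableEquality K
    x ≟ᶠ y = map′
      (λ eq → trans (lookup-index (elements-complete x))
                    (trans (cong (List.lookup elements) eq) (sym (lookup-index (elements-complete y)))))
      (cong (λ z → index (elements-complete z)))
      (index (elements-complete x) Fin.≟ index (elements-complete y))

    instance
      K-finite : Finite K
      K-finite = record { list = elements ; unique = elements-unique ; complete = elements-complete }

    vectors : ∀ n → List (Vect n)
    vectors zero    = [] ∷ []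
    vectors (suc n) = cartesianProductWith _∷_ elements (vectors n)

    vectors-unique : ∀ n → Unique (vectors n)
    vectors-unique zero    = [] ∷ []
    vectors-unique (suc n) =
      Unique.cartesianProductWith⁺ _∷_ Vec.∷-injective elements-unique (vectors-unique n)

    vectors-complete : ∀ {n} (u : Vect n) → u ∈ vectors n
    vectors-complete []      = here refl
    vectors-complete (c ∷ u) = ∈-cartesianProductWith⁺ _∷_ (elements-complete c) (vectors-complete u)

    instance
      Vect-finite : ∀ {n} → Finite (Vect n)
      Vect-finite = record { list = vectors _ ; unique = vectors-unique _ ; complete = vectors-complete }

    length-vectors : ∀ n → length (vectors n) ≡ b ^ n
    length-vectors zero    = refl
    length-vectors (suc n) = trans (length-cartesianProductWith _∷_ elements (vectors n))
      (cong₂ _*_ elements-count (length-vectors n))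

    all? : {A : Set} (a : A) → Dec ⊤
    all? _ = yes tt

    opaque
      unfolding #

      #K : # {A = K} all? ≡ b
      #K = trans (sumOver-1 elements) elements-count

      #Vect : ∀ n → # {A = Vect n} all? ≡ b ^ n
      #Vect n = trans (sumOver-1 (vectors n)) (length-vectors n)

    1<b : 1 < b
    1<b = subst (1 <_) elements-count (two elements (elements-complete 0#) (elements-complete 1#))
      where
      two : ∀ xs → 0# ∈ xs → 1# ∈ xs → 1 < length xs
      two (x ∷ [])     (here eq) (here eq′) = contradiction (trans eq (sym eq′)) 0≢1
      two (x ∷ y ∷ xs) _ _ = s≤s (s≤s z≤n)

    instance
      b-nonZero : NonZero b
      b-nonZero = >-nonZero (<-trans z<s 1<b)

    b^_-nonZero : ∀ k → NonZero (b ^ k)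
    b^ k -nonZero = m^n≢0 b k

    b^-≤⁻¹ : ∀ {j k} → b ^ j ≤ b ^ k → j ≤ k
    b^-≤⁻¹ {j} {k} le with j ≤? k
    ... | yes j≤k = j≤k
    ... | no j≰k  = contradiction le (<⇒≱ (^-monoʳ-< b 1<b (≰⇒> j≰k)))

    b^-injective : ∀ {j k} → b ^ j ≡ b ^ k → j ≡ k
    b^-injective eq = ≤-antisym (b^-≤⁻¹ (≤-reflexive eq)) (b^-≤⁻¹ (≤-reflexive (sym eq)))

    *ᶠ-cancel-0 : ∀ {c d} → c ≢ 0# → c *ᶠ d ≡ 0# → d ≡ 0#
    *ᶠ-cancel-0 {c} {d} c≢0 eq with inverse c c≢0
    ... | (e , ce≡1) = begin
      d              ≡⟨ F.*-identityˡ d ⟨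
      1# *ᶠ d        ≡⟨ cong (_*ᶠ d) (trans (sym ce≡1) (F.*-comm c e)) ⟩
      e *ᶠ c *ᶠ d    ≡⟨ F.*-assoc e c d ⟩
      e *ᶠ (c *ᶠ d)  ≡⟨ cong (e *ᶠ_) eq ⟩
      e *ᶠ 0#        ≡⟨ F.zeroʳ e ⟩
      0#             ∎
      where open ≡-Reasoning

    _≟ᵛ_ : ∀ {n} → DecidableEquality (Vect n)
    _≟ᵛ_ = Vec.≡-dec _≟ᶠ_

    ⊕-assoc : ∀ {n} (u v w : Vect n) → (u ⊕ v) ⊕ w ≡ u ⊕ (v ⊕ w)
    ⊕-assoc = Vec.zipWith-assoc F.+-assoc

    ⊕-comm : ∀ {n} (u v : Vect n) → u ⊕ v ≡ v ⊕ u
    ⊕-comm = Vec.zipWith-comm F.+-comm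

    ⊕-identityˡ : ∀ {n} (u : Vect n) → 0v ⊕ u ≡ u
    ⊕-identityˡ = Vec.zipWith-identityˡ F.+-identityˡ

    ⊕-identityʳ : ∀ {n} (u : Vect n) → u ⊕ 0v ≡ u
    ⊕-identityʳ = Vec.zipWith-identityʳ F.+-identityʳ

    1·_ : ∀ {n} (u : Vect n) → 1# · u ≡ u
    1· []      = refl
    1· (c ∷ u) = cong₂ _∷_ (F.*-identityˡ c) (1· u)

    0·_ : ∀ {n} (u : Vect n) → 0# · u ≡ 0v
    0· []      = refl
    0· (c ∷ u) = cong₂ _∷_ (F.zeroˡ c) (0· u)

    ·-0v : ∀ {n} c → c · 0v {n} ≡ 0v
    ·-0v {n} c = trans (Vec.map-replicate (c *ᶠ_) 0# n) (cong (replicate n) (F.zeroʳ c))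

    ·-distribˡ : ∀ {n} c (u v : Vect n) → c · (u ⊕ v) ≡ c · u ⊕ c · v
    ·-distribˡ c []      []      = refl
    ·-distribˡ c (d ∷ u) (e ∷ v) = cong₂ _∷_ (F.distribˡ c d e) (·-distribˡ c u v)

    ·-distribʳ : ∀ {n} c d (u : Vect n) → (c +ᶠ d) · u ≡ c · u ⊕ d · u
    ·-distribʳ c d []      = refl
    ·-distribʳ c d (e ∷ u) = cong₂ _∷_ (F.distribʳ e c d) (·-distribʳ c d u)

    ·-assoc : ∀ {n} c d (u : Vect n) → c · (d · u) ≡ (c *ᶠ d) · u
    ·-assoc c d []      = refl
    ·-assoc c d (e ∷ u) = cong₂ _∷_ (sym (F.*-assoc c d e)) (·-assoc c d u)

    infixl 6 _⊖_
    _⊖_ : ∀ {n} → Vect n → Vect n → Vect n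
    u ⊖ v = u ⊕ (-ᶠ 1#) · v

    ·-cancel : ∀ {n} c (u : Vect n) → c · u ⊕ (-ᶠ c) · u ≡ 0v
    ·-cancel c u = trans (sym (·-distribʳ c (-ᶠ c) u)) (trans (cong (_· u) (F.-‿inverseʳ c)) (0· u))

    ⊖-self : ∀ {n} (u : Vect n) → u ⊖ u ≡ 0v
    ⊖-self u = trans (cong (_⊖ u) (sym (1· u))) (·-cancel 1# u)

    ⊕-⊖ : ∀ {n} (u v : Vect n) → u ⊕ v ⊖ v ≡ u
    ⊕-⊖ u v = trans (⊕-assoc u v _) (trans (cong (u ⊕_) (⊖-self v)) (⊕-identityʳ u))

    ⊖-⊕ : ∀ {n} (u v : Vect n) → u ⊖ v ⊕ v ≡ u
    ⊖-⊕ u v = trans (⊕-assoc u _ v) (trans (cong (u ⊕_) (trans (⊕-comm _ v) (⊖-self v))) (⊕-identityʳ u))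

    ⊕-cancelʳ : ∀ {n} {u u′} (v : Vect n) → u ⊕ v ≡ u′ ⊕ v → u ≡ u′
    ⊕-cancelʳ {u = u} {u′} v eq = trans (sym (⊕-⊖ u v)) (trans (cong (_⊖ v) eq) (⊕-⊖ u′ v))

    ⊖≡0 : ∀ {n} {u v : Vect n} → u ⊖ v ≡ 0v → u ≡ v
    ⊖≡0 {u = u} {v} eq = trans (sym (⊖-⊕ u v)) (trans (cong (_⊕ v) eq) (⊕-identityˡ v))

    ⊕-interchange : ∀ {n} (u v u′ v′ : Vect n) → (u ⊕ v) ⊕ (u′ ⊕ v′) ≡ (u ⊕ u′) ⊕ (v ⊕ v′)
    ⊕-interchange u v u′ v′ = begin
      (u ⊕ v) ⊕ (u′ ⊕ v′)  ≡⟨ ⊕-assoc u v _ ⟩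
      u ⊕ (v ⊕ (u′ ⊕ v′))  ≡⟨ cong (u ⊕_) (⊕-assoc v u′ v′) ⟨
      u ⊕ ((v ⊕ u′) ⊕ v′)  ≡⟨ cong (λ t → u ⊕ (t ⊕ v′)) (⊕-comm v u′) ⟩
      u ⊕ ((u′ ⊕ v) ⊕ v′)  ≡⟨ cong (u ⊕_) (⊕-assoc u′ v v′) ⟩
      u ⊕ (u′ ⊕ (v ⊕ v′))  ≡⟨ ⊕-assoc u u′ _ ⟨
      (u ⊕ u′) ⊕ (v ⊕ v′)  ∎
      where open ≡-Reasoning

    ⊖-⊖-⊖ : ∀ {n} (w u v : Vect n) → (w ⊖ u) ⊖ (w ⊖ v) ≡ v ⊖ u
    ⊖-⊖-⊖ w u v = ⊕-cancelʳ (w ⊖ v) (trans (⊖-⊕ (w ⊖ u) (w ⊖ v)) (sym (begin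
      v ⊖ u ⊕ (w ⊖ v)  ≡⟨ ⊕-comm _ _ ⟩
      w ⊖ v ⊕ (v ⊖ u)  ≡⟨ ⊕-assoc (w ⊖ v) v _ ⟨
      w ⊖ v ⊕ v ⊖ u    ≡⟨ cong (_⊖ u) (⊖-⊕ w v) ⟩
      w ⊖ u            ∎)))
      where open ≡-Reasoning

    #-translate : ∀ {n} {P Q : Vect n → Set} (t : Vect n) (P? : ∀ u → Dec (P u)) (Q? : ∀ u → Dec (Q u)) →
      (∀ u → P u → Q (u ⊕ t)) → (∀ u → Q (u ⊕ t) → P u) → # P? ≡ # Q?
    #-translate {Q = Q} t P? Q? to from = #-bij P? Q? _≟ᵛ_ (_⊕ t) to (λ _ _ _ _ → ⊕-cancelʳ t)
      (λ u q → u ⊖ t , from (u ⊖ t) (subst Q (sym (⊖-⊕ u t)) q) , ⊖-⊕ u t)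

    lincomb-⊕ : ∀ {n d} (cs ds : Vect d) (vs : Vec (Vect n) d) →
                lincomb (cs ⊕ ds) vs ≡ lincomb cs vs ⊕ lincomb ds vs
    lincomb-⊕ []       []       []       = sym (⊕-identityˡ 0v)
    lincomb-⊕ (c ∷ cs) (d ∷ ds) (v ∷ vs) =
      trans (cong₂ _⊕_ (·-distribʳ c d v) (lincomb-⊕ cs ds vs)) (⊕-interchange (c · v) (d · v) _ _)

    lincomb-· : ∀ {n d} c (cs : Vect d) (vs : Vec (Vect n) d) → lincomb (c · cs) vs ≡ c · lincomb cs vs
    lincomb-· c []       []       = sym (·-0v c)
    lincomb-· c (d ∷ cs) (v ∷ vs) =
      trans (cong₂ _⊕_ (sym (·-assoc c d v)) (lincomb-· c cs vs)) (sym (·-distribˡ c (d · v) _))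

    lincomb-0 : ∀ {n d} (vs : Vec (Vect n) d) → lincomb 0v vs ≡ 0v
    lincomb-0 vs = trans (cong (λ cs → lincomb cs vs) (sym (0· 0v))) (trans (lincomb-· 0# 0v vs) (0· _))

    LinIndep⇒injective : ∀ {n d} {vs : Vec (Vect n) d} → LinIndep vs →
                         ∀ cs ds → lincomb cs vs ≡ lincomb ds vs → cs ≡ ds
    LinIndep⇒injective {vs = vs} indep cs ds eq = ⊖≡0 (indep (cs ⊖ ds) (begin
      lincomb (cs ⊖ ds) vs                    ≡⟨ lincomb-⊕ cs _ vs ⟩
      lincomb cs vs ⊕ lincomb ((-ᶠ 1#) · ds) vs ≡⟨ cong₂ _⊕_ eq (lincomb-· _ ds vs) ⟩
      lincomb ds vs ⊖ lincomb ds vs           ≡⟨ ⊖-self _ ⟩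
      0v                                      ∎))
      where open ≡-Reasoning

    -- Subspaces as decidable subsets: closure, bases, cardinality

    infix 4 _∈ˢ_ _∈ˢ?_ _⊆ˢ_ _⊆ˢ?_
    _∈ˢ_ : ∀ {n} → Vect n → SubsetV n → Set
    u ∈ˢ S = S u ≡ true

    _∈ˢ?_ : ∀ {n} (u : Vect n) (S : SubsetV n) → Dec (u ∈ˢ S)
    u ∈ˢ? S = S u Bool.≟ true

    _⊆ˢ_ : ∀ {n} → SubsetV n → SubsetV n → Set
    S ⊆ˢ T = ∀ u → u ∈ˢ S → u ∈ˢ T

    _⊆ˢ?_ : ∀ {n} (S T : SubsetV n) → Dec (S ⊆ˢ T)
    S ⊆ˢ? T = ∀? (λ u → u ∈ˢ? S →-dec u ∈ˢ? T)

    ∩⁺ : ∀ {n} {S T : SubsetV n} {u} → u ∈ˢ S → u ∈ˢ T → u ∈ˢ (S ∩ T)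
    ∩⁺ = cong₂ Data.Bool._∧_

    ∩⁻ˡ : ∀ {n} {S T : SubsetV n} {u} → u ∈ˢ (S ∩ T) → u ∈ˢ S
    ∩⁻ˡ {S = S} {u = u} h with S u
    ... | true = refl

    ∩⁻ʳ : ∀ {n} {S T : SubsetV n} {u} → u ∈ˢ (S ∩ T) → u ∈ˢ T
    ∩⁻ʳ {S = S} {u = u} h with S u
    ... | true = h

    card : ∀ {n} → SubsetV n → ℕ
    card S = # (_∈ˢ? S)

    card-mono : ∀ {n} {S T : SubsetV n} → S ⊆ˢ T → card S ≤ card T
    card-mono = #-mono

    card-⊇ : ∀ {n} {S T : SubsetV n} → S ⊆ˢ T → card T ≤ card S → T ⊆ˢ S
    card-⊇ {S = S} {T} = #-⊆-≥⇒⊇ (_∈ˢ? S) (_∈ˢ? T)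

    -- Subspaces are handled through closure and cardinality; bases appear only in the passage from
    -- and to `HasDim`.
    record IsSubspace {n} (S : SubsetV n) : Set where
      field
        has-0    : 0v ∈ˢ S
        closed-⊕ : ∀ {u v} → u ∈ˢ S → v ∈ˢ S → (u ⊕ v) ∈ˢ S
        closed-· : ∀ c {u} → u ∈ˢ S → (c · u) ∈ˢ S

      closed-⊖ : ∀ {u v} → u ∈ˢ S → v ∈ˢ S → (u ⊖ v) ∈ˢ S
      closed-⊖ h h′ = closed-⊕ h (closed-· (-ᶠ 1#) h′)

    ∩-isSubspace : ∀ {n} {S T : SubsetV n} → IsSubspace S → IsSubspace T → IsSubspace (S ∩ T)
    ∩-isSubspace {S = S} {T} s t = record
      { has-0    = ∩⁺ {S = S} {T} s.has-0 t.has-0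
      ; closed-⊕ = λ h h′ → ∩⁺ {S = S} {T} (s.closed-⊕ (∩⁻ˡ {S = S} {T} h) (∩⁻ˡ {S = S} {T} h′))
                                          (t.closed-⊕ (∩⁻ʳ {S = S} {T} h) (∩⁻ʳ {S = S} {T} h′))
      ; closed-· = λ c h → ∩⁺ {S = S} {T} (s.closed-· c (∩⁻ˡ {S = S} {T} h)) (t.closed-· c (∩⁻ʳ {S = S} {T} h))
      }
      where
      module s = IsSubspace s
      module t = IsSubspace t

    HasDim⇒IsSubspace : ∀ {n d} {S : SubsetV n} → HasDim S d → IsSubspace S
    HasDim⇒IsSubspace {S = S} (vs , _ , spans) = record
      { has-0    = proj₂ (spans _) (0v , sym (lincomb-0 vs))
      ; closed-⊕ = λ {u} {v} h h′ → add (proj₁ (spans u) h) (proj₁ (spans v) h′)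
      ; closed-· = λ c {u} h → scale c (proj₁ (spans u) h)
      }
      where
      add : ∀ {u v} → ∃[ cs ] (u ≡ lincomb cs vs) → ∃[ cs ] (v ≡ lincomb cs vs) → (u ⊕ v) ∈ˢ S
      add (cs , refl) (ds , refl) = proj₂ (spans _) (cs ⊕ ds , sym (lincomb-⊕ cs ds vs))
      scale : ∀ c {u} → ∃[ cs ] (u ≡ lincomb cs vs) → (c · u) ∈ˢ S
      scale c (cs , refl) = proj₂ (spans _) (c · cs , sym (lincomb-· c cs vs))

    HasDim⇒card : ∀ {n d} {S : SubsetV n} → HasDim S d → card S ≡ b ^ d
    HasDim⇒card {d = d} {S} (vs , indep , spans) = trans (sym
      (#-bij all? (_∈ˢ? S) _≟ᵛ_ (λ cs → lincomb cs vs) (λ cs _ → proj₂ (spans _) (cs , refl))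
        (λ cs ds _ _ → LinIndep⇒injective indep cs ds)
        (λ u h → let (cs , eq) = proj₁ (spans u) h in cs , tt , sym eq)))
      (#Vect d)

    LinIndep-∷ : ∀ {n d} {vs : Vec (Vect n) d} {u} → LinIndep vs →
                 ¬ (∃[ cs ] (u ≡ lincomb cs vs)) → LinIndep (u ∷ vs)
    LinIndep-∷ {vs = vs} {u} indep u∉ (c ∷ cs) eq with c ≟ᶠ 0#
    ... | yes refl = cong (0# ∷_) (indep cs (trans (sym (⊕-identityˡ _)) (trans (cong (_⊕ _) (sym (0· u))) eq)))
    ... | no c≢0 with inverse c c≢0
    ...   | (e , ce≡1) = contradiction ((-ᶠ e) · cs , (begin
      u                          ≡⟨ 1· u ⟨
      1# · u                     ≡⟨ cong (_· u) (trans (sym ce≡1) (F.*-comm c e)) ⟩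
      (e *ᶠ c) · u               ≡⟨ ·-assoc e c u ⟨
      e · (c · u)                ≡⟨ cong (e ·_) (⊕-⊖ (c · u) (lincomb cs vs)) ⟨
      e · (c · u ⊕ lincomb cs vs ⊖ lincomb cs vs)
                                 ≡⟨ cong (λ t → e · (t ⊖ lincomb cs vs)) eq ⟩
      e · (0v ⊖ lincomb cs vs)   ≡⟨ cong (e ·_) (⊕-identityˡ _) ⟩
      e · ((-ᶠ 1#) · lincomb cs vs) ≡⟨ ·-assoc e (-ᶠ 1#) _ ⟩
      (e *ᶠ (-ᶠ 1#)) · lincomb cs vs
        ≡⟨ cong (_· lincomb cs vs) (trans (sym (F.-‿distribʳ-* e 1#)) (cong -ᶠ_ (F.*-identityʳ e))) ⟩
      (-ᶠ e) · lincomb cs vs     ≡⟨ lincomb-· (-ᶠ e) cs vs ⟨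
      lincomb ((-ᶠ e) · cs) vs   ∎)) u∉
      where open ≡-Reasoning

    module _ {n : ℕ} {S : SubsetV n} (isSubspace : IsSubspace S) where
      open IsSubspace isSubspace

      IndepIn : ℕ → Set
      IndepIn d = ∃[ vs ] (LinIndep {n} {d} vs × (∀ cs → lincomb cs vs ∈ˢ S))

      -- Greedy choice: while the chosen vectors do not span `S`, add one outside their span. For
      -- `k` = n + 1 only the first alternative survives, since n + 1 independent vectors would give
      -- b^(n+1) elements in a space of b^n.
      grow : ∀ k → (∃[ d ] HasDim S d) ⊎ IndepIn k
      grow zero = inj₂ ([] , (λ { [] _ → refl }) , λ { [] → has-0 })
      grow (suc k) with grow k
      ... | inj₁ done = inj₁ done
      ... | inj₂ (vs , indep , vs⊆S) with ∃? (λ u → u ∈ˢ? S ×-dec ¬? (∃? (λ cs → u ≟ᵛ lincomb cs vs)))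
      ...   | yes (u , u∈S , u∉) = inj₂ (u ∷ vs , LinIndep-∷ indep u∉ ,
                λ { (c ∷ cs) → closed-⊕ (closed-· c u∈S) (vs⊆S cs) })
      ...   | no none = inj₁ (k , vs , indep , λ u →
                (λ u∈S → decidable-stable (∃? (λ cs → u ≟ᵛ lincomb cs vs)) (λ u∉ → none (u , u∈S , u∉))) ,
                λ { (cs , refl) → vs⊆S cs })

      IndepIn⇒card : ∀ {d} → IndepIn d → b ^ d ≤ card S
      IndepIn⇒card {d} (vs , indep , vs⊆S) = ≤-trans (≤-reflexive (sym (#Vect d)))
        (#-inj all? (_∈ˢ? S) _≟ᵛ_ (λ cs → lincomb cs vs) (λ cs _ → vs⊆S cs)
          (λ cs ds _ _ → LinIndep⇒injective indep cs ds))

      opaque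

        hasDim : ∃[ d ] HasDim S d
        hasDim with grow (suc n)
        ... | inj₁ done = done
        ... | inj₂ big  = contradiction
          (b^-≤⁻¹ {suc n} {n} (≤-trans (IndepIn⇒card big)
            (≤-trans (#-mono {A = Vect n} {P? = _∈ˢ? S} {Q? = all?} (λ _ _ → tt)) (≤-reflexive (#Vect n))))) 1+n≰n

      card⇒HasDim : ∀ {d} → card S ≡ b ^ d → HasDim S d
      card⇒HasDim eq with hasDim
      ... | (d , h) = subst (HasDim S) (b^-injective (trans (sym (HasDim⇒card h)) eq)) h

    record IsLinear {n} (φ : Vect n → K) : Set where
      field
        add : ∀ u v → φ (u ⊕ v) ≡ φ u +ᶠ φ v
        mul : ∀ c u → φ (c · u) ≡ c *ᶠ φ u

    module _ {n : ℕ} {S : SubsetV n} (isSubspace : IsSubspace S) {φ : Vect n → K} (linear : IsLinear φ) where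
      open IsSubspace isSubspace
      open IsLinear linear

      #-level : ∀ {u₀} → u₀ ∈ˢ S → φ u₀ ≢ 0# → ∀ c → b * # (λ u → u ∈ˢ? S ×-dec φ u ≟ᶠ c) ≡ card S
      #-level {u₀} u₀∈S φu₀≢0 c with inverse (φ u₀) φu₀≢0
      ... | (e , eq) = sym (trans (sym (*-identityʳ _)) (trans
        (double-count (_∈ˢ? S) (λ u d → φ u ≟ᶠ d) all? (λ _ _ _ _ → tt)
          (λ u _ → #-one (φ u) refl (λ _ → sym))
          -- As `e` inverts φ u₀, adding (c - d) e u₀ raises φ by c - d. This matches level `d` with
          -- level `c`, so the b levels all have the same size.
          (λ d _ → #-translate ((c +ᶠ (-ᶠ d)) · (e · u₀)) _ (λ u → u ∈ˢ? S ×-dec φ u ≟ᶠ c)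
            (λ u (h , φu≡d) → closed-⊕ h (closed-· _ (closed-· _ u₀∈S)) ,
              trans (shift u d) (trans (cong (_+ᶠ (c +ᶠ (-ᶠ d))) φu≡d) (trans (sym (F.+-assoc d c _)) (F.xyx⁻¹≈y d c))))
            (λ u (h , eq′) → subst (_∈ˢ S) (⊕-⊖ u _) (closed-⊖ h (closed-· _ (closed-· _ u₀∈S))) ,
              F.+-cancelʳ (c +ᶠ (-ᶠ d)) _ _ (trans (sym (shift u d))
                (trans eq′ (sym (trans (sym (F.+-assoc d c _)) (F.xyx⁻¹≈y d c))))))))
        (cong (_* # (λ u → u ∈ˢ? S ×-dec φ u ≟ᶠ c)) #K)))
        where
        shift : ∀ u d → φ (u ⊕ (c +ᶠ (-ᶠ d)) · (e · u₀)) ≡ φ u +ᶠ (c +ᶠ (-ᶠ d))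
        shift u d = begin
          φ (u ⊕ (c +ᶠ (-ᶠ d)) · (e · u₀))        ≡⟨ add u _ ⟩
          φ u +ᶠ φ ((c +ᶠ (-ᶠ d)) · (e · u₀))     ≡⟨ cong (φ u +ᶠ_) (trans (mul _ _) (cong (_ *ᶠ_) (mul e u₀))) ⟩
          φ u +ᶠ (c +ᶠ (-ᶠ d)) *ᶠ (e *ᶠ φ u₀)     ≡⟨ cong (λ t → φ u +ᶠ (c +ᶠ (-ᶠ d)) *ᶠ t) (trans (F.*-comm e _) eq) ⟩
          φ u +ᶠ (c +ᶠ (-ᶠ d)) *ᶠ 1#              ≡⟨ cong (φ u +ᶠ_) (F.*-identityʳ _) ⟩
          φ u +ᶠ (c +ᶠ (-ᶠ d))                    ∎
          where open ≡-Reasoning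

    opaque
      unfolding #

      -- The inequality |S| |T| ≤ |S + T| |S ∩ T| without forming S + T, for which any `R`
      -- containing the sums may stand. Subtracting one decomposition of a vector from the others
      -- embeds them into S ∩ T.
      card-sum : ∀ {n} {S T : SubsetV n} → IsSubspace S → IsSubspace T → {R : Vect n → Set} (R? : ∀ u → Dec (R u)) →
                 (∀ u v → u ∈ˢ S → v ∈ˢ T → R (u ⊕ v)) → card S * card T ≤ # R? * card (S ∩ T)
      card-sum {n} {S} {T} sS sT {R} R? sum⇒R = begin
        card S * card T                                            ≡⟨ ∑-*ʳ (λ u → ⟦ u ∈ˢ? S ⟧) _ ⟨
        ∑ (λ u → ⟦ u ∈ˢ? S ⟧ * card T)                             ≡⟨ ∑-cong (λ u → row u (u ∈ˢ? S)) ⟩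
        ∑ (λ u → ∑ (λ w → ⟦ u ∈ˢ? S ×-dec (w ⊖ u) ∈ˢ? T ⟧))        ≡⟨ ∑-swap (λ u w → ⟦ u ∈ˢ? S ×-dec (w ⊖ u) ∈ˢ? T ⟧) ⟩
        ∑ (λ w → # (λ u → u ∈ˢ? S ×-dec (w ⊖ u) ∈ˢ? T))            ≤⟨ ∑-mono column ⟩
        ∑ (λ w → ⟦ R? w ⟧ * card (S ∩ T))                          ≡⟨ ∑-*ʳ (λ w → ⟦ R? w ⟧) _ ⟩
        # R? * card (S ∩ T)                                        ∎
        where
        open ≤-Reasoning
        module sS = IsSubspace sS
        module sT = IsSubspace sT
        row : ∀ u (p : Dec (u ∈ˢ S)) → ⟦ p ⟧ * card T ≡ ∑ (λ w → ⟦ p ×-dec (w ⊖ u) ∈ˢ? T ⟧)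
        row u (no _)  = sym (∑-0 {A = Vect n} (λ _ → refl))
        row u (yes p) = trans (+-identityʳ _) (#-translate u (_∈ˢ? T) (λ w → yes p ×-dec (w ⊖ u) ∈ˢ? T)
          (λ v h → p , subst (_∈ˢ T) (sym (⊕-⊖ v u)) h) (λ v (_ , h) → subst (_∈ˢ T) (⊕-⊖ v u) h))
        column : ∀ w → # (λ u → u ∈ˢ? S ×-dec (w ⊖ u) ∈ˢ? T) ≤ ⟦ R? w ⟧ * card (S ∩ T)
        column w with ∃? (λ u → u ∈ˢ? S ×-dec (w ⊖ u) ∈ˢ? T)
        ... | no none = ≤-trans (≤-reflexive (#-none (λ u h → none (u , h)))) z≤n
        ... | yes (v , v∈S , w⊖v∈T) = begin
          # (λ u → u ∈ˢ? S ×-dec (w ⊖ u) ∈ˢ? T)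
            ≤⟨ #-inj _ (_∈ˢ? S ∩ T) _≟ᵛ_ (_⊖ v)
                 (λ u (h , h′) → ∩⁺ {S = S} {T} (sS.closed-⊖ h v∈S)
                   (subst (_∈ˢ T) (⊖-⊖-⊖ w v u) (sT.closed-⊖ w⊖v∈T h′)))
                 (λ _ _ _ _ → ⊕-cancelʳ _) ⟩
          card (S ∩ T)
            ≡⟨ +-identityʳ _ ⟨
          1 * card (S ∩ T)
            ≡⟨ cong (_* card (S ∩ T)) (⟦⟧-yes (subst R (trans (⊕-comm v _) (⊖-⊕ w v)) (sum⇒R v (w ⊖ v) v∈S w⊖v∈T)) (R? w)) ⟨
          ⟦ R? w ⟧ * card (S ∩ T) ∎

    opaque

      adjoin : ∀ {n} → Vect n → SubsetV n → SubsetV n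
      adjoin a T u = does (∃? (λ c → (u ⊖ c · a) ∈ˢ? T))

      adjoin⁺ : ∀ {n} {a : Vect n} {T : SubsetV n} {u} c → u ∈ˢ T → (u ⊕ c · a) ∈ˢ adjoin a T
      adjoin⁺ {a = a} {T} {u} c h = dec-true (∃? _) (c , subst (_∈ˢ T) (sym (⊕-⊖ u (c · a))) h)

      adjoin⁻ : ∀ {n} {a : Vect n} {T : SubsetV n} {u} → u ∈ˢ adjoin a T → ∃[ c ] ((u ⊖ c · a) ∈ˢ T)
      adjoin⁻ h = does⁻ (∃? _) h

    module _ {n : ℕ} {a : Vect n} {T : SubsetV n} where

      adjoin-⊆ : T ⊆ˢ adjoin a T
      adjoin-⊆ u h = subst (_∈ˢ adjoin a T) (trans (cong (u ⊕_) (0· a)) (⊕-identityʳ u)) (adjoin⁺ 0# h)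

      module _ (isSubspace : IsSubspace T) where
        open IsSubspace isSubspace

        adjoin-∋ : a ∈ˢ adjoin a T
        adjoin-∋ = subst (_∈ˢ adjoin a T) (trans (⊕-identityˡ _) (1· a)) (adjoin⁺ 1# has-0)

        adjoin-isSubspace : IsSubspace (adjoin a T)
        adjoin-isSubspace = record
          { has-0    = adjoin-⊆ 0v has-0
          ; closed-⊕ = λ {u} {v} h h′ → let (c , p) = adjoin⁻ h ; (d , q) = adjoin⁻ h′ in
              subst (_∈ˢ adjoin a T)
                (trans (cong ((u ⊖ c · a ⊕ (v ⊖ d · a)) ⊕_) (·-distribʳ c d a))
                  (trans (⊕-interchange (u ⊖ c · a) (v ⊖ d · a) (c · a) (d · a))
                    (cong₂ _⊕_ (⊖-⊕ u (c · a)) (⊖-⊕ v (d · a)))))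
                (adjoin⁺ (c +ᶠ d) (closed-⊕ p q))
          ; closed-· = λ e {u} h → let (c , p) = adjoin⁻ h in
              subst (_∈ˢ adjoin a T)
                (trans (cong (e · (u ⊖ c · a) ⊕_) (sym (·-assoc e c a)))
                  (trans (sym (·-distribˡ e _ (c · a))) (cong (e ·_) (⊖-⊕ u (c · a)))))
                (adjoin⁺ (e *ᶠ c) (closed-· e p))
          }

        -- The span is the disjoint union of the b cosets c a + T: two coefficients for one vector
        -- would put a nonzero multiple of `a`, hence `a`, into `T`.
        card-adjoin : ¬ a ∈ˢ T → card (adjoin a T) ≡ b * card T
        card-adjoin a∉T = trans (sym (*-identityʳ _)) (trans
          (double-count (_∈ˢ? adjoin a T) (λ u c → (u ⊖ c · a) ∈ˢ? T) all? (λ _ _ _ _ → tt)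
            (λ u h → let (c , p) = adjoin⁻ h in #-one c p (λ d q → unique-coefficient u d c q p))
            (λ c _ → sym (#-translate (c · a) (_∈ˢ? T) _
              (λ u h → adjoin⁺ c h , subst (_∈ˢ T) (sym (⊕-⊖ u (c · a))) h)
              (λ u (_ , h) → subst (_∈ˢ T) (⊕-⊖ u (c · a)) h))))
          (cong (_* card T) #K))
          where
          unique-coefficient : ∀ u c d → (u ⊖ c · a) ∈ˢ T → (u ⊖ d · a) ∈ˢ T → c ≡ d
          unique-coefficient u c d p q with (d +ᶠ (-ᶠ c)) ≟ᶠ 0#
          ... | yes eq = F.-‿injective (F.+-inverseʳ-unique d (-ᶠ c) eq)
          ... | no d-c≢0 with inverse _ d-c≢0
          ...   | (e , eq) = contradiction (subst (_∈ˢ T) (begin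
            e · ((u ⊖ c · a) ⊖ (u ⊖ d · a))    ≡⟨ cong (e ·_) (⊖-⊖-⊖ u (c · a) (d · a)) ⟩
            e · (d · a ⊖ c · a)                ≡⟨ cong (λ t → e · (d · a ⊕ t)) (·-assoc _ c a) ⟩
            e · (d · a ⊕ ((-ᶠ 1#) *ᶠ c) · a)   ≡⟨ cong (e ·_) (·-distribʳ d _ a) ⟨
            e · ((d +ᶠ (-ᶠ 1#) *ᶠ c) · a)      ≡⟨ cong (λ t → e · ((d +ᶠ t) · a)) (F.-1*x≈-x c) ⟩
            e · ((d +ᶠ (-ᶠ c)) · a)            ≡⟨ ·-assoc e _ a ⟩
            (e *ᶠ (d +ᶠ (-ᶠ c))) · a           ≡⟨ cong (_· a) (trans (F.*-comm e _) eq) ⟩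
            1# · a                             ≡⟨ 1· a ⟩
            a                                  ∎) (closed-· e (closed-⊖ p q))) a∉T
            where open ≡-Reasoning

  -- Reflexive forms and totally isotropic subspaces

  module PolarProperties {b : ℕ} (𝔽 : FiniteField b) where

    open FiniteField 𝔽 renaming (_+_ to _+ᶠ_; _*_ to _*ᶠ_; -_ to -ᶠ_)
    open LinAlg 𝔽
    open FieldProperties 𝔽

    -- For a quadratic form Q, `Singular u` will mean Q u = 0 and `form` is the polar form; in the
    -- other cases `Singular u` means form u u = 0.
    record TotallyIsotropic {n} (form : Vect n → Vect n → K) (Singular : Vect n → Set) (S : SubsetV n) : Set where
      field
        singular : ∀ {u} → u ∈ˢ S → Singular u
        perp     : ∀ {u v} → u ∈ˢ S → v ∈ˢ S → form u v ≡ 0#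

    -- The common features of the six kinds of forms; s plays the role of q^{2e}.
    record PolarGeometry (n D s : ℕ) (Iso : SubsetV n → Set) : Set₁ where
      field
        form     : Vect n → Vect n → K
        linear   : ∀ v → IsLinear (λ u → form u v)
        reflexive : ∀ {u v} → form u v ≡ 0# → form v u ≡ 0#
        Singular  : Vect n → Set
        singular? : ∀ u → Dec (Singular u)
        singular-⊕ : ∀ {u v} → Singular u → Singular v → form u v ≡ 0# → Singular (u ⊕ v)
        singular-· : ∀ c {u} → Singular u → Singular (c · u)
        singular⇒isotropic : ∀ {u} → Singular u → form u u ≡ 0#
        -- Stated for singular `u`, because in characteristic 2 the polar form of a quadratic form
        -- on a space of odd dimension has a nonzero radical.
        nondegenerate : ∀ u → Singular u → (∀ v → form u v ≡ 0#) → u ≡ 0v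
        #-singular : ∀ {v} → Singular v → v ≢ 0v →
                     b * b * # (λ f → singular? f ×-dec form f v ≟ᶠ 1#) ≡ s * b ^ (2 * D)

        Iso⇒ : ∀ {S} → IsSubspace S → Iso S → TotallyIsotropic form Singular S
        Iso⇐ : ∀ {S} → TotallyIsotropic form Singular S → Iso S
        rank : ∀ {S} → IsSubspace S → TotallyIsotropic form Singular S → card S ≢ b ^ suc D

    instance
      pred-b-nonZero : NonZero (pred b)
      pred-b-nonZero = >-nonZero (pred-mono-≤ 1<b)

    module Perp {n : ℕ} {form : Vect n → Vect n → K} (linear : ∀ v → IsLinear (λ u → form u v))
                (reflexive : ∀ {u v} → form u v ≡ 0# → form v u ≡ 0#) where

      infix 4 _⊥ˢ_ _⊥ˢ?_
      _⊥ˢ_ : Vect n → SubsetV n → Set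
      u ⊥ˢ T = ∀ v → v ∈ˢ T → form v u ≡ 0#

      _⊥ˢ?_ : ∀ u T → Dec (u ⊥ˢ T)
      u ⊥ˢ? T = ∀? (λ v → v ∈ˢ? T →-dec form v u ≟ᶠ 0#)

      not-⊥ : ∀ {u T} → ¬ u ⊥ˢ T → ∃[ v ] (v ∈ˢ T × form v u ≢ 0#)
      not-⊥ {u} {T} h = decidable-stable (∃? (λ v → v ∈ˢ? T ×-dec ¬? (form v u ≟ᶠ 0#)))
        λ none → h λ v v∈T → decidable-stable (form v u ≟ᶠ 0#) λ ≢0 → none (v , v∈T , ≢0)

      opaque
        unfolding #

        pairs : SubsetV n → SubsetV n → ℕ
        pairs S T = ∑ (λ u → # (λ v → u ∈ˢ? S ×-dec v ∈ˢ? T ×-dec form v u ≟ᶠ 0#))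

        pairs-comm : ∀ S T → pairs S T ≡ pairs T S
        pairs-comm S T = trans (∑-swap (λ u v → ⟦ u ∈ˢ? S ×-dec v ∈ˢ? T ×-dec form v u ≟ᶠ 0# ⟧))
          (∑-cong λ v → #-cong {P? = λ u → u ∈ˢ? S ×-dec v ∈ˢ? T ×-dec form v u ≟ᶠ 0#}
            (λ u (p , q , r) → q , p , reflexive r) (λ u (p , q , r) → q , p , reflexive r))

        -- After multiplication by b, a vector `u` of `S` contributes b |T| if it is orthogonal to
        -- `T`, and otherwise |T|, since its orthogonal space then cuts out a hyperplane of `T`.
        pairs-count : ∀ S {T} → IsSubspace T →
          b * pairs S T ≡ card S * card T + # (λ u → u ∈ˢ? S ×-dec u ⊥ˢ? T) * (pred b * card T)
        pairs-count S {T} sT = begin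
          b * pairs S T
            ≡⟨ ∑-*ˡ b (λ u → # (λ v → u ∈ˢ? S ×-dec v ∈ˢ? T ×-dec form v u ≟ᶠ 0#)) ⟨
          ∑ (λ u → b * # (λ v → u ∈ˢ? S ×-dec v ∈ˢ? T ×-dec form v u ≟ᶠ 0#))
            ≡⟨ ∑-cong (λ u → row u (u ∈ˢ? S)) ⟩
          ∑ (λ u → ⟦ u ∈ˢ? S ⟧ * card T + ⟦ u ∈ˢ? S ×-dec u ⊥ˢ? T ⟧ * (pred b * card T))
            ≡⟨ ∑-+ (λ u → ⟦ u ∈ˢ? S ⟧ * card T) (λ u → ⟦ u ∈ˢ? S ×-dec u ⊥ˢ? T ⟧ * (pred b * card T)) ⟩
          ∑ (λ u → ⟦ u ∈ˢ? S ⟧ * card T) + ∑ (λ u → ⟦ u ∈ˢ? S ×-dec u ⊥ˢ? T ⟧ * (pred b * card T))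
            ≡⟨ cong₂ _+_ (∑-*ʳ (λ u → ⟦ u ∈ˢ? S ⟧) (card T)) (∑-*ʳ (λ u → ⟦ u ∈ˢ? S ×-dec u ⊥ˢ? T ⟧) (pred b * card T)) ⟩
          card S * card T + # (λ u → u ∈ˢ? S ×-dec u ⊥ˢ? T) * (pred b * card T)
            ∎
          where
          open ≡-Reasoning
          row : ∀ u (p : Dec (u ∈ˢ S)) → b * # (λ v → p ×-dec v ∈ˢ? T ×-dec form v u ≟ᶠ 0#)
                ≡ ⟦ p ⟧ * card T + ⟦ p ×-dec u ⊥ˢ? T ⟧ * (pred b * card T)
          row u (no _)  = trans (cong (b *_) (∑-0 {A = Vect n} (λ _ → refl))) (*-zeroʳ b)
          row u (yes p) with u ⊥ˢ? T
          ... | yes ⊥ = begin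
            b * # (λ v → yes p ×-dec v ∈ˢ? T ×-dec form v u ≟ᶠ 0#)
              ≡⟨ cong (b *_) (#-cong {P? = λ v → yes p ×-dec v ∈ˢ? T ×-dec form v u ≟ᶠ 0#}
                   (λ v (_ , h , _) → h) (λ v h → p , h , ⊥ v h)) ⟩
            b * card T
              ≡⟨ cong (_* card T) (sym (suc-pred b)) ⟩
            card T + pred b * card T
              ≡⟨ cong₂ _+_ (sym (+-identityʳ (card T))) (sym (+-identityʳ (pred b * card T))) ⟩
            1 * card T + 1 * (pred b * card T) ∎
          ... | no ¬⊥ = let (v₀ , v₀∈T , ≢0) = not-⊥ ¬⊥ in begin
            b * # (λ v → yes p ×-dec v ∈ˢ? T ×-dec form v u ≟ᶠ 0#)
              ≡⟨ cong (b *_) (#-cong {P? = λ v → yes p ×-dec v ∈ˢ? T ×-dec form v u ≟ᶠ 0#}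
                   (λ v (_ , h) → h) (λ v h → p , h)) ⟩
            b * # (λ v → v ∈ˢ? T ×-dec form v u ≟ᶠ 0#)
              ≡⟨ #-level sT (linear u) v₀∈T ≢0 0# ⟩
            card T
              ≡⟨ trans (+-identityʳ _) (+-identityʳ _) ⟨
            1 * card T + 0 ∎

      -- The orthogonal pairs in S × T are counted from both sides and b - 1 is cancelled. In
      -- dimensions: dim S - dim (S ∩ T^⊥) = dim T - dim (T ∩ S^⊥).
      perp-card : ∀ {S T} → IsSubspace S → IsSubspace T →
        # (λ u → u ∈ˢ? S ×-dec u ⊥ˢ? T) * card T ≡ # (λ v → v ∈ˢ? T ×-dec v ⊥ˢ? S) * card S
      perp-card {S} {T} sS sT = *-cancelˡ-≡ _ _ (pred b) (begin
        pred b * (S∩T⊥ * card T)   ≡⟨ swap (pred b) S∩T⊥ (card T) ⟩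
        S∩T⊥ * (pred b * card T)   ≡⟨ +-cancelˡ-≡ (card S * card T) _ _ (begin
          card S * card T + S∩T⊥ * (pred b * card T)  ≡⟨ pairs-count S sT ⟨
          b * pairs S T                               ≡⟨ cong (b *_) (pairs-comm S T) ⟩
          b * pairs T S                               ≡⟨ pairs-count T sS ⟩
          card T * card S + T∩S⊥ * (pred b * card S)  ≡⟨ cong (_+ T∩S⊥ * (pred b * card S)) (*-comm (card T) (card S)) ⟩
          card S * card T + T∩S⊥ * (pred b * card S)  ∎) ⟩
        T∩S⊥ * (pred b * card S)   ≡⟨ swap T∩S⊥ (pred b) (card S) ⟩
        pred b * (T∩S⊥ * card S)   ∎)
        where
        open ≡-Reasoning
        S∩T⊥ T∩S⊥ : ℕ
        S∩T⊥ = # (λ u → u ∈ˢ? S ×-dec u ⊥ˢ? T)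
        T∩S⊥ = # (λ v → v ∈ˢ? T ×-dec v ⊥ˢ? S)
        swap : ∀ x y z → x * (y * z) ≡ y * (x * z)
        swap = solve-∀

      perp-⊕ : ∀ {u v w} → form u w ≡ 0# → form v w ≡ 0# → form (u ⊕ v) w ≡ 0#
      perp-⊕ {u} {v} {w} p q = trans (IsLinear.add (linear w) u v) (trans (cong₂ _+ᶠ_ p q) (F.+-identityˡ 0#))

      perp-· : ∀ c {u w} → form u w ≡ 0# → form (c · u) w ≡ 0#
      perp-· c {u} {w} p = trans (IsLinear.mul (linear w) c u) (trans (cong (c *ᶠ_) p) (F.zeroʳ c))

      opaque

        perpOf : Vect n → SubsetV n
        perpOf a u = does (form u a ≟ᶠ 0#)

        perpOf⁺ : ∀ {a u} → form u a ≡ 0# → u ∈ˢ perpOf a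
        perpOf⁺ = dec-true (_ ≟ᶠ 0#)

        perpOf⁻ : ∀ {a u} → u ∈ˢ perpOf a → form u a ≡ 0#
        perpOf⁻ = does⁻ (_ ≟ᶠ 0#)

      form-0 : ∀ w → form 0v w ≡ 0#
      form-0 w = trans (cong (λ t → form t w) (sym (0· 0v)))
                   (trans (IsLinear.mul (linear w) 0# 0v) (F.zeroˡ _))

      perpOf-isSubspace : ∀ a → IsSubspace (perpOf a)
      perpOf-isSubspace a = record
        { has-0    = perpOf⁺ (form-0 a)
        ; closed-⊕ = λ p q → perpOf⁺ (perp-⊕ (perpOf⁻ p) (perpOf⁻ q))
        ; closed-· = λ c p → perpOf⁺ (perp-· c (perpOf⁻ p))
        }

      #-nonperp : ∀ {S} → IsSubspace S → ∀ {v} → ¬ v ⊥ˢ S →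
        b * # (λ u → u ∈ˢ? S ×-dec ¬? (form u v ≟ᶠ 0#)) ≡ pred b * card S
      #-nonperp {S} sS {v} ¬⊥ = let (u₀ , u₀∈S , ≢0) = not-⊥ ¬⊥ in
        +-cancelˡ-≡ (card S) _ _ (begin
          card S + b * # (λ u → u ∈ˢ? S ×-dec ¬? (form u v ≟ᶠ 0#))
            ≡⟨ cong (_+ b * # (λ u → u ∈ˢ? S ×-dec ¬? (form u v ≟ᶠ 0#))) (#-level sS (linear v) u₀∈S ≢0 0#) ⟨
          b * # (λ u → u ∈ˢ? S ×-dec form u v ≟ᶠ 0#) + b * # (λ u → u ∈ˢ? S ×-dec ¬? (form u v ≟ᶠ 0#))
            ≡⟨ *-distribˡ-+ b _ _ ⟨
          b * (# (λ u → u ∈ˢ? S ×-dec form u v ≟ᶠ 0#) + # (λ u → u ∈ˢ? S ×-dec ¬? (form u v ≟ᶠ 0#)))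
            ≡⟨ cong (b *_) (#-split (_∈ˢ? S) (λ u → form u v ≟ᶠ 0#)) ⟨
          b * card S
            ≡⟨ cong (_* card S) (suc-pred b) ⟨
          card S + pred b * card S ∎)
        where open ≡-Reasoning

    module Geometry {n D s : ℕ} {Iso : SubsetV n → Set} (G : PolarGeometry n D s Iso) where
      open PolarGeometry G
      open Perp linear reflexive public
      open TotallyIsotropic

      adjoin-isotropic : ∀ {T a} → TotallyIsotropic form Singular T → Singular a → a ⊥ˢ T → TotallyIsotropic form Singular (adjoin a T)
      adjoin-isotropic {T} {a} iso a-sing a⊥T = record
        { singular = λ {u} h → let (c , p) = adjoin⁻ h in
            subst Singular (⊖-⊕ u (c · a))
              (singular-⊕ (singular iso p) (singular-· c a-sing) (reflexive (perp-· c (reflexive (a⊥T _ p)))))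
        ; perp = λ {u} {v} h h′ → let (c , p) = adjoin⁻ h ; (d , q) = adjoin⁻ h′ in
            subst₂ (λ t t′ → form t t′ ≡ 0#) (⊖-⊕ u (c · a)) (⊖-⊕ v (d · a))
              (perp-⊕ (reflexive (perp-⊕ (perp iso q p) (perp-· d (reflexive (a⊥T _ p)))))
                      (perp-· c (reflexive (perp-⊕ (a⊥T _ q) (perp-· d (singular⇒isotropic a-sing))))))
        }

      -- Otherwise the span of `a` and `S` would be totally isotropic of size b^(D+1), against
      -- `rank`.
      maximal : ∀ {S} → IsSubspace S → TotallyIsotropic form Singular S → card S ≡ b ^ D →
                ∀ {a} → Singular a → a ⊥ˢ S → a ∈ˢ S
      maximal {S} sS iso size {a} a-sing a⊥S = decidable-stable (a ∈ˢ? S) λ a∉S →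
        rank (adjoin-isSubspace sS) (adjoin-isotropic iso a-sing a⊥S)
          (trans (card-adjoin sS a∉S) (cong (b *_) size))

      #-singular-nonperp : ∀ {v} → Singular v → v ≢ 0v →
        b * b * # (λ f → singular? f ×-dec ¬? (form f v ≟ᶠ 0#)) ≡ pred b * (s * b ^ (2 * D))
      #-singular-nonperp {v} v-sing v≢0 = begin
        b * b * N≢           ≡⟨ cong (b * b *_) N≢≡ ⟩
        b * b * (pred b * N) ≡⟨ swap (b * b) (pred b) N ⟩
        pred b * (b * b * N) ≡⟨ cong (pred b *_) (#-singular v-sing v≢0) ⟩
        pred b * (s * b ^ (2 * D)) ∎
        where
        open ≡-Reasoning
        N≢ N : ℕ
        N≢ = # (λ f → singular? f ×-dec ¬? (form f v ≟ᶠ 0#))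
        N  = # (λ f → singular? f ×-dec form f v ≟ᶠ 1#)
        swap : ∀ x y z → x * (y * z) ≡ y * (x * z)
        swap = solve-∀
        #K* : # {A = K} (λ c → ¬? (c ≟ᶠ 0#)) ≡ pred b
        #K* = cong pred (trans (sym (trans (#-split all? (λ c → c ≟ᶠ 0#)) (cong₂ _+_
          (#-one 0# (tt , refl) (λ _ (_ , eq) → eq)) (#-cong (λ _ (_ , h) → h) (λ _ h → tt , h))))) #K)
        -- Multiplication by `c` carries the singular f with form f v = 1 onto those with form f v =
        -- c, so the b - 1 nonzero values are taken equally often.
        scale : ∀ c → c ≢ 0# → # (λ f → (singular? f ×-dec ¬? (form f v ≟ᶠ 0#)) ×-dec form f v ≟ᶠ c) ≡ N
        scale c c≢0 with inverse c c≢0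
        ... | (e , ce≡1) = sym (#-bij _ _ _≟ᵛ_ (c ·_)
          (λ f (h , eq) → let eq′ = trans (IsLinear.mul (linear v) c f) (trans (cong (c *ᶠ_) eq) (F.*-identityʳ c)) in
            (singular-· c h , λ z → c≢0 (trans (sym eq′) z)) , eq′)
          (λ f f′ _ _ eq → trans (sym (undo f)) (trans (cong (e ·_) eq) (undo f′)))
          (λ f ((h , _) , eq) → e · f , (singular-· e h ,
            trans (IsLinear.mul (linear v) e f) (trans (cong (e *ᶠ_) eq) (trans (F.*-comm e c) ce≡1))) ,
            trans (·-assoc c e f) (trans (cong (_· f) ce≡1) (1· f))))
          where
          undo : ∀ f → e · (c · f) ≡ f
          undo f = trans (·-assoc e c f) (trans (cong (_· f) (trans (F.*-comm e c) ce≡1)) (1· f))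
        N≢≡ : N≢ ≡ pred b * N
        N≢≡ = trans (sym (*-identityʳ N≢)) (trans
          (double-count (λ f → singular? f ×-dec ¬? (form f v ≟ᶠ 0#)) (λ f c → form f v ≟ᶠ c) (λ c → ¬? (c ≟ᶠ 0#))
            (λ { f _ (_ , h) refl → h }) (λ f _ → #-one (form f v) refl (λ _ → sym)) scale)
          (cong (_* N) #K*))

      #-singular-off : ∀ {T} → IsSubspace T → TotallyIsotropic form Singular T →
        # (λ f → singular? f ×-dec ¬? (f ⊥ˢ? T)) * (b * card T) ≡ pred (card T) * (s * b ^ (2 * D))
      #-singular-off {T} sT iso = *-cancelˡ-≡ _ _ (b * pred b) ⦃ m*n≢0 b (pred b) ⦄ (begin
        b * pred b * (M * (b * card T))                  ≡⟨ r₁ b (pred b) M (card T) ⟩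
        b * b * (M * (pred b * card T))                  ≡⟨ counted ⟩
        b * (T* * (pred b * (s * b ^ (2 * D))))          ≡⟨ r₂ b (pred b) T* _ ⟩
        b * pred b * (T* * (s * b ^ (2 * D)))            ≡⟨ cong (λ t → b * pred b * (t * (s * b ^ (2 * D)))) T*≡ ⟩
        b * pred b * (pred (card T) * (s * b ^ (2 * D))) ∎)
        where
        open ≡-Reasoning
        M T* : ℕ
        M  = # (λ f → singular? f ×-dec ¬? (f ⊥ˢ? T))
        T* = # (λ v → v ∈ˢ? T ×-dec ¬? (v ≟ᵛ 0v))
        r₁ : ∀ c p m t → c * p * (m * (c * t)) ≡ c * c * (m * (p * t))
        r₁ = solve-∀
        r₂ : ∀ c p t x → c * (t * (p * x)) ≡ c * p * (t * x)
        r₂ = solve-∀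
        T*≡ : T* ≡ pred (card T)
        T*≡ = cong pred (sym (trans (#-split (_∈ˢ? T) (_≟ᵛ 0v)) (cong (_+ T*)
          (#-one 0v (IsSubspace.has-0 sT , refl) (λ _ (_ , eq) → eq)))))
        -- Pairs (f, v) with v in `T` and form v f ≠ 0. For given `f` the v form the complement of a
        -- hyperplane of `T`; for given v ≠ 0 the number of `f` is known; v = 0 occurs in no pair.
        counted : b * b * (M * (pred b * card T)) ≡ b * (T* * (pred b * (s * b ^ (2 * D))))
        counted = weighted-double-count (λ f → singular? f ×-dec ¬? (f ⊥ˢ? T))
          (λ f v → v ∈ˢ? T ×-dec ¬? (form v f ≟ᶠ 0#)) (λ v → v ∈ˢ? T ×-dec ¬? (v ≟ᵛ 0v)) b (b * b)
          (λ { f v _ (v∈T , ≢0) → v∈T , λ { refl → ≢0 (form-0 f) } })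
          (λ f (_ , ¬⊥) → #-nonperp sT ¬⊥)
          (λ v (v∈T , v≢0) → trans
            (cong (b * b *_) (#-cong
              (λ f ((h , _) , _ , ≢0) → h , λ eq → ≢0 (reflexive eq))
              (λ f (h , ≢0) → (h , λ ⊥ → ≢0 (reflexive (⊥ v v∈T))) , v∈T , λ eq → ≢0 (reflexive eq))))
            (#-singular-nonperp (singular iso v∈T) v≢0))

  -- The six kinds of polar spaces

  module FormProperties {b : ℕ} (𝔽 : FiniteField b) where

    open FiniteField 𝔽 renaming (_+_ to _+ᶠ_; _*_ to _*ᶠ_; -_ to -ᶠ_)
    open LinAlg 𝔽
    open FieldProperties 𝔽
    open PolarProperties 𝔽

    +ᶠ-cancel : ∀ x y → x +ᶠ (-ᶠ y) +ᶠ y ≡ x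
    +ᶠ-cancel x y = trans (F.+-assoc x _ y) (trans (cong (x +ᶠ_) (F.-‿inverseˡ y)) (F.+-identityʳ x))

    whole : ∀ {n} → SubsetV n
    whole _ = true

    whole-isSubspace : ∀ {n} → IsSubspace (whole {n})
    whole-isSubspace = record { has-0 = refl ; closed-⊕ = λ _ _ → refl ; closed-· = λ _ _ → refl }

    card-whole : ∀ n → card (whole {n}) ≡ b ^ n
    card-whole n = trans (#-cong (λ _ _ → tt) (λ _ _ → refl)) (#Vect n)

    module _ {n : ℕ} {form : Vect n → Vect n → K} (linear : ∀ v → IsLinear (λ u → form u v))
             (reflexive : ∀ {u v} → form u v ≡ 0# → form v u ≡ 0#)
             {Singular : Vect n → Set} (singular? : ∀ u → Dec (Singular u))
             (nondegenerate : ∀ u → Singular u → (∀ v → form u v ≡ 0#) → u ≡ 0v) where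
      open Perp linear reflexive

      -- As S ⊆ S^⊥ and no nonzero vector of `S` is orthogonal to the whole space, `perp-card` gives
      -- |S|² ≤ |S^⊥| |S| = b^n. For |S| = b^(D+1) this means 2D + 2 ≤ n.
      isotropic-bound : ∀ {D S} → n ≤ suc (2 * D) → IsSubspace S → TotallyIsotropic form Singular S → card S ≢ b ^ suc D
      isotropic-bound {D} {S} n≤ sS iso size = <-irrefl refl (≤-trans (s≤s n≤) (≤-trans (≤-reflexive double) 2+2D≤n))
        where
        open TotallyIsotropic iso
        double : suc (suc (2 * D)) ≡ suc D + suc D
        double = lemma D
          where
          lemma : ∀ k → suc (suc (2 * k)) ≡ suc k + suc k
          lemma = solve-∀
        2+2D≤n : suc D + suc D ≤ n
        2+2D≤n = b^-≤⁻¹ (begin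
          b ^ (suc D + suc D)     ≡⟨ ^-distribˡ-+-* b (suc D) (suc D) ⟩
          b ^ suc D * b ^ suc D   ≡⟨ cong₂ _*_ size size ⟨
          card S * card S         ≤⟨ *-monoˡ-≤ (card S) (#-mono (λ u u∈S → refl , λ v v∈S → perp v∈S u∈S)) ⟩
          # (λ u → u ∈ˢ? whole ×-dec u ⊥ˢ? S) * card S
                                  ≡⟨ perp-card whole-isSubspace sS ⟩
          # (λ v → v ∈ˢ? S ×-dec v ⊥ˢ? whole) * card (whole {n})
                                  ≡⟨ cong₂ _*_ (#-one 0v (IsSubspace.has-0 sS , λ v _ → reflexive (form-0 v))
                                       (λ v (v∈S , ⊥) → nondegenerate v (singular v∈S) (λ w → reflexive (⊥ w refl))))
                                       (card-whole n) ⟩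
          1 * b ^ n               ≡⟨ +-identityʳ _ ⟩
          b ^ n                   ∎)
          where open ≤-Reasoning

      -- The translations f ↦ f + αv act on the affine hyperplane form f v = 1.
      #-singular-by-translation : ∀ {v} → Singular v → form v v ≡ 0# → v ≢ 0v → ∀ k →
        (∀ f → form f v ≡ 1# → # (λ c → singular? (f ⊕ c · v)) ≡ k) →
        b * b * # (λ f → singular? f ×-dec form f v ≟ᶠ 1#) ≡ b ^ n * k
      #-singular-by-translation {v} v-sing vv≡0 v≢0 k fibre = begin
        b * b * N           ≡⟨ *-assoc b b N ⟩
        b * (b * N)         ≡⟨ cong (b *_) (trans (cong (_* N) (sym #K)) (sym counted)) ⟩
        b * (A * k)         ≡⟨ *-assoc b A k ⟨
        b * A * k           ≡⟨ cong (_* k) b*A ⟩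
        b ^ n * k           ∎
        where
        open ≡-Reasoning
        A N : ℕ
        A = # (λ f → form f v ≟ᶠ 1#)
        N = # (λ f → singular? f ×-dec form f v ≟ᶠ 1#)
        b*A : b * A ≡ b ^ n
        b*A = let (f , _ , ≢0) = not-⊥ {v} {whole} (λ ⊥ → v≢0 (nondegenerate v v-sing (λ w → reflexive (⊥ w refl)))) in
          trans (cong (b *_) (#-cong (λ _ h → refl , h) (λ _ (_ , h) → h)))
            (trans (#-level whole-isSubspace (linear v) {f} refl ≢0 1#) (card-whole n))
        shift : ∀ f c → form (f ⊕ c · v) v ≡ form f v
        shift f c = trans (IsLinear.add (linear v) f (c · v)) (trans (cong (form f v +ᶠ_) (perp-· c vv≡0)) (F.+-identityʳ _))
        -- Pairs (f, c) with form f v = 1 and f + c v singular. Translation by c v preserves form f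
        -- v = 1, so every `c` contributes `N`.
        counted : A * k ≡ # {A = K} all? * N
        counted = double-count (λ f → form f v ≟ᶠ 1#) (λ f c → singular? (f ⊕ c · v)) all? (λ _ _ _ _ → tt) fibre
          (λ c _ → #-translate (c · v) _ _ (λ f (h , h′) → h′ , trans (shift f c) h)
            (λ f (h , h′) → trans (sym (shift f c)) h′ , h))

    symplecticGeometry : ∀ D (f : SymplecticForm (2 * D)) → PolarGeometry (2 * D) D b
      (TotallyIsotropicB (SymplecticForm.B f))
    symplecticGeometry D f = record
      { form               = B
      ; linear             = linear
      ; reflexive          = reflexive
      ; Singular           = λ u → B u u ≡ 0#
      ; singular?          = λ u → B u u ≟ᶠ 0#
      ; singular-⊕         = λ _ _ _ → alternating _
      ; singular-·         = λ _ _ → alternating _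
      ; singular⇒isotropic = λ h → h
      ; nondegenerate      = λ u _ → nondegenerate u
      ; #-singular         = λ {v} v-sing v≢0 → trans
          (#-singular-by-translation linear reflexive (λ u → B u u ≟ᶠ 0#) (λ u _ → nondegenerate u) v-sing
            (alternating v) v≢0 b
            (λ g _ → trans (#-cong (λ _ _ → tt) (λ _ _ → alternating _)) #K))
          (*-comm (b ^ (2 * D)) b)
      ; Iso⇒               = λ _ iso → record { singular = λ _ → alternating _ ; perp = iso _ _ }
      ; Iso⇐               = λ iso u v → TotallyIsotropic.perp iso
      ; rank               = isotropic-bound linear reflexive (λ u → B u u ≟ᶠ 0#) (λ u _ → nondegenerate u) {D = D} (n≤1+n _)
      }
      where
      open SymplecticForm f
      open Bilinear bilinear
      linear : ∀ v → IsLinear (λ u → B u v)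
      linear v = record { add = λ u u′ → addˡ u u′ v ; mul = λ c u → mulˡ c u v }
      reflexive : ∀ {u v} → B u v ≡ 0# → B v u ≡ 0#
      reflexive {u} {v} uv≡0 = begin
        B v u                                 ≡⟨ F.+-identityʳ _ ⟨
        B v u +ᶠ 0#                           ≡⟨ cong (B v u +ᶠ_) (alternating v) ⟨
        B v u +ᶠ B v v                        ≡⟨ F.+-identityˡ _ ⟨
        0# +ᶠ (B v u +ᶠ B v v)
          ≡⟨ cong (_+ᶠ (B v u +ᶠ B v v)) (trans (cong₂ _+ᶠ_ (alternating u) uv≡0) (F.+-identityˡ 0#)) ⟨
        (B u u +ᶠ B u v) +ᶠ (B v u +ᶠ B v v)  ≡⟨ cong₂ _+ᶠ_ (addʳ u u v) (addʳ v u v) ⟨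
        B u (u ⊕ v) +ᶠ B v (u ⊕ v)            ≡⟨ addˡ u v (u ⊕ v) ⟨
        B (u ⊕ v) (u ⊕ v)                     ≡⟨ alternating (u ⊕ v) ⟩
        0#                                    ∎
        where open ≡-Reasoning

    -- Quadratic forms

    module _ {n : ℕ} (form : QuadraticForm n) where
      open QuadraticForm form
      open Bilinear polarBilinear

      polar-linear : ∀ v → IsLinear (λ u → polar u v)
      polar-linear v = record { add = λ u u′ → addˡ u u′ v ; mul = λ c u → mulˡ c u v }

      polar-sym : ∀ u v → polar u v ≡ polar v u
      polar-sym u v = trans (F.+-assoc _ _ _) (trans
        (cong₂ _+ᶠ_ (cong Q (⊕-comm u v)) (F.+-comm (-ᶠ Q u) (-ᶠ Q v))) (sym (F.+-assoc _ _ _)))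

      Q-⊕ : ∀ u v → Q (u ⊕ v) ≡ polar u v +ᶠ Q v +ᶠ Q u
      Q-⊕ u v = sym (trans (cong (_+ᶠ Q u) (+ᶠ-cancel _ (Q v))) (+ᶠ-cancel _ (Q u)))

      polar-0 : ∀ {u v} → Q (u ⊕ v) ≡ 0# → Q u ≡ 0# → Q v ≡ 0# → polar u v ≡ 0#
      polar-0 {u} {v} h hu hv = begin
        polar u v                  ≡⟨ F.+-identityʳ _ ⟨
        polar u v +ᶠ 0#            ≡⟨ cong (polar u v +ᶠ_) hv ⟨
        polar u v +ᶠ Q v           ≡⟨ F.+-identityʳ _ ⟨
        polar u v +ᶠ Q v +ᶠ 0#     ≡⟨ cong (polar u v +ᶠ Q v +ᶠ_) hu ⟨
        polar u v +ᶠ Q v +ᶠ Q u    ≡⟨ Q-⊕ u v ⟨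
        Q (u ⊕ v)                  ≡⟨ h ⟩
        0#                         ∎
        where open ≡-Reasoning

      Q-· : ∀ c {u} → Q u ≡ 0# → Q (c · u) ≡ 0#
      Q-· c {u} h = trans (homogeneous c u) (trans (cong (c *ᶠ c *ᶠ_) h) (F.zeroʳ _))

      Q-twice : ∀ {u} → Q u ≡ 0# → Q (u ⊕ u) ≡ 0#
      Q-twice {u} h = trans (cong Q (trans (cong₂ _⊕_ (sym (1· u)) (sym (1· u))) (sym (·-distribʳ 1# 1# u))))
                            (Q-· (1# +ᶠ 1#) h)

      -- If form f v = 1 then Q (f + c v) = Q f + c, so exactly one c gives a singular vector. This
      -- leaves b^(n-2) singular f with form f v = 1, whence s = b^(n-2D).
      quadraticGeometry : ∀ D s → b ^ n ≡ s * b ^ (2 * D) →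
        (∀ {S} → IsSubspace S → TotallyIsotropic polar (λ u → Q u ≡ 0#) S → card S ≢ b ^ suc D) →
        PolarGeometry n D s (TotallySingular form)
      quadraticGeometry D s size rank = record
        { form               = polar
        ; linear             = polar-linear
        ; reflexive          = reflexive
        ; Singular           = λ u → Q u ≡ 0#
        ; singular?          = λ u → Q u ≟ᶠ 0#
        ; singular-⊕         = λ {u} {v} h h′ ⊥ → trans (Q-⊕ u v)
            (trans (cong₂ _+ᶠ_ (trans (cong₂ _+ᶠ_ ⊥ h′) (F.+-identityˡ 0#)) h) (F.+-identityˡ 0#))
        ; singular-·         = Q-·
        ; singular⇒isotropic = isotropic
        ; nondegenerate      = nondegenerate
        ; #-singular         = λ {v} v-sing v≢0 → trans
            (#-singular-by-translation polar-linear reflexive (λ u → Q u ≟ᶠ 0#) nondegenerate v-sing (isotropic v-sing) v≢0 1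
              (λ f fv≡1 → #-one (-ᶠ Q f) (trans (shift v-sing fv≡1) (F.-‿inverseˡ _))
                (λ c eq → F.+-inverseˡ-unique c (Q f) (trans (sym (shift v-sing fv≡1)) eq))))
            (trans (*-identityʳ _) size)
        ; Iso⇒               = λ sS sing → record
            { singular = sing _
            ; perp     = λ h h′ → polar-0 (sing _ (IsSubspace.closed-⊕ sS h h′)) (sing _ h) (sing _ h′) }
        ; Iso⇐               = λ iso u → TotallyIsotropic.singular iso
        ; rank               = rank
        }
        where
        reflexive : ∀ {u v} → polar u v ≡ 0# → polar v u ≡ 0#
        reflexive {u} {v} h = trans (polar-sym v u) h
        isotropic : ∀ {u} → Q u ≡ 0# → polar u u ≡ 0#
        isotropic h = polar-0 (Q-twice h) h h
        shift : ∀ {f v c} → Q v ≡ 0# → polar f v ≡ 1# → Q (f ⊕ c · v) ≡ c +ᶠ Q f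
        shift {f} {v} {c} h fv≡1 = trans (Q-⊕ f (c · v)) (cong (_+ᶠ Q f) (trans
          (cong₂ _+ᶠ_ (trans (mulʳ c f v) (trans (cong (c *ᶠ_) fv≡1) (F.*-identityʳ c))) (Q-· c h)) (F.+-identityʳ c)))

      quadratic-rank : ∀ {D S} → n ≤ suc (2 * D) → IsSubspace S →
        TotallyIsotropic polar (λ u → Q u ≡ 0#) S → card S ≢ b ^ suc D
      quadratic-rank {D} n≤ = isotropic-bound polar-linear (λ {u} {v} h → trans (polar-sym v u) h)
        (λ u → Q u ≟ᶠ 0#) nondegenerate {D = D} n≤

    -- A monic polynomial of degree d, given by its d lower coefficients with the constant term
    -- first; it serves to bound numbers of roots.
    monic : ∀ {d} → Vec K d → K → K
    monic []       x = 1#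
    monic (c ∷ cs) x = c +ᶠ x *ᶠ monic cs x

    monic-0s : ∀ d x → monic (replicate d 0#) x ≡ x ^ᶠ d
    monic-0s zero    x = refl
    monic-0s (suc d) x = trans (F.+-identityˡ _) (cong (x *ᶠ_) (monic-0s d x))

    -- Division by the linear factor at `a`, p(x) = p(a) + (x - a) q(x), written in terms of y = x -
    -- a.
    monic-divide : ∀ {d} (cs : Vec K (suc d)) a → ∃[ qs ]
      (∀ y → monic cs (a +ᶠ y) ≡ monic cs a +ᶠ y *ᶠ monic {d} qs (a +ᶠ y))
    monic-divide (c ∷ [])         a = [] , λ y → trans (cong (c +ᶠ_) (F.distribʳ 1# a y)) (sym (F.+-assoc c _ _))
    monic-divide (c ∷ cs@(_ ∷ _)) a with monic-divide cs a
    ... | (qs , eq) = monic cs a ∷ qs , λ y → let x = a +ᶠ y ; e = monic cs a ; q = monic qs x in begin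
      c +ᶠ x *ᶠ monic cs x                        ≡⟨ cong (λ t → c +ᶠ x *ᶠ t) (eq y) ⟩
      c +ᶠ x *ᶠ (e +ᶠ y *ᶠ q)                     ≡⟨ cong (c +ᶠ_) (F.distribˡ x e _) ⟩
      c +ᶠ (x *ᶠ e +ᶠ x *ᶠ (y *ᶠ q))              ≡⟨ cong₂ (λ s t → c +ᶠ (s +ᶠ t)) (F.distribʳ e a y) (xyq x y q) ⟩
      c +ᶠ (a *ᶠ e +ᶠ y *ᶠ e +ᶠ y *ᶠ (x *ᶠ q))    ≡⟨ cong (c +ᶠ_) (F.+-assoc _ _ _) ⟩
      c +ᶠ (a *ᶠ e +ᶠ (y *ᶠ e +ᶠ y *ᶠ (x *ᶠ q)))  ≡⟨ F.+-assoc c _ _ ⟨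
      c +ᶠ a *ᶠ e +ᶠ (y *ᶠ e +ᶠ y *ᶠ (x *ᶠ q))    ≡⟨ cong (c +ᶠ a *ᶠ e +ᶠ_) (F.distribˡ y e _) ⟨
      c +ᶠ a *ᶠ e +ᶠ y *ᶠ (e +ᶠ x *ᶠ q)           ∎
      where
      open ≡-Reasoning
      xyq : ∀ x y q → x *ᶠ (y *ᶠ q) ≡ y *ᶠ (x *ᶠ q)
      xyq x y q = trans (sym (F.*-assoc x y q)) (trans (cong (_*ᶠ q) (F.*-comm x y)) (F.*-assoc y x q))

    #-roots : ∀ {d} (cs : Vec K d) → # (λ x → monic cs x ≟ᶠ 0#) ≤ d
    #-roots []          = ≤-reflexive (#-none (λ _ eq → 0≢1 (sym eq)))
    #-roots {suc d} cs@(_ ∷ _) with ∃? (λ x → monic cs x ≟ᶠ 0#)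
    ... | no none = ≤-trans (≤-reflexive (#-none (λ x eq → none (x , eq)))) z≤n
    -- Every root other than `a` is a root of the quotient by the linear factor at `a`, whose degree
    -- is one less.
    ... | yes (a , root) with monic-divide cs a
    ...   | (qs , eq) = begin
      # (λ x → monic cs x ≟ᶠ 0#)
        ≡⟨ #-split (λ x → monic cs x ≟ᶠ 0#) (_≟ᶠ a) ⟩
      # (λ x → monic cs x ≟ᶠ 0# ×-dec x ≟ᶠ a) + # (λ x → monic cs x ≟ᶠ 0# ×-dec ¬? (x ≟ᶠ a))
        ≤⟨ +-mono-≤ (≤-reflexive (#-one a (root , refl) (λ _ (_ , x≡a) → x≡a))) (#-mono other) ⟩
      1 + # (λ x → monic qs x ≟ᶠ 0#)
        ≤⟨ s≤s (#-roots qs) ⟩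
      suc d ∎
      where
      open ≤-Reasoning
      other : ∀ x → monic cs x ≡ 0# × x ≢ a → monic qs x ≡ 0#
      other x (root′ , x≢a) = subst (λ t → monic qs t ≡ 0#) x≡ (*ᶠ-cancel-0 y≢0 (E.begin
        y *ᶠ monic qs (a +ᶠ y)                 E.≡⟨ F.+-identityˡ _ ⟨
        0# +ᶠ y *ᶠ monic qs (a +ᶠ y)           E.≡⟨ cong (_+ᶠ y *ᶠ monic qs (a +ᶠ y)) root ⟨
        monic cs a +ᶠ y *ᶠ monic qs (a +ᶠ y)   E.≡⟨ eq y ⟨
        monic cs (a +ᶠ y)                      E.≡⟨ cong (monic cs) x≡ ⟩
        monic cs x                             E.≡⟨ root′ ⟩
        0#                                     E.∎))
        where
        module E = ≡-Reasoning
        y : K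
        y = x +ᶠ (-ᶠ a)
        x≡ : a +ᶠ y ≡ x
        x≡ = trans (F.+-comm a _) (+ᶠ-cancel x a)
        y≢0 : y ≢ 0#
        y≢0 y≡0 = x≢a (sym (trans (sym (F.+-identityʳ a)) (trans (cong (a +ᶠ_) (sym y≡0)) x≡)))

    #-trinomial-roots : ∀ c e r → 2 ≤ r → # (λ x → x ^ᶠ r +ᶠ c *ᶠ x ≟ᶠ e) ≤ r
    #-trinomial-roots c e (suc (suc r)) (s≤s (s≤s _)) =
      ≤-trans (#-mono (λ x h → root x h)) (#-roots ((-ᶠ e) ∷ c ∷ replicate r 0#))
      where
      -- The exponent is at least 2, so the lower coefficients of the polynomial are -e, then c,
      -- then r zeros.
      root : ∀ x → x ^ᶠ suc (suc r) +ᶠ c *ᶠ x ≡ e → monic ((-ᶠ e) ∷ c ∷ replicate r 0#) x ≡ 0#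
      root x h = begin
        (-ᶠ e) +ᶠ x *ᶠ (c +ᶠ x *ᶠ monic (replicate r 0#) x)  ≡⟨ cong (λ t → (-ᶠ e) +ᶠ x *ᶠ (c +ᶠ x *ᶠ t)) (monic-0s r x) ⟩
        (-ᶠ e) +ᶠ x *ᶠ (c +ᶠ x *ᶠ x ^ᶠ r)                    ≡⟨ cong ((-ᶠ e) +ᶠ_) (F.distribˡ x c _) ⟩
        (-ᶠ e) +ᶠ (x *ᶠ c +ᶠ x ^ᶠ suc (suc r))
          ≡⟨ cong ((-ᶠ e) +ᶠ_) (trans (F.+-comm _ _) (cong (x ^ᶠ suc (suc r) +ᶠ_) (F.*-comm x c))) ⟩
        (-ᶠ e) +ᶠ (x ^ᶠ suc (suc r) +ᶠ c *ᶠ x)               ≡⟨ cong ((-ᶠ e) +ᶠ_) h ⟩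
        (-ᶠ e) +ᶠ e                                          ≡⟨ F.-‿inverseˡ e ⟩
        0#                                                   ∎
        where open ≡-Reasoning

    1^ᶠ : ∀ r → 1# ^ᶠ r ≡ 1#
    1^ᶠ zero    = refl
    1^ᶠ (suc r) = trans (F.*-identityˡ _) (1^ᶠ r)

    -- Hermitean forms

    module _ {r n} (r² : r * r ≡ b) (hf : HermiteanForm r n) where
      open HermiteanForm hf

      2≤r : 2 ≤ r
      2≤r with 2 ≤? r
      ... | yes p = p
      ... | no ¬p = contradiction 1<b (≤⇒≯ (≤-trans (≤-reflexive (sym r²)) (*-mono-≤ (≤-pred (≰⇒> ¬p)) (≤-pred (≰⇒> ¬p)))))

      σ-0 : σ 0# ≡ 0#
      σ-0 = lemma r (≤-trans (n≤1+n 1) 2≤r)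
        where
        lemma : ∀ k → 1 ≤ k → 0# ^ᶠ k ≡ 0#
        lemma (suc k) _ = F.zeroˡ _

      H-linear : ∀ v → IsLinear (λ u → H u v)
      H-linear v = record { add = λ u u′ → addˡ u u′ v ; mul = λ c u → mulˡ c u v }

      H-reflexive : ∀ {u v} → H u v ≡ 0# → H v u ≡ 0#
      H-reflexive {u} {v} h = trans (hermitean v u) (trans (cong σ h) σ-0)

      open Perp H-linear H-reflexive

      H-singular-⊕ : ∀ {u v} → H u u ≡ 0# → H v v ≡ 0# → H u v ≡ 0# → H (u ⊕ v) (u ⊕ v) ≡ 0#
      H-singular-⊕ uu vv uv = perp-⊕ (H-reflexive (perp-⊕ uu (H-reflexive uv))) (H-reflexive (perp-⊕ uv vv))

      H-singular-· : ∀ c {u} → H u u ≡ 0# → H (c · u) (c · u) ≡ 0#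
      H-singular-· c uu = perp-· c (H-reflexive (perp-· c uu))

      -- As c varies, H (f + cv) (f + cv) takes values in the at most r fixed points of σ,
      -- each at most r times.  Since b = r², each of these bounds is attained.
      H-fibre : ∀ {v} → H v v ≡ 0# → ∀ f → H f v ≡ 1# → # (λ c → H (f ⊕ c · v) (f ⊕ c · v) ≟ᶠ 0#) ≡ r
      H-fibre {v} vv≡0 f fv≡1 = ≤-antisym (fibre-≤ 0#) (+-cancelʳ-≤ (pred r * r) r _ (begin
        r + pred r * r          ≡⟨ cong (_* r) r≡ ⟩
        r * r                   ≡⟨ r² ⟩
        b                       ≡⟨ #K ⟨
        # {A = K} all?          ≡⟨ #-split all? (λ c → g c ≟ᶠ 0#) ⟩
        # (λ c → all? c ×-dec g c ≟ᶠ 0#) + # (λ c → all? c ×-dec ¬? (g c ≟ᶠ 0#))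
                                ≤⟨ +-mono-≤ (#-mono (λ _ → proj₂)) (#-fibres _ (λ c → σ c ≟ᶠ c ×-dec ¬? (c ≟ᶠ 0#)) _≟ᶠ_ g
                                     (λ c (_ , ≢0) → sym (hermitean _ _) , ≢0) fibre-≤) ⟩
        # (λ c → g c ≟ᶠ 0#) + # (λ c → σ c ≟ᶠ c ×-dec ¬? (c ≟ᶠ 0#)) * r
                                ≤⟨ +-monoʳ-≤ _ (*-monoˡ-≤ r (pred-mono-≤ fixed)) ⟩
        # (λ c → g c ≟ᶠ 0#) + pred r * r ∎))
        where
        open ≤-Reasoning
        r≡ : suc (pred r) ≡ r
        r≡ = suc-pred r ⦃ >-nonZero (≤-trans (n≤1+n 1) 2≤r) ⦄
        g : K → K
        g c = H (f ⊕ c · v) (f ⊕ c · v)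
        g≡ : ∀ c → g c ≡ σ (H f f +ᶠ c) +ᶠ c
        g≡ c = eq
          where
          w : Vect n
          w = f ⊕ c · v
          vw : H v w ≡ 1#
          vw = trans (hermitean v w) (trans (cong σ (trans (addˡ f (c · v) v)
            (trans (cong₂ _+ᶠ_ fv≡1 (perp-· c vv≡0)) (F.+-identityʳ 1#)))) (1^ᶠ r))
          vf : H v f ≡ 1#
          vf = trans (hermitean v f) (trans (cong σ fv≡1) (1^ᶠ r))
          c* : ∀ {d} → d ≡ 1# → c *ᶠ d ≡ c
          c* eq = trans (cong (c *ᶠ_) eq) (F.*-identityʳ c)
          fw : H f w ≡ σ (H f f +ᶠ c)
          fw = trans (hermitean f w) (cong σ (trans (addˡ f (c · v) f) (cong (H f f +ᶠ_) (trans (mulˡ c v f) (c* vf)))))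
          eq : H w w ≡ σ (H f f +ᶠ c) +ᶠ c
          eq = trans (addˡ f (c · v) w) (cong₂ _+ᶠ_ fw (trans (mulˡ c v w) (c* vw)))
        -- With x = H f f + c the equation g c = d becomes x^r + x = d + H f f, which has at most r
        -- solutions.
        fibre-≤ : ∀ d → # (λ c → g c ≟ᶠ d) ≤ r
        fibre-≤ d = ≤-trans
          (#-inj _ (λ x → x ^ᶠ r +ᶠ 1# *ᶠ x ≟ᶠ d +ᶠ H f f) _≟ᶠ_ (H f f +ᶠ_) root (λ _ _ _ _ → F.+-cancelˡ (H f f) _ _))
          (#-trinomial-roots 1# (d +ᶠ H f f) r 2≤r)
          where
          root : ∀ c → g c ≡ d → σ (H f f +ᶠ c) +ᶠ 1# *ᶠ (H f f +ᶠ c) ≡ d +ᶠ H f f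
          root c eq = trans (cong (σ (H f f +ᶠ c) +ᶠ_) (trans (F.*-identityˡ _) (F.+-comm (H f f) c)))
            (trans (sym (F.+-assoc _ c (H f f))) (cong (_+ᶠ H f f) (trans (sym (g≡ c)) eq)))
        -- The fixed points of σ are roots of x^r - x. One of them is 0, which leaves at most r - 1
        -- nonzero values for `g`.
        fixed : suc (# (λ c → σ c ≟ᶠ c ×-dec ¬? (c ≟ᶠ 0#))) ≤ r
        fixed = begin
          suc (# (λ c → σ c ≟ᶠ c ×-dec ¬? (c ≟ᶠ 0#)))
            ≡⟨ cong (_+ # (λ c → σ c ≟ᶠ c ×-dec ¬? (c ≟ᶠ 0#)))
              (#-one {P? = λ c → σ c ≟ᶠ c ×-dec c ≟ᶠ 0#} 0# (σ-0 , refl) (λ _ (_ , eq) → eq)) ⟨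
          # (λ c → σ c ≟ᶠ c ×-dec c ≟ᶠ 0#) + # (λ c → σ c ≟ᶠ c ×-dec ¬? (c ≟ᶠ 0#))
            ≡⟨ #-split (λ c → σ c ≟ᶠ c) (_≟ᶠ 0#) ⟨
          # (λ c → σ c ≟ᶠ c)
            ≤⟨ #-mono (λ c eq → trans (cong₂ _+ᶠ_ eq (F.-1*x≈-x c)) (F.-‿inverseʳ c)) ⟩
          # (λ c → c ^ᶠ r +ᶠ (-ᶠ 1#) *ᶠ c ≟ᶠ 0#)
            ≤⟨ #-trinomial-roots (-ᶠ 1#) 0# r 2≤r ⟩
          r ∎

      -- Each fibre contributes r, so s = b^(n-2D) r with b = r²: this is r³ for n = 2D + 1 and r
      -- for n = 2D.
      hermiteanGeometry : ∀ D s → n ≤ suc (2 * D) → b ^ n * r ≡ s * b ^ (2 * D) →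
        PolarGeometry n D s (TotallyIsotropicB H)
      hermiteanGeometry D s n≤ size = record
        { form               = H
        ; linear             = H-linear
        ; reflexive          = H-reflexive
        ; Singular           = λ u → H u u ≡ 0#
        ; singular?          = λ u → H u u ≟ᶠ 0#
        ; singular-⊕         = H-singular-⊕
        ; singular-·         = H-singular-·
        ; singular⇒isotropic = λ h → h
        ; nondegenerate      = λ u _ → nondegenerate u
        ; #-singular         = λ {v} v-sing v≢0 → trans
            (#-singular-by-translation H-linear H-reflexive (λ u → H u u ≟ᶠ 0#) (λ u _ → nondegenerate u) v-sing v-sing v≢0 r
              (H-fibre v-sing))
            size
        ; Iso⇒               = λ _ iso → record { singular = λ h → iso _ _ h h ; perp = iso _ _ }
        ; Iso⇐               = λ iso u v → TotallyIsotropic.perp iso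
        ; rank               = isotropic-bound H-linear H-reflexive (λ u → H u u ≟ᶠ 0#) (λ u _ → nondegenerate u) {D = D} n≤
        }

    -- q^(2e) as a natural number. By `line-count` it is the number of neighbours of a vertex y that
    -- contain y ∩ z, for a given neighbour z of y.
    lineSize : ∀ {D n} → PolarSpace D n → ℕ
    lineSize (symplectic _)   = b
    lineSize (quadOdd _)      = b
    lineSize (quadHyp _ _)    = 1
    lineSize (quadEll _ _)    = b ^ 2
    lineSize (hermOdd r _ _)  = r ^ 3
    lineSize (hermEven r _ _) = r ^ 1

    q^2e≡ : ∀ {D n} (P : PolarSpace D n) → q^2e P ≡ ℕtoℚ (lineSize P)
    q^2e≡ (symplectic _)   = refl
    q^2e≡ (quadOdd _)      = refl
    q^2e≡ (quadHyp _ _)    = refl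
    q^2e≡ (quadEll _ _)    = refl
    q^2e≡ (hermOdd _ _ _)  = refl
    q^2e≡ (hermEven _ _ _) = refl

    geometry : ∀ {D n} (P : PolarSpace D n) → PolarGeometry n D (lineSize P) (Isotropic P)
    geometry {D} (symplectic f) = symplecticGeometry D f
    geometry {D} (quadOdd Q)    = quadraticGeometry Q D b refl (quadratic-rank Q {D} ≤-refl)
    geometry {D} (quadHyp Q _)  = quadraticGeometry Q D 1 (sym (+-identityʳ _)) (quadratic-rank Q {D} (n≤1+n _))
    -- In dimension 2D + 2 the bound by dimension would allow a totally singular subspace of
    -- dimension D + 1; the Witt index excludes it.
    geometry {D} (quadEll Q (_ , none)) = quadraticGeometry Q D (b ^ 2)
      (trans (^-distribˡ-+-* b (2 * D) 2) (*-comm (b ^ (2 * D)) (b ^ 2)))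
      (λ {S} sS iso size → none (S , card⇒HasDim sS size , λ u → TotallyIsotropic.singular iso))
    geometry {D} (hermOdd r r² h) = hermiteanGeometry r² h D (r ^ 3) ≤-refl
      (trans (cong (λ t → t * b ^ (2 * D) * r) (sym r²)) (cube r (b ^ (2 * D))))
      where
      cube : ∀ r x → r * r * x * r ≡ r * (r * (r * 1)) * x
      cube = solve-∀
    geometry {D} (hermEven r r² h) = hermiteanGeometry r² h D (r ^ 1) (n≤1+n _)
      (trans (*-comm _ r) (cong (_* b ^ (2 * D)) (sym (*-identityʳ r))))

  -- Dual polar graphs

  instance
    Fin-finite : ∀ {m} → Finite (Fin m)
    Fin-finite {m} = record { list = allFin m ; unique = Unique.allFin⁺ m ; complete = ∈-allFin }

  module DualPolarGraph {b : ℕ} (𝔽 : FiniteField b) {n D s : ℕ} {Iso : LinAlg.SubsetV 𝔽 n → Set}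
    (G : PolarProperties.PolarGeometry 𝔽 n D s Iso)
    {m : ℕ} {sub : Fin m → LinAlg.SubsetV 𝔽 n}
    (vertex-dim : ∀ y → LinAlg.HasDim 𝔽 (sub y) D)
    (vertex-iso : ∀ y → Iso (sub y))
    (injective : ∀ y z → (∀ u → sub y u ≡ sub z u) → y ≡ z)
    (surjective : ∀ S → LinAlg.HasDim 𝔽 S D → Iso S → ∃[ y ] (∀ u → S u ≡ sub y u))
    {dist : Fin m → Fin m → ℕ} (isDistance : LinAlg.IsDistance 𝔽 D m sub dist)
    where

    open FiniteField 𝔽 using (0#; 1#)
    open LinAlg 𝔽
    open FieldProperties 𝔽
    open PolarProperties 𝔽
    open PolarGeometry G
    open Geometry G

    -- The Gaussian integer [k] = (b^k - 1) / (b - 1); `qnum-spec` expresses this without division.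
    qnum : ℕ → ℕ
    qnum zero    = 0
    qnum (suc k) = 1 + b * qnum k

    qnum-spec : ∀ k → pred b * qnum k + 1 ≡ b ^ k
    qnum-spec zero    = cong (_+ 1) (*-zeroʳ (pred b))
    qnum-spec (suc k) = begin
      pred b * (1 + b * qnum k) + 1      ≡⟨ r₁ (pred b) b (qnum k) ⟩
      suc (pred b) + b * (pred b * qnum k) ≡⟨ cong (_+ b * (pred b * qnum k)) (suc-pred b) ⟩
      b + b * (pred b * qnum k)          ≡⟨ r₂ b (pred b * qnum k) ⟩
      b * (pred b * qnum k + 1)          ≡⟨ cong (b *_) (qnum-spec k) ⟩
      b ^ suc k                          ∎
      where
      open ≡-Reasoning
      r₁ : ∀ p c q → p * (1 + c * q) + 1 ≡ suc p + c * (p * q)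
      r₁ = solve-∀
      r₂ : ∀ c x → c + c * x ≡ c * (x + 1)
      r₂ = solve-∀

    qnum-unique : ∀ {x} k → pred b * x + 1 ≡ b ^ k → x ≡ qnum k
    qnum-unique k eq = *-cancelˡ-≡ _ _ (pred b) (+-cancelʳ-≡ 1 _ _ (trans eq (sym (qnum-spec k))))

    vertex-sub : ∀ y → IsSubspace (sub y)
    vertex-sub y = HasDim⇒IsSubspace (vertex-dim y)

    vertex-ti : ∀ y → TotallyIsotropic form Singular (sub y)
    vertex-ti y = Iso⇒ (vertex-sub y) (vertex-iso y)

    vertex-perp : ∀ y {u v} → u ∈ˢ sub y → v ∈ˢ sub y → form u v ≡ 0#
    vertex-perp y = TotallyIsotropic.perp (vertex-ti y)

    vertex-singular : ∀ y {u} → u ∈ˢ sub y → Singular u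
    vertex-singular y = TotallyIsotropic.singular (vertex-ti y)

    vertex-card : ∀ y → card (sub y) ≡ b ^ D
    vertex-card y = HasDim⇒card (vertex-dim y)

    vertex-max : ∀ y {a} → Singular a → a ⊥ˢ sub y → a ∈ˢ sub y
    vertex-max y = maximal (vertex-sub y) (vertex-ti y) (vertex-card y)

    meet : Fin m → Fin m → SubsetV n
    meet y z = sub y ∩ sub z

    meet⁺ : ∀ {y z u} → u ∈ˢ sub y → u ∈ˢ sub z → u ∈ˢ meet y z
    meet⁺ {y} {z} = ∩⁺ {S = sub y} {sub z}

    meetˡ : ∀ {y z u} → u ∈ˢ meet y z → u ∈ˢ sub y
    meetˡ {y} {z} = ∩⁻ˡ {S = sub y} {sub z}

    meetʳ : ∀ {y z u} → u ∈ˢ meet y z → u ∈ˢ sub z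
    meetʳ {y} {z} = ∩⁻ʳ {S = sub y} {sub z}

    meet-sub : ∀ y z → IsSubspace (meet y z)
    meet-sub y z = ∩-isSubspace (vertex-sub y) (vertex-sub z)

    meet-card : ∀ y z → card (meet y z) ≡ b ^ (D ∸ dist y z)
    meet-card y z = HasDim⇒card (proj₂ (isDistance y z))

    dist≤D : ∀ y z → dist y z ≤ D
    dist≤D y z = proj₁ (isDistance y z)

    ⊆ˢ⇒≡ : ∀ {y z} → sub y ⊆ˢ sub z → y ≡ z
    ⊆ˢ⇒≡ {y} {z} y⊆z = injective y z (λ u → ext (sub y u) (sub z u) (y⊆z u)
      (card-⊇ y⊆z (≤-reflexive (trans (vertex-card z) (sym (vertex-card y)))) u))
      where
      ext : ∀ p q → (p ≡ true → q ≡ true) → (q ≡ true → p ≡ true) → p ≡ q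
      ext false false _ _ = refl
      ext false true  _ g = g refl
      ext true  q     f _ = sym (f refl)

    codim-≤ : ∀ {j k} → k ≤ D → b ^ (D ∸ j) ≤ b ^ (D ∸ k) → k ≤ j
    codim-≤ k≤D le = ∸-cancelʳ-≤ k≤D (b^-≤⁻¹ le)

    codim-≡ : ∀ {j k} → j ≤ D → k ≤ D → b ^ (D ∸ j) ≡ b ^ (D ∸ k) → j ≡ k
    codim-≡ j≤D k≤D eq = ∸-cancelˡ-≡ j≤D k≤D (b^-injective eq)

    dist-sym : ∀ y z → dist y z ≡ dist z y
    dist-sym y z = codim-≡ (dist≤D y z) (dist≤D z y) (trans (sym (meet-card y z)) (trans
      (#-cong (λ u h → meet⁺ {z} {y} (meetʳ {y} {z} h) (meetˡ {y} {z} h))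
              (λ u h → meet⁺ {y} {z} (meetʳ {z} {y} h) (meetˡ {z} {y} h)))
      (meet-card z y)))

    dist-refl : ∀ y → dist y y ≡ 0
    dist-refl y = codim-≡ (dist≤D y y) z≤n (trans (sym (meet-card y y)) (trans
      (#-cong (λ u h → meetˡ {y} {y} h) (λ u h → meet⁺ {y} {y} h h)) (vertex-card y)))

    dist≡0⇒≡ : ∀ {y z} → dist y z ≡ 0 → y ≡ z
    dist≡0⇒≡ {y} {z} eq = ⊆ˢ⇒≡ (λ u h → meetʳ {y} {z} (card-⊇ {S = meet y z} {sub y} (λ _ → meetˡ {y} {z})
      (≤-reflexive (trans (vertex-card y) (sym (trans (meet-card y z) (cong (λ d → b ^ (D ∸ d)) eq))))) u h))

    triple : Fin m → Fin m → Fin m → SubsetV n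
    triple x y z = meet x y ∩ sub z

    triple⁺ : ∀ {x y z u} → u ∈ˢ sub x → u ∈ˢ sub y → u ∈ˢ sub z → u ∈ˢ triple x y z
    triple⁺ {x} {y} {z} h h′ h″ = ∩⁺ {S = meet x y} {sub z} (meet⁺ {x} {y} h h′) h″

    triple⁻ : ∀ {x y z u} → u ∈ˢ triple x y z → u ∈ˢ sub x × u ∈ˢ sub y × u ∈ˢ sub z
    triple⁻ {x} {y} {z} h = let h′ = ∩⁻ˡ {S = meet x y} {sub z} h in
      meetˡ {x} {y} h′ , meetʳ {x} {y} h′ , ∩⁻ʳ {S = meet x y} {sub z} h

    triple-sub : ∀ x y z → IsSubspace (triple x y z)
    triple-sub x y z = ∩-isSubspace (meet-sub x y) (vertex-sub z)

    opaque
      -- The codimension D - dim (x ∩ y ∩ z), an analogue of `dist` for three vertices. Being a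
      -- codimension it can be compared with distances directly.
      ρ : Fin m → Fin m → Fin m → ℕ
      ρ x y z = D ∸ proj₁ (hasDim (triple-sub x y z))

      ρ≤D : ∀ x y z → ρ x y z ≤ D
      ρ≤D x y z = m∸n≤m D (proj₁ (hasDim (triple-sub x y z)))

      triple-card : ∀ x y z → card (triple x y z) ≡ b ^ (D ∸ ρ x y z)
      triple-card x y z = trans (HasDim⇒card dimension) (cong (b ^_) (sym (m∸[m∸n]≡n {D} {t} (b^-≤⁻¹ {t} {D} (begin
        b ^ t                ≡⟨ HasDim⇒card dimension ⟨
        card (triple x y z)  ≤⟨ card-mono {S = triple x y z} {sub x} (λ u h → proj₁ (triple⁻ {x} {y} {z} h)) ⟩
        card (sub x)         ≡⟨ vertex-card x ⟩
        b ^ D                ∎)))))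
        where
        open ≤-Reasoning
        t : ℕ
        t = proj₁ (hasDim (triple-sub x y z))
        dimension : HasDim (triple x y z) t
        dimension = proj₂ (hasDim (triple-sub x y z))

    ρ-swapˡ : ∀ x y z → ρ x y z ≡ ρ y x z
    ρ-swapˡ x y z = codim-≡ (ρ≤D x y z) (ρ≤D y x z) (trans (sym (triple-card x y z)) (trans
      (#-cong (λ u h → let (p , q , r) = triple⁻ {x} {y} {z} h in triple⁺ {y} {x} {z} q p r)
              (λ u h → let (p , q , r) = triple⁻ {y} {x} {z} h in triple⁺ {x} {y} {z} q p r))
      (triple-card y x z)))

    ρ-swapʳ : ∀ x y z → ρ x y z ≡ ρ x z y
    ρ-swapʳ x y z = codim-≡ (ρ≤D x y z) (ρ≤D x z y) (trans (sym (triple-card x y z)) (trans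
      (#-cong (λ u h → let (p , q , r) = triple⁻ {x} {y} {z} h in triple⁺ {x} {z} {y} p r q)
              (λ u h → let (p , q , r) = triple⁻ {x} {z} {y} h in triple⁺ {x} {y} {z} p r q))
      (triple-card x z y)))

    dist≤ρ : ∀ x y z → dist x y ≤ ρ x y z
    dist≤ρ x y z = codim-≤ (dist≤D x y) (begin
      b ^ (D ∸ ρ x y z)    ≡⟨ triple-card x y z ⟨
      card (triple x y z)  ≤⟨ card-mono {S = triple x y z} {meet x y} (λ _ → ∩⁻ˡ {S = meet x y} {sub z}) ⟩
      card (meet x y)      ≡⟨ meet-card x y ⟩
      b ^ (D ∸ dist x y)   ∎)
      where open ≤-Reasoning

    ⊆⇒ρ≡ : ∀ {x y z} → meet x y ⊆ˢ sub z → ρ x y z ≡ dist x y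
    ⊆⇒ρ≡ {x} {y} {z} sub⊆ = codim-≡ (ρ≤D x y z) (dist≤D x y) (trans (sym (triple-card x y z)) (trans
      (#-cong (λ _ → ∩⁻ˡ {S = meet x y} {sub z}) (λ u h → ∩⁺ {S = meet x y} {sub z} h (sub⊆ u h)))
      (meet-card x y)))

    ρ≤⇒⊆ : ∀ {x y z} → ρ x y z ≤ dist x y → meet x y ⊆ˢ sub z
    ρ≤⇒⊆ {x} {y} {z} le u h = ∩⁻ʳ {S = meet x y} {sub z} (card-⊇ {S = triple x y z} {meet x y}
      (λ _ → ∩⁻ˡ {S = meet x y} {sub z}) (begin
        card (meet x y)      ≡⟨ meet-card x y ⟩
        b ^ (D ∸ dist x y)   ≤⟨ ^-monoʳ-≤ b (∸-monoʳ-≤ D le) ⟩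
        b ^ (D ∸ ρ x y z)    ≡⟨ triple-card x y z ⟨
        card (triple x y z)  ∎) u h)
      where open ≤-Reasoning

    -- Maximality of y bounds the part of x ∩ z outside y by the codimension of x ∩ y + y ∩ z in y.
    ρ-triangle : ∀ x y z → ρ x y z + ρ x y z ≤ dist x y + dist y z + dist x z
    ρ-triangle x y z = codims (dist≤D x y) (dist≤D y z) (dist≤D x z) (ρ≤D x y z) (b^-≤⁻¹ (begin
      b ^ ((D ∸ dist x y) + (D ∸ dist y z) + (D ∸ dist x z))
        ≡⟨ trans (^-distribˡ-+-* b ((D ∸ dist x y) + (D ∸ dist y z)) (D ∸ dist x z))
          (cong (_* b ^ (D ∸ dist x z)) (^-distribˡ-+-* b (D ∸ dist x y) (D ∸ dist y z))) ⟩
      b ^ (D ∸ dist x y) * b ^ (D ∸ dist y z) * b ^ (D ∸ dist x z)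
        ≡⟨ cong₂ _*_ (cong₂ _*_ (meet-card x y) (meet-card y z)) (meet-card x z) ⟨
      card (meet x y) * card (meet y z) * card (meet x z)
        ≤⟨ *-monoˡ-≤ (card (meet x z))
          (card-sum (meet-sub x y) (meet-sub y z) (λ u → u ∈ˢ? sub y ×-dec u ⊥ˢ? meet x z) sum∈) ⟩
      A * card (meet x y ∩ meet y z) * card (meet x z)
        ≡⟨ r₁ A (card (meet x y ∩ meet y z)) (card (meet x z)) ⟩
      card (meet x y ∩ meet y z) * (A * card (meet x z))
        -- The bound on y ∩ (x ∩ z)^⊥ is exchanged for one on (x ∩ z) ∩ y^⊥, which by maximality of
        -- `y` lies in x ∩ y ∩ z.
        ≡⟨ cong₂ _*_ same (perp-card (vertex-sub y) (meet-sub x z)) ⟩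
      card (triple x y z) * (# (λ v → v ∈ˢ? meet x z ×-dec v ⊥ˢ? sub y) * card (sub y))
        ≤⟨ *-monoʳ-≤ (card (triple x y z)) (*-monoˡ-≤ (card (sub y)) (#-mono perp⇒)) ⟩
      card (triple x y z) * (card (triple x y z) * card (sub y))
        ≡⟨ cong₂ (λ t c → t * (t * c)) (triple-card x y z) (vertex-card y) ⟩
      b ^ (D ∸ ρ x y z) * (b ^ (D ∸ ρ x y z) * b ^ D)
        ≡⟨ trans (^-distribˡ-+-* b (D ∸ ρ x y z) _) (cong (b ^ (D ∸ ρ x y z) *_) (^-distribˡ-+-* b (D ∸ ρ x y z) D)) ⟨
      b ^ ((D ∸ ρ x y z) + ((D ∸ ρ x y z) + D)) ∎))
      where
      open ≤-Reasoning
      A : ℕ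
      A = # (λ u → u ∈ˢ? sub y ×-dec u ⊥ˢ? meet x z)
      r₁ : ∀ a t c → a * t * c ≡ t * (a * c)
      r₁ = solve-∀
      sum∈ : ∀ u v → u ∈ˢ meet x y → v ∈ˢ meet y z → (u ⊕ v) ∈ˢ sub y × (u ⊕ v) ⊥ˢ meet x z
      sum∈ u v h h′ = IsSubspace.closed-⊕ (vertex-sub y) (meetʳ {x} {y} h) (meetˡ {y} {z} h′) ,
        λ w h″ → reflexive (perp-⊕ (vertex-perp x (meetˡ {x} {y} h) (meetˡ {x} {z} h″))
                                   (vertex-perp z (meetʳ {y} {z} h′) (meetʳ {x} {z} h″)))
      same : card (meet x y ∩ meet y z) ≡ card (triple x y z)
      same = #-cong
        (λ u h → let h₁ = ∩⁻ˡ {S = meet x y} {meet y z} h ; h₂ = ∩⁻ʳ {S = meet x y} {meet y z} h in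
          ∩⁺ {S = meet x y} {sub z} h₁ (meetʳ {y} {z} h₂))
        (λ u h → let (p , q , r) = triple⁻ {x} {y} {z} h in
          ∩⁺ {S = meet x y} {meet y z} (meet⁺ {x} {y} p q) (meet⁺ {y} {z} q r))
      perp⇒ : ∀ v → v ∈ˢ meet x z × v ⊥ˢ sub y → v ∈ˢ triple x y z
      perp⇒ v (h , ⊥) = triple⁺ {x} {y} {z} (meetˡ {x} {z} h)
        (vertex-max y (vertex-singular x (meetˡ {x} {z} h)) ⊥) (meetʳ {x} {z} h)
      codims : ∀ {i j k r} → i ≤ D → j ≤ D → k ≤ D → r ≤ D →
        (D ∸ i) + (D ∸ j) + (D ∸ k) ≤ (D ∸ r) + ((D ∸ r) + D) → r + r ≤ i + j + k
      codims {i} {j} {k} {r} i≤ j≤ k≤ r≤ le = +-cancelʳ-≤ (D + D + D) _ _ (begin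
        r + r + (D + D + D)
          ≡⟨ cong (λ d → r + r + d) (cong₂ _+_ (cong₂ _+_ (m+[n∸m]≡n i≤) (m+[n∸m]≡n j≤)) (m+[n∸m]≡n k≤)) ⟨
        r + r + (i + (D ∸ i) + (j + (D ∸ j)) + (k + (D ∸ k)))
          ≡⟨ p₁ r i j k (D ∸ i) (D ∸ j) (D ∸ k) ⟩
        r + r + (i + j + k) + ((D ∸ i) + (D ∸ j) + (D ∸ k))
          ≤⟨ +-monoʳ-≤ (r + r + (i + j + k)) le ⟩
        r + r + (i + j + k) + ((D ∸ r) + ((D ∸ r) + D))
          ≡⟨ p₂ r (i + j + k) (D ∸ r) D ⟩
        i + j + k + (r + (D ∸ r) + (r + (D ∸ r)) + D)
          ≡⟨ cong (λ d → i + j + k + (d + d + D)) (m+[n∸m]≡n r≤) ⟩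
        i + j + k + (D + D + D) ∎)
        where
        p₁ : ∀ r i j k i′ j′ k′ → r + r + (i + i′ + (j + j′) + (k + k′)) ≡ r + r + (i + j + k) + (i′ + j′ + k′)
        p₁ = solve-∀
        p₂ : ∀ r t r′ d → r + r + t + (r′ + (r′ + d)) ≡ t + (r + r′ + (r + r′) + d)
        p₂ = solve-∀

    -- Since ∂(x, z) ≤ ρ, the bound on 2ρ by the sum of the three distances already contains the
    -- triangle inequality.
    dist-triangle : ∀ x y z → dist x z ≤ dist x y + dist y z
    dist-triangle x y z = +-cancelʳ-≤ (dist x z) _ _ (≤-trans
      (+-mono-≤ xz≤ρ xz≤ρ) (ρ-triangle x y z))
      where
      xz≤ρ : dist x z ≤ ρ x y z
      xz≤ρ = ≤-trans (dist≤ρ x z y) (≤-reflexive (ρ-swapʳ x z y))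

    adjacent-card : ∀ {y w} → dist y w ≡ 1 → b * card (meet y w) ≡ b ^ D
    adjacent-card {y} {w} adj = trans (cong (b *_) (trans (meet-card y w) (cong (λ d → b ^ (D ∸ d)) adj)))
      (cong (b ^_) (m+[n∸m]≡n (subst (_≤ D) adj (dist≤D y w))))

    module _ {y : Fin m} {a : Vect n} (a-sing : Singular a) (a∉y : ¬ a ∈ˢ sub y) where

      a^⊥ : SubsetV n
      a^⊥ = sub y ∩ perpOf a

      a^⊥-sub : IsSubspace a^⊥
      a^⊥-sub = ∩-isSubspace (vertex-sub y) (perpOf-isSubspace a)

      a^⊥⁺ : ∀ {u} → u ∈ˢ sub y → form u a ≡ 0# → u ∈ˢ a^⊥
      a^⊥⁺ h ⊥ = ∩⁺ {S = sub y} {perpOf a} h (perpOf⁺ ⊥)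

      a^⊥⁻ : ∀ {u} → u ∈ˢ a^⊥ → u ∈ˢ sub y × form u a ≡ 0#
      a^⊥⁻ h = ∩⁻ˡ {S = sub y} {perpOf a} h , perpOf⁻ (∩⁻ʳ {S = sub y} {perpOf a} h)

      -- By maximality of `y` the vector `a` is not orthogonal to all of it, so y ∩ a^⊥ is a
      -- hyperplane of `y`.
      a^⊥-card : b * card a^⊥ ≡ b ^ D
      a^⊥-card = let (u , u∈y , ≢0) = not-⊥ (λ ⊥ → a∉y (vertex-max y a-sing ⊥)) in trans
        (cong (b *_) (#-cong (λ _ → a^⊥⁻) (λ _ (h , ⊥) → a^⊥⁺ h ⊥)))
        (trans (#-level (vertex-sub y) (linear a) u∈y ≢0 0#) (vertex-card y))

      -- Both y ∩ w and y ∩ a^⊥ are hyperplanes of `y`, and the first lies in the second because `w`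
      -- is totally isotropic and contains `a`. So they coincide.
      adjacent-perp : ∀ {w} → dist y w ≡ 1 → a ∈ˢ sub w → ∀ {u} → u ∈ˢ sub y → form u a ≡ 0# → u ∈ˢ sub w
      adjacent-perp {w} adj a∈w {u} u∈y ⊥ = meetʳ {y} {w} (card-⊇ {S = meet y w} {a^⊥}
        (λ v h → a^⊥⁺ (meetˡ {y} {w} h) (vertex-perp w (meetʳ {y} {w} h) a∈w))
        (≤-reflexive (*-cancelˡ-≡ _ _ b (trans a^⊥-card (sym (adjacent-card adj))))) u (a^⊥⁺ u∈y ⊥))

      span : SubsetV n
      span = adjoin a a^⊥

      span-card : card span ≡ b ^ D
      span-card = trans (card-adjoin a^⊥-sub (λ h → a∉y (proj₁ (a^⊥⁻ h)))) a^⊥-card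

      span-iso : TotallyIsotropic form Singular span
      span-iso = adjoin-isotropic (record
        { singular = λ h → vertex-singular y (proj₁ (a^⊥⁻ h))
        ; perp     = λ h h′ → vertex-perp y (proj₁ (a^⊥⁻ h)) (proj₁ (a^⊥⁻ h′)) })
        a-sing (λ v h → proj₂ (a^⊥⁻ h))

      -- By `adjacent-perp` every neighbour through `a` contains `span`, which already has the size
      -- of a vertex; this gives uniqueness.
      neighbour-through : ∃[ w ] (dist y w ≡ 1 × a ∈ˢ sub w × (∀ w′ → dist y w′ ≡ 1 → a ∈ˢ sub w′ → w′ ≡ w))
      neighbour-through = w , adj , a∈w , only
        where
        found : ∃[ w ] (∀ u → span u ≡ sub w u)
        found = surjective span (card⇒HasDim (adjoin-isSubspace a^⊥-sub) span-card) (Iso⇐ span-iso)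
        w : Fin m
        w = proj₁ found
        span⊆w : span ⊆ˢ sub w
        span⊆w u h = trans (sym (proj₂ found u)) h
        w⊆span : sub w ⊆ˢ span
        w⊆span u h = trans (proj₂ found u) h
        a∈w : a ∈ˢ sub w
        a∈w = span⊆w a (adjoin-∋ a^⊥-sub)
        size : card (meet y w) ≡ card a^⊥
        size = #-cong (λ u h → a^⊥⁺ (meetˡ {y} {w} h) (vertex-perp w (meetʳ {y} {w} h) a∈w))
                      (λ u h → meet⁺ {y} {w} (proj₁ (a^⊥⁻ h)) (span⊆w u (adjoin-⊆ u h)))
        adj : dist y w ≡ 1
        adj = +-cancelʳ-≡ (D ∸ dist y w) (dist y w) 1
          (trans (m+[n∸m]≡n (dist≤D y w)) (sym (b^-injective {suc (D ∸ dist y w)} {D} (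
          trans (cong (b *_) (trans (sym (meet-card y w)) size)) a^⊥-card))))
        only : ∀ w′ → dist y w′ ≡ 1 → a ∈ˢ sub w′ → w′ ≡ w
        only w′ adj′ a∈w′ = sym (⊆ˢ⇒≡ {w} {w′} (λ u h → span⊆w′ u (w⊆span u h)))
          where
          span⊆w′ : span ⊆ˢ sub w′
          span⊆w′ u h = let (c , p) = adjoin⁻ {T = a^⊥} h in subst (_∈ˢ sub w′) (⊖-⊕ u (c · a))
            (IsSubspace.closed-⊕ (vertex-sub w′) (adjacent-perp adj′ a∈w′ (proj₁ (a^⊥⁻ p)) (proj₂ (a^⊥⁻ p)))
              (IsSubspace.closed-· (vertex-sub w′) c a∈w′))

    -- Neighbours of one vertex that are closer to another

    module _ {y z : Fin m} {T : SubsetV n} (sT : IsSubspace T) (T⊆y : T ⊆ˢ sub y) where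

      Between : Fin m → Set
      Between w = dist y w ≡ 1 × suc (dist w z) ≡ dist y z × T ⊆ˢ sub w

      between? : ∀ w → Dec (Between w)
      between? w = dist y w ≟ 1 ×-dec suc (dist w z) ≟ dist y z ×-dec T ⊆ˢ? sub w

      -- The three distances add up to 2 ∂(y, z), so `ρ-triangle` forces y ∩ z ⊆ w. Thus y ∩ z is
      -- the part of w ∩ z inside `y`, and it is a hyperplane of w ∩ z.
      between-row : ∀ w → Between w →
        # (λ a → a ∈ˢ? meet w z ×-dec ¬? (a ∈ˢ? sub y)) ≡ pred b * b ^ (D ∸ dist y z)
      between-row w (adj , closer , _) = +-cancelˡ-≡ (b ^ (D ∸ dist y z)) _ _ (begin
        b ^ (D ∸ dist y z) + # (λ a → a ∈ˢ? meet w z ×-dec ¬? (a ∈ˢ? sub y))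
          ≡⟨ cong (_+ # (λ a → a ∈ˢ? meet w z ×-dec ¬? (a ∈ˢ? sub y))) (trans (sym (meet-card y z)) (#-cong
               (λ a h → meet⁺ {w} {z} (y∩z⊆w a h) (meetʳ {y} {z} h) , meetˡ {y} {z} h)
               (λ a (h , h′) → meet⁺ {y} {z} h′ (meetʳ {w} {z} h)))) ⟩
        # (λ a → a ∈ˢ? meet w z ×-dec a ∈ˢ? sub y) + # (λ a → a ∈ˢ? meet w z ×-dec ¬? (a ∈ˢ? sub y))
          ≡⟨ #-split (_∈ˢ? meet w z) (_∈ˢ? sub y) ⟨
        card (meet w z)
          ≡⟨ meet-card w z ⟩
        b ^ (D ∸ dist w z)
          ≡⟨ cong (b ^_) (+-∸-assoc 1 (subst (_≤ D) (sym closer) (dist≤D y z))) ⟩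
        b * b ^ (D ∸ suc (dist w z))
          ≡⟨ cong (λ d → b * b ^ (D ∸ d)) closer ⟩
        b * b ^ (D ∸ dist y z)
          ≡⟨ cong (_* b ^ (D ∸ dist y z)) (suc-pred b) ⟨
        b ^ (D ∸ dist y z) + pred b * b ^ (D ∸ dist y z) ∎)
        where
        open ≡-Reasoning
        double : ∀ {i} → i + i ≤ dist y z + dist y z → i ≤ dist y z
        double {i} le with i ≤? dist y z
        ... | yes p = p
        ... | no ¬p = contradiction le (<⇒≱ (+-mono-< (≰⇒> ¬p) (≰⇒> ¬p)))
        sum : dist y z + dist z w + dist y w ≡ dist y z + dist y z
        sum = trans (+-assoc (dist y z) _ _) (cong (dist y z +_)
          (trans (cong₂ _+_ (dist-sym z w) adj) (trans (+-comm (dist w z) 1) closer)))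
        y∩z⊆w : meet y z ⊆ˢ sub w
        y∩z⊆w = ρ≤⇒⊆ {y} {z} {w} (double (≤-trans (ρ-triangle y z w) (≤-reflexive sum)))

      -- The unique neighbour through `a` contains y ∩ a^⊥, hence both `T` and y ∩ z. It meets `z`
      -- also in `a`, so it is closer to `z` than `y` is.
      between-column : ∀ a → (a ∈ˢ sub z × a ⊥ˢ T) × ¬ a ∈ˢ sub y →
        # (λ w → between? w ×-dec a ∈ˢ? meet w z ×-dec ¬? (a ∈ˢ? sub y)) ≡ 1
      between-column a ((a∈z , a⊥T) , a∉y) = #-one w
        ((adj , closer , λ u h → adjacent-perp a-sing a∉y adj a∈w (T⊆y u h) (a⊥T u h)) , meet⁺ {w} {z} a∈w a∈z , a∉y)
        (λ w′ ((adj′ , _) , a∈ , _) → only w′ adj′ (meetˡ {w′} {z} a∈))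
        where
        a-sing : Singular a
        a-sing = vertex-singular z a∈z
        through : ∃[ w ] (dist y w ≡ 1 × a ∈ˢ sub w × (∀ w′ → dist y w′ ≡ 1 → a ∈ˢ sub w′ → w′ ≡ w))
        through = neighbour-through a-sing a∉y
        w : Fin m
        w = proj₁ through
        adj : dist y w ≡ 1
        adj = proj₁ (proj₂ through)
        a∈w : a ∈ˢ sub w
        a∈w = proj₁ (proj₂ (proj₂ through))
        only : ∀ w′ → dist y w′ ≡ 1 → a ∈ˢ sub w′ → w′ ≡ w
        only = proj₂ (proj₂ (proj₂ through))
        y∩z⊆w∩z : meet y z ⊆ˢ meet w z
        y∩z⊆w∩z u h = meet⁺ {w} {z} (adjacent-perp a-sing a∉y adj a∈w (meetˡ {y} {z} h)
          (vertex-perp z (meetʳ {y} {z} h) a∈z)) (meetʳ {y} {z} h)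
        wz<yz : dist w z < dist y z
        wz<yz = ≰⇒> λ yz≤wz → a∉y (meetˡ {y} {z} (card-⊇ {S = meet y z} {meet w z} y∩z⊆w∩z
          (subst₂ _≤_ (sym (meet-card w z)) (sym (meet-card y z)) (^-monoʳ-≤ b (∸-monoʳ-≤ D yz≤wz)))
          a (meet⁺ {w} {z} a∈w a∈z)))
        closer : suc (dist w z) ≡ dist y z
        closer = ≤-antisym wz<yz (≤-trans (dist-triangle y w z) (≤-reflexive (cong (_+ dist w z) adj)))

      #-between : ∀ {t t′ k} → card T ≡ b ^ t * b ^ t′ → card (T ∩ sub z) ≡ b ^ t′ → k + t ≡ dist y z →
        # between? ≡ qnum k
      #-between {t} {t′} {k} cardT cardT∩z k+t = qnum-unique k
        (*-cancelʳ-≡ _ _ (b ^ j * b ^ t) ⦃ m*n≢0 (b ^ j) (b ^ t) ⦃ b^ j -nonZero ⦄ ⦃ b^ t -nonZero ⦄ ⦄ (begin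
          (pred b * N + 1) * (b ^ j * b ^ t)        ≡⟨ r₁ (pred b) N (b ^ j) (b ^ t) ⟩
          (b ^ j + N * (pred b * b ^ j)) * b ^ t    ≡⟨ cong (λ x → (b ^ j + x) * b ^ t) counted ⟩
          (b ^ j + R) * b ^ t                       ≡⟨ cong (_* b ^ t) E≡ ⟨
          E * b ^ t                                 ≡⟨ *-cancelʳ-≡ _ _ (b ^ t′) ⦃ b^ t′ -nonZero ⦄ perp ⟩
          b ^ D                                     ≡⟨ cong (b ^_) (m+[n∸m]≡n (dist≤D y z)) ⟨
          b ^ (dist y z + j)                        ≡⟨ cong (λ d → b ^ (d + j)) k+t ⟨
          b ^ (k + t + j)
            ≡⟨ trans (^-distribˡ-+-* b (k + t) j) (cong (_* b ^ j) (^-distribˡ-+-* b k t)) ⟩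
          b ^ k * b ^ t * b ^ j                     ≡⟨ r₂ (b ^ k) (b ^ t) (b ^ j) ⟩
          b ^ k * (b ^ j * b ^ t)                   ∎))
        where
        open ≡-Reasoning
        j N R E : ℕ
        j = D ∸ dist y z
        N = # between?
        R = # (λ a → (a ∈ˢ? sub z ×-dec a ⊥ˢ? T) ×-dec ¬? (a ∈ˢ? sub y))
        E = # (λ a → a ∈ˢ? sub z ×-dec a ⊥ˢ? T)
        r₁ : ∀ p x j i → (p * x + 1) * (j * i) ≡ (j + x * (p * j)) * i
        r₁ = solve-∀
        r₂ : ∀ x i j → x * i * j ≡ x * (j * i)
        r₂ = solve-∀
        r₃ : ∀ x i j → x * i * j ≡ x * (i * j)
        r₃ = solve-∀
        -- Each `w` contains (b - 1) b^j vectors of `z` outside `y`, and each vector of z ∩ T^⊥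
        -- outside `y` determines one `w`. As |z ∩ T^⊥| = b^(D-t), this means N (b - 1) b^j =
        -- b^(D-t) - b^j.
        counted : N * (pred b * b ^ j) ≡ R
        counted = trans (double-count between? (λ w a → a ∈ˢ? meet w z ×-dec ¬? (a ∈ˢ? sub y)) _
          (λ w a (_ , _ , T⊆w) (h , a∉y) →
            (meetʳ {w} {z} h , λ v v∈T → vertex-perp w (T⊆w v v∈T) (meetˡ {w} {z} h)) , a∉y)
          between-row between-column) (*-identityʳ R)
        E≡ : E ≡ b ^ j + R
        E≡ = trans (#-split (λ a → a ∈ˢ? sub z ×-dec a ⊥ˢ? T) (_∈ˢ? sub y)) (cong (_+ R) (trans (#-cong
          (λ a ((a∈z , _) , a∈y) → meet⁺ {y} {z} a∈y a∈z)
          (λ a h → (meetʳ {y} {z} h , λ v v∈T → vertex-perp y (T⊆y v v∈T) (meetˡ {y} {z} h)) , meetˡ {y} {z} h))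
          (meet-card y z)))
        -- Vectors of `T` are singular, so maximality of `z` gives T ∩ z^⊥ = T ∩ z.
        T-perp : # (λ v → v ∈ˢ? T ×-dec v ⊥ˢ? sub z) ≡ b ^ t′
        T-perp = trans (#-cong
          (λ v (v∈T , ⊥) → ∩⁺ {S = T} {sub z} v∈T (vertex-max z (vertex-singular y (T⊆y v v∈T)) ⊥))
          (λ v h → ∩⁻ˡ {S = T} {sub z} h , λ w w∈z → vertex-perp z w∈z (∩⁻ʳ {S = T} {sub z} h))) cardT∩z
        perp : E * b ^ t * b ^ t′ ≡ b ^ D * b ^ t′
        perp = begin
          E * b ^ t * b ^ t′                                     ≡⟨ r₃ E (b ^ t) (b ^ t′) ⟩
          E * (b ^ t * b ^ t′)                                   ≡⟨ cong (E *_) cardT ⟨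
          E * card T                                             ≡⟨ perp-card (vertex-sub z) sT ⟩
          # (λ v → v ∈ˢ? T ×-dec v ⊥ˢ? sub z) * card (sub z)     ≡⟨ cong₂ _*_ T-perp (vertex-card z) ⟩
          b ^ t′ * b ^ D                                         ≡⟨ *-comm (b ^ t′) (b ^ D) ⟩
          b ^ D * b ^ t′                                         ∎

    #-neighbours-off : ∀ {y T} → IsSubspace T → T ⊆ˢ sub y → ∀ {t k} → card T ≡ b ^ t → t + k ≡ D →
      # (λ w → dist y w ≟ 1 ×-dec ¬? (T ⊆ˢ? sub w)) + s * qnum k ≡ s * qnum D
    #-neighbours-off {y} {T} sT T⊆y {t} {k} cardT t+k = *-cancelˡ-≡ _ _ (pred b) (begin
      pred b * (N + s * qnum k)                        ≡⟨ r₁ (pred b) N s (qnum k) ⟩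
      N * pred b + s * (pred b * qnum k)               ≡⟨ cong (_+ s * (pred b * qnum k)) N≡ ⟩
      pred (b ^ t) * s * b ^ k + s * (pred b * qnum k) ≡⟨ r₂ (pred (b ^ t)) s (b ^ k) (pred b * qnum k) ⟩
      s * (pred (b ^ t) * b ^ k + pred b * qnum k)     ≡⟨ cong (s *_) (+-cancelʳ-≡ 1 _ _ (begin
          pred (b ^ t) * b ^ k + pred b * qnum k + 1     ≡⟨ +-assoc (pred (b ^ t) * b ^ k) _ 1 ⟩
          pred (b ^ t) * b ^ k + (pred b * qnum k + 1)   ≡⟨ cong (pred (b ^ t) * b ^ k +_) (qnum-spec k) ⟩
          pred (b ^ t) * b ^ k + b ^ k                   ≡⟨ +-comm _ (b ^ k) ⟩
          suc (pred (b ^ t)) * b ^ k                     ≡⟨ cong (_* b ^ k) (suc-pred (b ^ t) ⦃ b^ t -nonZero ⦄) ⟩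
          b ^ t * b ^ k                                  ≡⟨ b^D ⟨
          b ^ D                                          ≡⟨ qnum-spec D ⟨
          pred b * qnum D + 1                            ∎)) ⟩
      s * (pred b * qnum D)                            ≡⟨ r₃ s (pred b) (qnum D) ⟩
      pred b * (s * qnum D)                            ∎)
      where
      open ≡-Reasoning
      N M : ℕ
      N = # (λ w → dist y w ≟ 1 ×-dec ¬? (T ⊆ˢ? sub w))
      M = # (λ f → singular? f ×-dec ¬? (f ⊥ˢ? T))
      r₁ : ∀ p x s q → p * (x + s * q) ≡ x * p + s * (p * q)
      r₁ = solve-∀
      r₂ : ∀ a s c q → a * s * c + s * q ≡ s * (a * c + q)
      r₂ = solve-∀
      r₃ : ∀ s p q → s * (p * q) ≡ p * (s * q)
      r₃ = solve-∀
      r₄ : ∀ x p d t → x * p * (d * t) ≡ x * (p * d) * t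
      r₄ = solve-∀
      r₅ : ∀ c x t → c * (x * 1) * t ≡ x * (c * t)
      r₅ = solve-∀
      r₆ : ∀ a s t k → a * (s * (t * k * (t * k))) ≡ a * s * k * (t * k * t)
      r₆ = solve-∀
      b^D : b ^ D ≡ b ^ t * b ^ k
      b^D = trans (cong (b ^_) (sym t+k)) (^-distribˡ-+-* b t k)
      T-iso : TotallyIsotropic form Singular T
      T-iso = record { singular = λ h → vertex-singular y (T⊆y _ h)
                     ; perp     = λ h h′ → vertex-perp y (T⊆y _ h) (T⊆y _ h′) }
      -- The number of vectors of `w` outside `y` is b^D - b^(D-1); the weight b avoids the exponent
      -- D - 1.
      row : ∀ w → dist y w ≡ 1 × ¬ T ⊆ˢ sub w → b * # (λ a → a ∈ˢ? sub w ×-dec ¬? (a ∈ˢ? sub y)) ≡ pred b * b ^ D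
      row w (adj , _) = +-cancelˡ-≡ (b ^ D) _ _ (begin
        b ^ D + b * # (λ a → a ∈ˢ? sub w ×-dec ¬? (a ∈ˢ? sub y))
          ≡⟨ cong (_+ b * # (λ a → a ∈ˢ? sub w ×-dec ¬? (a ∈ˢ? sub y))) (trans (sym (adjacent-card adj)) (cong (b *_) (#-cong
               (λ a h → meetʳ {y} {w} h , meetˡ {y} {w} h) (λ a (h , h′) → meet⁺ {y} {w} h′ h)))) ⟩
        b * # (λ a → a ∈ˢ? sub w ×-dec a ∈ˢ? sub y) + b * # (λ a → a ∈ˢ? sub w ×-dec ¬? (a ∈ˢ? sub y))
          ≡⟨ *-distribˡ-+ b _ _ ⟨
        b * (# (λ a → a ∈ˢ? sub w ×-dec a ∈ˢ? sub y) + # (λ a → a ∈ˢ? sub w ×-dec ¬? (a ∈ˢ? sub y)))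
          ≡⟨ cong (b *_) (trans (sym (#-split (_∈ˢ? sub w) (_∈ˢ? sub y))) (vertex-card w)) ⟩
        b * b ^ D
          ≡⟨ cong (_* b ^ D) (suc-pred b) ⟨
        b ^ D + pred b * b ^ D ∎)
      column : ∀ a → Singular a × ¬ a ⊥ˢ T →
        1 * # (λ w → (dist y w ≟ 1 ×-dec ¬? (T ⊆ˢ? sub w)) ×-dec a ∈ˢ? sub w ×-dec ¬? (a ∈ˢ? sub y)) ≡ 1
      column a (a-sing , ¬⊥) = trans (+-identityʳ _) (#-one (proj₁ through)
        ((proj₁ (proj₂ through) , λ T⊆w → ¬⊥ (λ v v∈T → vertex-perp (proj₁ through) (T⊆w v v∈T) a∈w)) , a∈w , a∉y)
        (λ w′ ((adj′ , _) , a∈w′ , _) → proj₂ (proj₂ (proj₂ through)) w′ adj′ a∈w′))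
        where
        a∉y : ¬ a ∈ˢ sub y
        a∉y a∈y = ¬⊥ (λ v v∈T → vertex-perp y (T⊆y v v∈T) a∈y)
        through : ∃[ w ] (dist y w ≡ 1 × a ∈ˢ sub w × (∀ w′ → dist y w′ ≡ 1 → a ∈ˢ sub w′ → w′ ≡ w))
        through = neighbour-through a-sing a∉y
        a∈w : a ∈ˢ sub (proj₁ through)
        a∈w = proj₁ (proj₂ (proj₂ through))
      -- Pairs (w, a) with a in `w` outside `y`. Such a `w` contains y ∩ a^⊥, so if it does not
      -- contain `T`, then a is not orthogonal to `T`, and conversely. Each such a lies in one
      -- neighbour of `y`.
      counted : 1 * (N * (pred b * b ^ D)) ≡ b * (M * 1)
      counted = weighted-double-count (λ w → dist y w ≟ 1 ×-dec ¬? (T ⊆ˢ? sub w))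
        (λ w a → a ∈ˢ? sub w ×-dec ¬? (a ∈ˢ? sub y)) (λ f → singular? f ×-dec ¬? (f ⊥ˢ? T)) b 1
        (λ w a (adj , T⊄w) (a∈w , a∉y) → vertex-singular w a∈w , λ ⊥ → T⊄w (λ u u∈T →
          adjacent-perp (vertex-singular w a∈w) a∉y adj a∈w (T⊆y u u∈T) (⊥ u u∈T)))
        row column
      N≡ : N * pred b ≡ pred (b ^ t) * s * b ^ k
      N≡ = *-cancelʳ-≡ _ _ (b ^ D * b ^ t) ⦃ m*n≢0 (b ^ D) (b ^ t) ⦃ b^ D -nonZero ⦄ ⦃ b^ t -nonZero ⦄ ⦄ (begin
        N * pred b * (b ^ D * b ^ t)              ≡⟨ r₄ N (pred b) (b ^ D) (b ^ t) ⟩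
        N * (pred b * b ^ D) * b ^ t              ≡⟨ cong (_* b ^ t) (trans (sym (+-identityʳ _)) counted) ⟩
        b * (M * 1) * b ^ t                       ≡⟨ r₅ b M (b ^ t) ⟩
        M * (b * b ^ t)                           ≡⟨ cong (λ x → M * (b * x)) cardT ⟨
        M * (b * card T)                          ≡⟨ #-singular-off sT T-iso ⟩
        pred (card T) * (s * b ^ (2 * D))         ≡⟨ cong₂ (λ x d → pred x * (s * d)) cardT
                                                       (trans (cong (λ d → b ^ (D + d)) (+-identityʳ D))
                                                         (^-distribˡ-+-* b D D)) ⟩
        pred (b ^ t) * (s * (b ^ D * b ^ D))      ≡⟨ cong (λ x → pred (b ^ t) * (s * (x * x))) b^D ⟩
        pred (b ^ t) * (s * (b ^ t * b ^ k * (b ^ t * b ^ k)))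
                                                  ≡⟨ r₆ (pred (b ^ t)) s (b ^ t) (b ^ k) ⟩
        pred (b ^ t) * s * b ^ k * (b ^ t * b ^ k * b ^ t)
                                                  ≡⟨ cong (λ x → pred (b ^ t) * s * b ^ k * (x * b ^ t)) b^D ⟨
        pred (b ^ t) * s * b ^ k * (b ^ D * b ^ t) ∎)

  -- Levels with respect to the base vertex

  -- Rounding down; it gains the last unit when `ρ-triangle` is applied to distances with odd sum.
  half-≤ : ∀ {i j} → i + i ≤ suc (j + j) → i ≤ j
  half-≤ {i} {j} le with i ≤? j
  ... | yes p = p
  ... | no ¬p = contradiction (≤-trans (+-mono-≤ (≰⇒> ¬p) (≰⇒> ¬p)) le)
    (<⇒≱ (≤-reflexive (cong suc (sym (+-suc j j)))))

  module LevelCounts {b : ℕ} (𝔽 : FiniteField b) {n D s : ℕ} {Iso : LinAlg.SubsetV 𝔽 n → Set}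
    (G : PolarProperties.PolarGeometry 𝔽 n D s Iso)
    {m : ℕ} {sub : Fin m → LinAlg.SubsetV 𝔽 n}
    (vertex-dim : ∀ y → LinAlg.HasDim 𝔽 (sub y) D)
    (vertex-iso : ∀ y → Iso (sub y))
    (injective : ∀ y z → (∀ u → sub y u ≡ sub z u) → y ≡ z)
    (surjective : ∀ S → LinAlg.HasDim 𝔽 S D → Iso S → ∃[ y ] (∀ u → S u ≡ sub y u))
    {dist : Fin m → Fin m → ℕ} (isDistance : LinAlg.IsDistance 𝔽 D m sub dist)
    (x : Fin m)
    where

    open LinAlg 𝔽
    open FieldProperties 𝔽
    open DualPolarGraph 𝔽 G vertex-dim vertex-iso injective surjective isDistance

    d : Fin m → ℕ
    d y = dist x y

    -- Equivalently x ∩ y ⊆ x ∩ z, so this is a preorder on the vertices, along which the distance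
    -- from `x` does not increase.
    Inc : Fin m → Fin m → Set
    Inc y z = meet x y ⊆ˢ sub z

    inc? : ∀ y z → Dec (Inc y z)
    inc? y z = meet x y ⊆ˢ? sub z

    inc-trans : ∀ {y z w} → Inc y z → Inc z w → Inc y w
    inc-trans {y} {z} p q u h = q u (meet⁺ {x} {z} (meetˡ {x} {y} h) (p u h))

    inc-refl : ∀ y → Inc y y
    inc-refl y u h = meetʳ {x} {y} h

    ρ-inc : ∀ {y z} → Inc y z → ρ x y z ≡ d y
    ρ-inc = ⊆⇒ρ≡

    ρ-inc′ : ∀ {y z} → Inc z y → ρ x y z ≡ d z
    ρ-inc′ {y} {z} p = trans (ρ-swapʳ x y z) (ρ-inc p)

    d≤ρ : ∀ y z → d y ≤ ρ x y z
    d≤ρ y z = dist≤ρ x y z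

    d≤ρ′ : ∀ y z → d z ≤ ρ x y z
    d≤ρ′ y z = ≤-trans (d≤ρ z y) (≤-reflexive (ρ-swapʳ x z y))

    inc⇒≤ : ∀ {y z} → Inc y z → d z ≤ d y
    inc⇒≤ {y} {z} p = ≤-trans (d≤ρ′ y z) (≤-reflexive (ρ-inc p))

    -- The inclusion x ∩ y ⊆ x ∩ z is an equality once the dimension on the right is not larger.
    inc-back : ∀ {y z} → Inc y z → d y ≤ d z → Inc z y
    inc-back {y} {z} p le = ρ≤⇒⊆ (≤-trans (≤-reflexive (trans (ρ-swapʳ x z y) (ρ-inc p))) le)

    d-triangle : ∀ y z → d z ≤ dist y z + d y
    d-triangle y z = ≤-trans (dist-triangle x y z) (≤-reflexive (+-comm (d y) (dist y z)))

    d-up : ∀ {y z k} → dist y z ≡ k → d z ≤ k + d y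
    d-up {y} {z} refl = d-triangle y z

    d-down : ∀ {y z k} → dist y z ≡ k → d y ≤ k + d z
    d-down {y} {z} eq = d-up (trans (dist-sym z y) eq)

    ρ-bound : ∀ {y z k} → dist y z ≡ k → ρ x y z + ρ x y z ≤ d y + k + d z
    ρ-bound {y} {z} refl = ρ-triangle x y z

    -- Parity: 2ρ ≤ 2 d y + 1 gives ρ ≤ d y, so intersecting x ∩ y with `z` loses nothing.
    adjacent⇒inc : ∀ {y z} → dist y z ≡ 1 → d z ≤ d y → Inc y z
    adjacent⇒inc {y} {z} adj le = ρ≤⇒⊆ (half-≤ (begin
      ρ x y z + ρ x y z   ≤⟨ ρ-bound adj ⟩
      d y + 1 + d z       ≤⟨ +-monoʳ-≤ (d y + 1) le ⟩
      d y + 1 + d y       ≡⟨ cong (_+ d y) (+-comm (d y) 1) ⟩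
      suc (d y + d y)     ∎))
      where open ≤-Reasoning

    not-inc⇒up : ∀ {y z} → dist y z ≡ 1 → ¬ Inc y z → d z ≡ suc (d y)
    not-inc⇒up {y} {z} adj ¬p = ≤-antisym (d-up adj) (≰⇒> (λ le → ¬p (adjacent⇒inc adj le)))

    up⇒not-inc : ∀ {y z} → d z ≡ suc (d y) → ¬ Inc y z
    up⇒not-inc up p = <-irrefl refl (≤-trans (≤-reflexive (sym up)) (inc⇒≤ p))

    -- For mutually adjacent vertices 2ρ ≤ 3 gives y ∩ w ⊆ z. On a common level x ∩ y ⊆ w, so x ∩ y
    -- ⊆ z and `z` cannot be further from `x`.
    no-triangle : ∀ {y w z} → dist y w ≡ 1 → dist w z ≡ 1 → dist y z ≡ 1 → d y ≡ d w → ¬ d z ≡ suc (d y)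
    no-triangle {y} {w} {z} yw wz yz same up = up⇒not-inc up (λ u h →
      ρ≤⇒⊆ {y} {w} {z} (subst (ρ y w z ≤_) (sym yw) ρ≤1) u
        (meet⁺ {y} {w} (meetʳ {x} {y} h) (adjacent⇒inc yw (≤-reflexive (sym same)) u h)))
      where
      ρ≤1 : ρ y w z ≤ 1
      ρ≤1 = half-≤ (≤-trans (ρ-triangle y w z) (≤-reflexive (cong₂ _+_ (cong₂ _+_ yw wz) yz)))

    zeroSpace : SubsetV n
    zeroSpace u = does (u ≟ᵛ 0v)

    zero⁻ : ∀ {u} → u ∈ˢ zeroSpace → u ≡ 0v
    zero⁻ {u} = does⁻ (u ≟ᵛ 0v)

    zero⁺ : ∀ {u} → u ≡ 0v → u ∈ˢ zeroSpace
    zero⁺ {u} = dec-true (u ≟ᵛ 0v)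

    zeroSpace-sub : IsSubspace zeroSpace
    zeroSpace-sub = record
      { has-0    = zero⁺ refl
      ; closed-⊕ = λ {u} {v} h h′ → zero⁺ (trans (cong₂ _⊕_ (zero⁻ {u} h) (zero⁻ {v} h′)) (⊕-identityˡ 0v))
      ; closed-· = λ c {u} h → zero⁺ (trans (cong (c ·_) (zero⁻ {u} h)) (·-0v c)) }

    between : ∀ y z w → Dec (dist y w ≡ 1 × suc (dist w z) ≡ dist y z)
    between y z w = dist y w ≟ 1 ×-dec suc (dist w z) ≟ dist y z

    #-between-all : ∀ {y z k} → dist y z ≡ k → # (between y z) ≡ qnum k
    #-between-all {y} {z} {k} eq = trans
      (#-cong (λ w (p , q) → p , q , λ u h → subst (_∈ˢ sub w) (sym (zero⁻ {u} h)) (IsSubspace.has-0 (vertex-sub w)))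
              (λ w (p , q , _) → p , q))
      (#-between {y} {z} zeroSpace-sub zero⊆y {0} {0} {k}
        (#-one 0v (zero⁺ refl) (λ u h → zero⁻ {u} h))
        (#-one 0v (∩⁺ {S = zeroSpace} {sub z} (zero⁺ refl) (IsSubspace.has-0 (vertex-sub z)))
          (λ u h → zero⁻ {u} (∩⁻ˡ {S = zeroSpace} {sub z} h)))
        (trans (+-identityʳ k) (sym eq)))
      where
      zero⊆y : zeroSpace ⊆ˢ sub y
      zero⊆y u h = subst (_∈ˢ sub y) (sym (zero⁻ {u} h)) (IsSubspace.has-0 (vertex-sub y))

    #-between-inc : ∀ {v y z k} → Inc v y → k + ρ x v z ≡ dist y z + d v →
      # (λ w → between y z w ×-dec inc? v w) ≡ qnum k
    #-between-inc {v} {y} {z} {k} v≤y eq = trans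
      (#-cong (λ w ((p , q) , r) → p , q , r) (λ w (p , q , r) → (p , q) , r))
      (#-between {y} {z} (meet-sub x v) v≤y {t} {D ∸ ρ x v z} {k}
        (trans (meet-card x v) (trans (cong (b ^_) split) (^-distribˡ-+-* b t (D ∸ ρ x v z))))
        (triple-card x v z)
        (+-cancelʳ-≡ (d v) _ _ (trans (+-assoc k t (d v)) (trans (cong (k +_) (m∸n+n≡m (d≤ρ v z))) eq))))
      where
      -- For T = x ∩ v this is the codimension of T ∩ z in `T`.
      t : ℕ
      t = ρ x v z ∸ d v
      split : D ∸ d v ≡ t + (D ∸ ρ x v z)
      split = +-cancelʳ-≡ (d v) _ _ (begin
        D ∸ d v + d v                  ≡⟨ m∸n+n≡m (dist≤D x v) ⟩
        D                              ≡⟨ m+[n∸m]≡n (ρ≤D x v z) ⟨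
        ρ x v z + (D ∸ ρ x v z)        ≡⟨ cong (_+ (D ∸ ρ x v z)) (m∸n+n≡m (d≤ρ v z)) ⟨
        t + d v + (D ∸ ρ x v z)        ≡⟨ r t (d v) (D ∸ ρ x v z) ⟩
        t + (D ∸ ρ x v z) + d v        ∎)
        where
        open ≡-Reasoning
        r : ∀ i j k → i + j + k ≡ i + k + j
        r = solve-∀

    #-between-out : ∀ {v y z k j} → Inc v y → k + ρ x v z ≡ dist y z + d v → dist y z ≡ j →
      qnum k + # (λ w → between y z w ×-dec ¬? (inc? v w)) ≡ qnum j
    #-between-out {v} {y} {z} p eq eq′ = trans
      (cong (_+ # (λ w → between y z w ×-dec ¬? (inc? v w))) (sym (#-between-inc p eq)))
      (trans (sym (#-split (between y z) (inc? v))) (#-between-all eq′))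

    -- By `not-inc⇒up` and `up⇒not-inc` the neighbours counted are those one step further from `x`.
    -- The space x ∩ y has codimension d y in `y`.
    up-count : ∀ y → # (λ w → dist y w ≟ 1 ×-dec ¬? (inc? y w)) + s * qnum (d y) ≡ s * qnum D
    up-count y = #-neighbours-off (meet-sub x y) (λ _ → meetʳ {x} {y}) {D ∸ d y} {d y} (meet-card x y) (m∸n+n≡m (dist≤D x y))

    -- With T = y every neighbour is counted, which gives the valency s [D]. With T = y ∩ z only
    -- those not containing y ∩ z are, and the difference is s [1].
    line-count : ∀ {y z} → dist y z ≡ 1 → # (λ w → dist y w ≟ 1 ×-dec meet y z ⊆ˢ? sub w) ≡ s
    line-count {y} {z} adj = +-cancelʳ-≡ N _ _ (begin
      # (λ w → dist y w ≟ 1 ×-dec meet y z ⊆ˢ? sub w) + N  ≡⟨ #-split (λ w → dist y w ≟ 1) (λ w → meet y z ⊆ˢ? sub w) ⟨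
      # (λ w → dist y w ≟ 1)                               ≡⟨ #-cong (λ w adj′ → adj′ , λ y⊆w → 0≢1+n (trans (sym (trans
                                                               (cong (dist y) (sym (⊆ˢ⇒≡ y⊆w))) (dist-refl y))) adj′))
                                                                 (λ _ → proj₁) ⟩
      # (λ w → dist y w ≟ 1 ×-dec ¬? (sub y ⊆ˢ? sub w))
        ≡⟨ trans (sym (+-identityʳ _)) (cong (# (λ w → dist y w ≟ 1 ×-dec ¬? (sub y ⊆ˢ? sub w)) +_) (sym (*-zeroʳ s))) ⟩
      # (λ w → dist y w ≟ 1 ×-dec ¬? (sub y ⊆ˢ? sub w)) + s * 0
                                                           ≡⟨ #-neighbours-off (vertex-sub y) (λ _ h → h) {D} {0}
                                                             (vertex-card y) (+-identityʳ D) ⟩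
      s * qnum D
        ≡⟨ #-neighbours-off (meet-sub y z) (λ _ → meetˡ {y} {z}) {D ∸ 1} {1}
                                                               (trans (meet-card y z) (cong (λ i → b ^ (D ∸ i)) adj))
                                                                 (m∸n+n≡m (subst (_≤ D) adj (dist≤D y z))) ⟨
      N + s * qnum 1                                       ≡⟨ cong (λ t → N + s * suc t) (*-zeroʳ b) ⟩
      N + s * 1                                            ≡⟨ trans (cong (N +_) (*-identityʳ s)) (+-comm N s) ⟩
      s + N                                                ∎)
      where
      open ≡-Reasoning
      N : ℕ
      N = # (λ w → dist y w ≟ 1 ×-dec ¬? (meet y z ⊆ˢ? sub w))

    qnum-1 : qnum 1 ≡ 1
    qnum-1 = cong suc (*-zeroʳ b)

    qnum-2 : qnum 2 ≡ 1 + b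
    qnum-2 = cong suc (trans (cong (b *_) qnum-1) (*-identityʳ b))

    -- `N` is the support of L², and `M` is the support of LR off the diagonal.
    L F R N M : Fin m → Fin m → Set
    L y z = dist y z ≡ 1 × d z ≡ suc (d y)
    F y z = dist y z ≡ 1 × d z ≡ d y
    R y z = dist y z ≡ 1 × suc (d z) ≡ d y
    N y z = dist y z ≡ 2 × d z ≡ 2 + d y
    M y z = dist y z ≡ 2 × d z ≡ d y × ¬ Inc y z

    L? : ∀ y z → Dec (L y z)
    L? y z = dist y z ≟ 1 ×-dec d z ≟ suc (d y)

    F? : ∀ y z → Dec (F y z)
    F? y z = dist y z ≟ 1 ×-dec d z ≟ d y

    R? : ∀ y z → Dec (R y z)
    R? y z = dist y z ≟ 1 ×-dec suc (d z) ≟ d y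

    N? : ∀ y z → Dec (N y z)
    N? y z = dist y z ≟ 2 ×-dec d z ≟ 2 + d y

    M? : ∀ y z → Dec (M y z)
    M? y z = dist y z ≟ 2 ×-dec d z ≟ d y ×-dec ¬? (inc? y z)

    L⇒R : ∀ {y z} → L y z → R z y
    L⇒R {y} {z} (p , q) = trans (dist-sym z y) p , sym q

    R⇒L : ∀ {y z} → R y z → L z y
    R⇒L {y} {z} (p , q) = trans (dist-sym z y) p , sym q

    F-sym : ∀ {y z} → F y z → F z y
    F-sym {y} {z} (p , q) = trans (dist-sym z y) p , sym q

    L⇒inc : ∀ {y z} → L y z → Inc z y
    L⇒inc {y} {z} (p , q) = adjacent⇒inc (trans (dist-sym z y) p) (≤-trans (n≤1+n (d y)) (≤-reflexive (sym q)))

    path-2 : ∀ {y w z} → dist y w ≡ 1 → dist w z ≡ 1 → dist y z ≤ 2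
    path-2 {y} {w} {z} p q = ≤-trans (dist-triangle y w z) (≤-reflexive (cong₂ _+_ p q))

    LL⇒N : ∀ {y w z} → L y w → L w z → N y z
    LL⇒N {y} {w} {z} (p , q) (p′ , q′) = ≤-antisym (path-2 p p′) (+-cancelʳ-≤ (d y) 2 (dist y z)
      (≤-trans (≤-reflexive (sym up)) (d-triangle y z))) , up
      where
      up : d z ≡ 2 + d y
      up = trans q′ (cong suc q)

    N-between : ∀ {y w z} → N y z → dist y w ≡ 1 × suc (dist w z) ≡ dist y z → L y w × L w z
    N-between {y} {w} {z} (yz , up) (yw , closer) = (yw , dw) , (wz , trans up (cong suc (sym dw)))
      where
      wz : dist w z ≡ 1
      wz = suc-injective (trans closer yz)
      dw : d w ≡ suc (d y)
      dw = ≤-antisym (d-up yw) (≤-pred (≤-trans (≤-reflexive (sym up)) (d-up wz)))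

    between-2 : ∀ {y w z} → dist y z ≡ 2 → dist w z ≡ 1 → suc (dist w z) ≡ dist y z
    between-2 yz wz = trans (cong suc wz) (sym yz)

    -- When d z = d y + 2, every vertex between `y` and `z` is forced onto the middle level, so all
    -- [2] of them count.
    #LL : ∀ y z → # (λ w → L? y w ×-dec L? w z) ≡ (1 + b) * ⟦ N? y z ⟧
    #LL y z with N? y z
    ... | yes nyz = trans (#-cong (λ w (p , q) → proj₁ p , between-2 (proj₁ nyz) (proj₁ q)) (λ w → N-between nyz))
      (trans (#-between-all (proj₁ nyz)) (trans qnum-2 (sym (*-identityʳ (1 + b)))))
    ... | no ¬nyz = trans (#-none (λ w (p , q) → ¬nyz (LL⇒N p q))) (sym (*-zeroʳ (1 + b)))

    -- The bound reads 2ρ ≤ 2 (d y + 1) + 1, and rounding makes it meet the lower bound d z.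
    -- Consequently x ∩ z ⊆ y.
    step-ρ : ∀ {y z} → dist y z ≡ 2 → d z ≡ suc (d y) → ρ x y z ≡ suc (d y)
    step-ρ {y} {z} yz up = ≤-antisym (half-≤ (begin
      ρ x y z + ρ x y z            ≤⟨ ρ-bound yz ⟩
      d y + 2 + d z                ≡⟨ cong (d y + 2 +_) up ⟩
      d y + 2 + suc (d y)          ≡⟨ r (d y) ⟩
      suc (suc (d y) + suc (d y))  ∎)) (≤-trans (≤-reflexive (sym up)) (d≤ρ′ y z))
      where
      open ≤-Reasoning
      r : ∀ i → i + 2 + suc i ≡ suc (suc i + suc i)
      r = solve-∀

    step-inc : ∀ {y z} → dist y z ≡ 2 → d z ≡ suc (d y) → Inc z y
    step-inc {y} {z} yz up = ρ≤⇒⊆ (≤-reflexive (trans (ρ-swapʳ x z y) (trans (step-ρ yz up) (sym up))))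

    -- Both products live on d z = d y + 1. At distance 1 the entries of LF and FL are s - 1 and 0;
    -- at distance 2 they are b and 1; elsewhere they vanish.
    LF-FL : ∀ y z → # (λ w → L? y w ×-dec F? w z) + ⟦ L? y z ⟧ ≡ b * # (λ w → F? y w ×-dec L? w z) + s * ⟦ L? y z ⟧
    LF-FL y z with d z ≟ suc (d y)
    ... | no ¬up = trans (cong₂ _+_ (#-none (λ w ((_ , q) , (_ , q′)) → ¬up (trans q′ q))) notL)
        (sym (cong₂ _+_ (trans (cong (b *_) (#-none (λ w ((_ , q) , (_ , q′)) → ¬up (trans q′ (cong suc q))))) (*-zeroʳ b))
          (trans (cong (s *_) notL) (*-zeroʳ s))))
      where
      notL : ⟦ dist y z ≟ 1 ×-dec no ¬up ⟧ ≡ 0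
      notL = ⟦⟧-no (λ (_ , up) → ¬up up) (dist y z ≟ 1 ×-dec no ¬up)
    ... | yes up = cases (dist y z ≟ 1) (dist y z ≟ 2)
      where
      lf fl : ℕ
      lf = # (λ w → L? y w ×-dec F? w z)
      fl = # (λ w → F? y w ×-dec L? w z)
      cases : (p : Dec (dist y z ≡ 1)) → Dec (dist y z ≡ 2) → lf + ⟦ p ×-dec yes up ⟧ ≡ b * fl + s * ⟦ p ×-dec yes up ⟧
      cases (yes yz) _ = begin
        lf + 1                                                    ≡⟨ +-comm lf 1 ⟩
        1 + lf
          ≡⟨ cong₂ _+_ (#-one z ((yz , λ u → meetʳ {y} {z}) , refl) (λ _ (_ , eq) → eq)) (#-cong to from) ⟨
        # (λ w → line? w ×-dec w Fin.≟ z) + # (λ w → line? w ×-dec ¬? (w Fin.≟ z))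
                                                                  ≡⟨ #-split line? (Fin._≟ z) ⟨
        # line?                                                   ≡⟨ line-count yz ⟩
        s                                                         ≡⟨ *-identityʳ s ⟨
        s * 1                                                     ≡⟨ cong (_+ s * 1) (trans (cong (b *_) fl≡0) (*-zeroʳ b)) ⟨
        b * fl + s * 1                                            ∎
        where
        open ≡-Reasoning
        -- The neighbours of `y` that contain y ∩ z. All of them lie on the level of `z`, and those
        -- other than `z` are exactly the ones counted by `lf`.
        line? : ∀ w → Dec (dist y w ≡ 1 × meet y z ⊆ˢ sub w)
        line? w = dist y w ≟ 1 ×-dec meet y z ⊆ˢ? sub w
        fl≡0 : fl ≡ 0
        fl≡0 = #-none (λ w ((yw , q) , (wz , q′)) → no-triangle yw wz yz (sym q) up)
        to : ∀ w → (dist y w ≡ 1 × meet y z ⊆ˢ sub w) × ¬ w ≡ z → L y w × F w z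
        to w ((yw , ⊆w) , w≢z) = (yw , dw) , (wz , trans up (sym dw))
          where
          wz≤1 : dist w z ≤ 1
          wz≤1 = ≤-trans (dist≤ρ w z y) (≤-reflexive
            (trans (ρ-swapʳ w z y) (trans (ρ-swapˡ w y z) (trans (ρ-swapʳ y w z) (trans (⊆⇒ρ≡ ⊆w) yz)))))
          wz : dist w z ≡ 1
          wz = ≤-antisym wz≤1 (n≢0⇒n>0 (λ eq → w≢z (dist≡0⇒≡ eq)))
          dw : d w ≡ suc (d y)
          dw = ≤-antisym (d-up yw) (≰⇒> (λ le → no-triangle yw wz yz
            (≤-antisym (≤-pred (≤-trans (≤-reflexive (sym up)) (d-up wz))) le) up))
        from : ∀ w → L y w × F w z → (dist y w ≡ 1 × meet y z ⊆ˢ sub w) × ¬ w ≡ z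
        from w ((yw , q) , (wz , q′)) = (yw , ρ≤⇒⊆ (subst (ρ y z w ≤_) (sym yz) (half-≤ (≤-trans (ρ-triangle y z w)
          (≤-reflexive (cong₂ _+_ (cong₂ _+_ yz (trans (dist-sym z w) wz)) yw)))))) ,
          λ { refl → 0≢1+n (trans (sym (dist-refl w)) wz) }
      cases (no ¬1) (yes yz) = begin
        lf + 0         ≡⟨ +-identityʳ lf ⟩
        lf             ≡⟨ #-cong (λ w ((yw , q) , (wz , _)) → (yw , between-2 yz wz) , up⇒not-inc q)
                            (λ w ((yw , closer) , ¬p) → (yw , not-inc⇒up yw ¬p) ,
                              (suc-injective (trans closer yz) , trans up (sym (not-inc⇒up yw ¬p)))) ⟩
        out
          ≡⟨ suc-injective (trans (cong (_+ out) (sym qnum-1)) (trans (#-between-out (inc-refl y) k-eq yz) qnum-2)) ⟩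
        b              ≡⟨ *-identityʳ b ⟨
        b * 1          ≡⟨ cong (b *_) (trans (sym qnum-1) (trans (sym (#-between-inc (inc-refl y) k-eq)) (#-cong
                            (λ w ((yw , closer) , p) → let wz = suc-injective (trans closer yz) ; dw = dw≡ wz p in
                              (yw , dw) , (wz , trans up (cong suc (sym dw))))
                            (λ w ((yw , q) , (wz , _)) → (yw , between-2 yz wz) , adjacent⇒inc yw (≤-reflexive q))))) ⟩
        b * fl         ≡⟨ trans (cong (b * fl +_) (*-zeroʳ s)) (+-identityʳ _) ⟨
        b * fl + s * 0 ∎
        where
        open ≡-Reasoning
        -- Of the 1 + b vertices between `y` and `z`, one contains x ∩ y and stays on the level of
        -- `y`; the other b move to the level of `z`.
        out : ℕ
        out = # (λ w → between y z w ×-dec ¬? (inc? y w))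
        k-eq : 1 + ρ x y z ≡ dist y z + d y
        k-eq = trans (cong suc (step-ρ yz up)) (cong (_+ d y) (sym yz))
        dw≡ : ∀ {w} → dist w z ≡ 1 → Inc y w → d w ≡ d y
        dw≡ wz p = ≤-antisym (inc⇒≤ p) (≤-pred (≤-trans (≤-reflexive (sym up)) (d-up wz)))
      cases (no ¬1) (no ¬2) = trans (cong (_+ 0) (#-none (λ w ((p , _) , (p′ , _)) → far (path-2 p p′))))
        (sym (cong₂ _+_ (trans (cong (b *_) (#-none (λ w ((p , _) , (p′ , _)) → far (path-2 p p′)))) (*-zeroʳ b))
          (*-zeroʳ s)))
        where
        far : ¬ dist y z ≤ 2
        far le with dist y z in eq
        ... | zero      = 1+n≢n (trans (sym up) (cong d (sym (dist≡0⇒≡ eq))))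
        ... | suc zero  = ¬1 refl
        ... | suc (suc zero) = ¬2 refl
        ... | suc (suc (suc _)) = contradiction le (λ { (s≤s (s≤s ())) })

    -- The products LR, LRL, RL², L²R and the cubic relation

    lr : Fin m → Fin m → ℕ
    lr y z = # (λ w → L? y w ×-dec R? w z)

    up : Fin m → ℕ
    up y = # (λ w → dist y w ≟ 1 ×-dec ¬? (inc? y w))

    lr-diagonal : ∀ y → lr y y ≡ up y
    lr-diagonal y = #-cong (λ w (l@(p , q) , _) → p , up⇒not-inc q)
      (λ w (p , ¬p) → let l = p , not-inc⇒up p ¬p in l , L⇒R l)

    -- Here ρ = d y + 1: the triangle bound gives ≤, and x ∩ y not being inside `z` gives >.
    M-ρ : ∀ {y z} → M y z → 1 + ρ x y z ≡ dist y z + d y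
    M-ρ {y} {z} (yz , same , ¬p) = trans (cong suc (≤-antisym
        (half-≤ (≤-trans (ρ-bound yz) (≤-trans (≤-reflexive (trans (cong (d y + 2 +_) same) (r (d y)))) (n≤1+n _))))
        (≰⇒> (λ le → ¬p (ρ≤⇒⊆ le)))))
      (cong (_+ d y) (sym yz))
      where
      r : ∀ i → i + 2 + i ≡ suc i + suc i
      r = solve-∀

    -- Equal levels at distance 1 are excluded by `no-triangle`. At distance 2, if x ∩ y ⊆ z then
    -- all [2] vertices between contain x ∩ y and none goes up; otherwise just one contains it and b
    -- go up.
    lr-off-diagonal : ∀ {y z} → y ≢ z → lr y z ≡ b * ⟦ M? y z ⟧
    lr-off-diagonal {y} {z} y≢z with M? y z
    ... | yes myz@(yz , same , ¬p) = trans (#-cong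
        (λ w ((yw , q) , (wz , _)) → (yw , between-2 yz wz) , up⇒not-inc q)
        (λ w ((yw , closer) , ¬q) → let dw = not-inc⇒up yw ¬q in
          (yw , dw) , (suc-injective (trans closer yz) , trans (cong suc same) (sym dw))))
      (trans (suc-injective (trans (cong (_+ out) (sym qnum-1))
        (trans (#-between-out (inc-refl y) (M-ρ myz) yz) qnum-2))) (sym (*-identityʳ b)))
      where
      out : ℕ
      out = # (λ w → between y z w ×-dec ¬? (inc? y w))
    ... | no ¬m = trans (#-none none) (sym (*-zeroʳ b))
      where
      none : ∀ w → ¬ (L y w × R w z)
      none w ((yw , q) , (wz , q′)) = cases (dist y z) refl
        where
        same : d z ≡ d y
        same = suc-injective (trans q′ q)
        cases : ∀ k → dist y z ≡ k → _
        cases zero eq = y≢z (dist≡0⇒≡ eq)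
        cases (suc zero) yz = no-triangle yz (trans (dist-sym z w) wz) yw (sym same) q
        cases (suc (suc (suc k))) eq = contradiction (path-2 yw wz)
          (λ le → 1+n≰n (≤-trans (≤-trans (s≤s (s≤s (s≤s z≤n))) (≤-reflexive (sym eq))) le))
        cases (suc (suc zero)) yz = ¬m (yz , same , λ p → #-empty
          (+-cancelˡ-≡ (qnum 2) (# (λ w → between y z w ×-dec ¬? (inc? y w))) 0
            (trans (#-between-out (inc-refl y) (trans (cong (2 +_) (ρ-inc p)) (cong (_+ d y) (sym yz))) yz)
              (sym (+-identityʳ (qnum 2)))))
          w ((yw , between-2 yz wz) , up⇒not-inc q))

    lr-cases : ∀ y z → lr y z ≡ ⟦ z Fin.≟ y ⟧ * up y + b * ⟦ M? y z ⟧
    lr-cases y z with z Fin.≟ y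
    ... | yes refl = trans (lr-diagonal y) (sym (trans (cong₂ _+_ (+-identityʳ (up y))
          (trans (cong (b *_) (⟦⟧-no (λ (_ , _ , ¬p) → ¬p (inc-refl y)) (M? y y))) (*-zeroʳ b))) (+-identityʳ (up y))))
    ... | no z≢y = lr-off-diagonal (≢-sym z≢y)

    -- Exactly one vertex between contains x ∩ y. It contains x ∩ z as well, so it lies one level
    -- down: on the same level x ∩ y and x ∩ z would coincide, against `M`.
    M-meet : ∀ {y z} → M y z → # (λ w → R? y w ×-dec L? w z) ≡ 1
    M-meet {y} {z} myz@(yz , same , ¬p) = trans (#-cong to from) (trans (#-between-inc (inc-refl y) (M-ρ myz)) qnum-1)
      where
      to : ∀ w → R y w × L w z → (dist y w ≡ 1 × suc (dist w z) ≡ dist y z) × Inc y w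
      to w (r@(yw , _) , (wz , _)) = (yw , between-2 yz wz) , L⇒inc (R⇒L r)
      from : ∀ w → (dist y w ≡ 1 × suc (dist w z) ≡ dist y z) × Inc y w → R y w × L w z
      from w ((yw , closer) , y≤w) = (yw , dw) , (wz , trans same (sym dw))
        where
        wz : dist w z ≡ 1
        wz = suc-injective (trans closer yz)
        z≤w : Inc z w
        z≤w = adjacent⇒inc (trans (dist-sym z w) wz) (≤-trans (inc⇒≤ y≤w) (≤-reflexive (sym same)))
        dw : suc (d w) ≡ d y
        dw = ≤-antisym (≰⇒> (λ le → ¬p (inc-back (inc-trans z≤w (inc-back y≤w le)) (≤-reflexive same)))) (d-down yw)

    rn nr : Fin m → Fin m → ℕ
    rn y z = # (λ w → R? y w ×-dec N? w z)
    nr y z = # (λ w → N? y w ×-dec R? w z)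

    -- For v with `R y v` and `N v z`, the number of the 1 + b vertices between v and z that do not
    -- contain x ∩ y.
    κ : Fin m → Fin m → ℕ
    κ y z with inc? z y
    ... | yes _ = b
    ... | no _  = 1 + b

    κ-yes : ∀ {y z} → Inc z y → κ y z ≡ b
    κ-yes {y} {z} p with inc? z y
    ... | yes _ = refl
    ... | no ¬p = contradiction p ¬p

    κ-no : ∀ {y z} → ¬ Inc z y → κ y z ≡ 1 + b
    κ-no {y} {z} ¬p with inc? z y
    ... | yes p = contradiction p ¬p
    ... | no _  = refl

    -- By `M-meet` each w determines a unique v below both `y` and w, and this v satisfies `N v z`.
    -- Summing over v instead, every v accounts for `κ y z` vertices w.
    #M-L : ∀ y z → # (λ w → M? y w ×-dec L? w z) ≡ rn y z * κ y z
    #M-L y z = trans (sym (*-identityʳ _)) (double-count (λ w → M? y w ×-dec L? w z)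
      (λ w v → R? y v ×-dec L? v w) (λ v → R? y v ×-dec N? v z)
      (λ w v (_ , lwz) (ryv , lvw) → ryv , LL⇒N lvw lwz)
      (λ w (myw , _) → M-meet myw)
      column)
      where
      column : ∀ v → R y v × N v z → # (λ w → (M? y w ×-dec L? w z) ×-dec R? y v ×-dec L? v w) ≡ κ y z
      column v (ryv@(yv , dv) , nvz@(vz , up-z)) = trans (#-cong
          (λ w (((_ , _ , ¬p) , lwz) , _ , lvw) → (proj₁ lvw , between-2 vz (proj₁ lwz)) , ¬p)
          (λ w (bw , ¬p) → let (lvw , lwz) = N-between nvz bw in ((M-from lvw ¬p) , lwz) , ryv , lvw))
        (cases (inc? z y))
        where
        y≤v : Inc y v
        y≤v = L⇒inc (R⇒L ryv)
        level : d z ≡ suc (d y)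
        level = trans up-z (cong suc dv)
        M-from : ∀ {w} → L v w → ¬ Inc y w → M y w
        M-from {w} (vw , dw) ¬p = yw , same , ¬p
          where
          same : d w ≡ d y
          same = trans dw dv
          yw≢0 : dist y w ≢ 0
          yw≢0 eq = ¬p (subst (Inc y) (dist≡0⇒≡ eq) (inc-refl y))
          yw≢1 : dist y w ≢ 1
          yw≢1 eq = ¬p (adjacent⇒inc eq (≤-reflexive same))
          yw : dist y w ≡ 2
          yw = ≤-antisym (path-2 yv vw) (≤∧≢⇒< (n≢0⇒n>0 yw≢0) (≢-sym yw≢1))
        out : ℕ
        out = # (λ w → between v z w ×-dec ¬? (inc? y w))
        cases : Dec (Inc z y) → out ≡ κ y z
        cases (yes p) = trans (suc-injective (trans (cong (_+ out) (sym qnum-1)) (trans (#-between-out y≤v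
            (trans (cong suc (trans (ρ-inc′ p) level)) (cong (_+ d y) (sym vz))) vz) qnum-2))) (sym (κ-yes p))
        -- A w between v and `z` that contained x ∩ y would satisfy x ∩ z ⊆ x ∩ w = x ∩ y. So none
        -- of the 1 + b is lost.
        cases (no ¬p) = trans (cong (_+ out) (sym (#-none {P? = λ w → between v z w ×-dec inc? y w} (λ w (bw , y≤w) →
            let ((_ , dw) , lwz) = N-between nvz bw in
            ¬p (inc-trans (L⇒inc lwz) (inc-back y≤w (≤-reflexive (sym (trans dw dv)))))))))
          (trans (sym (#-split (between v z) (inc? y))) (trans (#-between-all vz) (trans qnum-2 (sym (κ-no ¬p)))))

    LRL : ∀ y z → ∑ (λ w → lr y w * ⟦ L? w z ⟧) ≡ up y * ⟦ L? y z ⟧ + b * (rn y z * κ y z)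
    LRL y z = begin
      ∑ (λ w → lr y w * ⟦ L? w z ⟧)
        ≡⟨ ∑-cong (λ w → trans (cong (_* ⟦ L? w z ⟧) (lr-cases y w)) (r ⟦ w Fin.≟ y ⟧ (up y) b ⟦ M? y w ⟧ ⟦ L? w z ⟧)) ⟩
      ∑ (λ w → ⟦ w Fin.≟ y ⟧ * (up y * ⟦ L? w z ⟧) + b * (⟦ M? y w ⟧ * ⟦ L? w z ⟧))
        ≡⟨ ∑-+ (λ w → ⟦ w Fin.≟ y ⟧ * (up y * ⟦ L? w z ⟧)) (λ w → b * (⟦ M? y w ⟧ * ⟦ L? w z ⟧)) ⟩
      ∑ (λ w → ⟦ w Fin.≟ y ⟧ * (up y * ⟦ L? w z ⟧)) + ∑ (λ w → b * (⟦ M? y w ⟧ * ⟦ L? w z ⟧))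
        ≡⟨ cong₂ _+_
             (trans (∑-single y (λ w w≢y → cong (_* (up y * ⟦ L? w z ⟧)) (⟦⟧-no w≢y (w Fin.≟ y))))
               (trans (cong (_* (up y * ⟦ L? y z ⟧)) (⟦⟧-yes refl (y Fin.≟ y))) (+-identityʳ (up y * ⟦ L? y z ⟧))))
             (trans (∑-*ˡ b (λ w → ⟦ M? y w ⟧ * ⟦ L? w z ⟧)) (cong (b *_)
               (trans (∑-cong (λ w → sym (⟦⟧-× (M? y w) (L? w z))))
                 (trans (sym (#-∑ (λ w → M? y w ×-dec L? w z))) (#M-L y z))))) ⟩
      up y * ⟦ L? y z ⟧ + b * (rn y z * κ y z) ∎
      where
      open ≡-Reasoning
      r : ∀ e u c k l → (e * u + c * k) * l ≡ e * (u * l) + c * (k * l)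
      r = solve-∀

    -- Given w with `N y w` and `R w z`, some v between `y` and w contains x ∩ z, and then x ∩ v = x
    -- ∩ z by levels. Were v ≠ z, the vertex w above both would contradict the vanishing of LR at
    -- (v, z). So z = v lies one step above `y`, and every neighbour further up from `z` counts.
    nr-inc : ∀ {y z} → Inc z y → nr y z ≡ up z * ⟦ L? y z ⟧
    nr-inc {y} {z} p with L? y z
    ... | yes (yz , up-z) = trans (#-cong
        (λ w ((_ , dw) , (wz , q)) → trans (dist-sym z w) wz , up⇒not-inc (sym q))
        (λ w (zw , ¬q) → let lzw = zw , not-inc⇒up zw ¬q in LL⇒N (yz , up-z) lzw , L⇒R lzw))
      (sym (*-identityʳ (up z)))
    ... | no ¬l = trans (#-none none) (sym (*-zeroʳ (up z)))
      where
      none : ∀ w → ¬ (N y w × R w z)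
      none w (nyw@(yw , dw) , rwz@(wz , q)) = ¬l (subst (L y) v≡z lyv)
        where
        found : ∃[ v ] ((dist y v ≡ 1 × suc (dist v w) ≡ dist y w) × Inc z v)
        found = #-∃ {P? = λ v → between y w v ×-dec inc? z v} (≤-reflexive (sym (trans
          (#-between-inc {z} {y} {w} {1} p
            (trans (cong suc (trans (ρ-inc′ (L⇒inc (R⇒L rwz))) (sym q))) (cong (_+ d z) (sym yw))))
          qnum-1)))
        v : Fin m
        v = proj₁ found
        lyv : L y v
        lyv = proj₁ (N-between nyw (proj₁ (proj₂ found)))
        lvw : L v w
        lvw = proj₂ (N-between nyw (proj₁ (proj₂ found)))
        v≡z : v ≡ z
        v≡z = decidable-stable (v Fin.≟ z) λ v≢z → #-empty
          (trans (lr-off-diagonal v≢z) (trans (cong (b *_) (⟦⟧-no (λ (_ , _ , ¬q) → ¬q v≤z) (M? v z))) (*-zeroʳ b)))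
          w (lvw , rwz)
          where
          v≤z : Inc v z
          v≤z = inc-back (proj₂ (proj₂ found)) (≤-reflexive (suc-injective (trans q (proj₂ lvw))))

    -- Distances 1 and 2 would imply x ∩ z ⊆ y, and both counts need distance at most 3. At distance
    -- 3 one has ρ = d y + 2, `rn` is 1 and `nr` is b².
    nr-not-inc : ∀ {y z} → d z ≡ suc (d y) → ¬ Inc z y → nr y z ≡ b * b * rn y z
    nr-not-inc {y} {z} up-z ¬p with dist y z ≟ 3
    ... | no ¬3 = trans (#-none (λ w (nyw , rwz) → far
      (≤-trans (dist-triangle y w z) (≤-reflexive (cong₂ _+_ (proj₁ nyw) (proj₁ rwz))))))
        (sym (trans (cong (b * b *_) (#-none
          (λ w (ryw , nwz) → far (≤-trans (dist-triangle y w z) (≤-reflexive (cong₂ _+_ (proj₁ ryw) (proj₁ nwz)))))))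
          (*-zeroʳ (b * b))))
      where
      far : ¬ dist y z ≤ 3
      far le with dist y z in eq
      ... | zero = 1+n≢n (trans (sym up-z) (cong d (sym (dist≡0⇒≡ eq))))
      ... | suc zero = ¬p (L⇒inc (eq , up-z))
      ... | suc (suc zero) = ¬p (step-inc eq up-z)
      ... | suc (suc (suc zero)) = ¬3 refl
      ... | suc (suc (suc (suc _))) = contradiction le (λ { (s≤s (s≤s (s≤s ()))) })
    ... | yes yz = trans nr≡ (sym (trans (cong (b * b *_) rn≡) (*-identityʳ (b * b))))
      where
      ρ≡ : ρ x y z ≡ 2 + d y
      ρ≡ = ≤-antisym (half-≤ (≤-trans (ρ-bound yz)
        (≤-trans (≤-reflexive (trans (cong (d y + 3 +_) up-z) (r (d y)))) (n≤1+n _))))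
        (≤-trans (≤-reflexive (cong suc (sym up-z))) (≰⇒> (λ le → ¬p (ρ≤⇒⊆ (≤-trans (≤-reflexive (ρ-swapʳ x z y)) le)))))
        where
        r : ∀ i → i + 3 + suc i ≡ (2 + i) + (2 + i)
        r = solve-∀
      -- Just one neighbour of `y` towards `z` contains x ∩ y. It must go down: on the level of `y`
      -- it would satisfy x ∩ z ⊆ x ∩ w = x ∩ y.
      rn≡ : rn y z ≡ 1
      rn≡ = trans (#-cong to from) (trans
        (#-between-inc {y} {y} {z} {1} (inc-refl y) (trans (cong suc ρ≡) (cong (_+ d y) (sym yz)))) qnum-1)
        where
        to : ∀ w → R y w × N w z → (dist y w ≡ 1 × suc (dist w z) ≡ dist y z) × Inc y w
        to w (ryw , nwz) = (proj₁ ryw , trans (cong suc (proj₁ nwz)) (sym yz)) , L⇒inc (R⇒L ryw)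
        from : ∀ w → (dist y w ≡ 1 × suc (dist w z) ≡ dist y z) × Inc y w → R y w × N w z
        from w ((yw , closer) , y≤w) = (yw , dw) , (wz , trans up-z (cong suc (sym dw)))
          where
          wz : dist w z ≡ 2
          wz = suc-injective (trans closer yz)
          dw : suc (d w) ≡ d y
          dw = ≤-antisym
            (≰⇒> (λ le → ¬p (inc-trans (step-inc wz (trans up-z (cong suc (≤-antisym le (inc⇒≤ y≤w))))) (inc-back y≤w le))))
            (d-down yw)
      zy : dist z y ≡ 3
      zy = trans (dist-sym z y) yz
      -- Seen from `z`, there are [3] neighbours towards `y`, of which [2] contain x ∩ z; the other
      -- b² go up.
      nr≡ : nr y z ≡ b * b
      nr≡ = trans (#-cong
          (λ w (nyw , rwz) → (trans (dist-sym z w) (proj₁ rwz) , trans (cong suc (trans (dist-sym w y) (proj₁ nyw)))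
            (sym zy)) , up⇒not-inc (sym (proj₂ rwz)))
          (λ w ((zw , closer) , ¬q) → let dw = not-inc⇒up zw ¬q in
            (trans (dist-sym y w) (suc-injective (trans closer zy)) , trans dw (cong suc up-z)) ,
              (trans (dist-sym w z) zw , sym dw)))
        (+-cancelˡ-≡ (1 + b) _ _ (trans (cong (_+ # (λ w → between z y w ×-dec ¬? (inc? z w))) (sym qnum-2))
          (trans (#-between-out {z} {z} {y} {2} (inc-refl z)
            (trans (cong (2 +_) (trans (ρ-swapʳ x z y) ρ≡)) (trans (cong (3 +_) (sym up-z)) (cong (_+ d z) (sym zy)))) zy)
            (cong suc (trans (cong (b *_) qnum-2) (trans (*-distribˡ-+ b 1 b) (cong (_+ b * b) (*-identityʳ b))))))))

    -- The cubic relation with L² = (b + 1) N inserted, multiplied by b and freed of negative terms: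
    -- b³ RN + NR + s b^D L = b LRL.
    cubic : ∀ y z → b * (b * (b * rn y z)) + nr y z + s * b ^ D * ⟦ L? y z ⟧ ≡ b * ∑ (λ w → lr y w * ⟦ L? w z ⟧)
    cubic y z = trans (cases (d z ≟ suc (d y)) (inc? z y)) (cong (b *_) (sym (LRL y z)))
      where
      open ≡-Reasoning
      ℓ : ℕ
      ℓ = ⟦ L? y z ⟧
      ℓ-cong : ∀ {j k} → (L y z → j ≡ k) → j * ℓ ≡ k * ℓ
      ℓ-cong {j} {k} h with L? y z
      ... | yes l = cong (_* 1) (h l)
      ... | no _  = trans (*-zeroʳ j) (sym (*-zeroʳ k))
      -- From `up-count` on consecutive levels, using [k + 1] = 1 + b [k] and (b - 1) [D] + 1 = b^D.
      valencies : L y z → up z + s * b ^ D ≡ b * up y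
      valencies (_ , up-z) = +-cancelʳ-≡ (s + b * (s * qnum (d y))) _ _ (begin
        up z + s * b ^ D + (s + b * (s * qnum (d y)))       ≡⟨ r₁ (up z) s (b ^ D) b (qnum (d y)) ⟩
        up z + s * qnum (suc (d y)) + s * b ^ D             ≡⟨ cong (λ i → up z + s * qnum i + s * b ^ D) up-z ⟨
        up z + s * qnum (d z) + s * b ^ D                   ≡⟨ cong₂ _+_ (up-count z) (cong (s *_) (sym (qnum-spec D))) ⟩
        s * qnum D + s * (pred b * qnum D + 1)              ≡⟨ r₂ s (qnum D) (pred b) ⟩
        suc (pred b) * (s * qnum D) + s                     ≡⟨ cong (λ c → c * (s * qnum D) + s) (suc-pred b) ⟩
        b * (s * qnum D) + s                                ≡⟨ cong (λ t → b * t + s) (up-count y) ⟨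
        b * (up y + s * qnum (d y)) + s                     ≡⟨ r₃ b (up y) (s * qnum (d y)) s ⟩
        b * up y + (s + b * (s * qnum (d y)))               ∎)
        where
        r₁ : ∀ u s e c q → u + s * e + (s + c * (s * q)) ≡ u + s * (1 + c * q) + s * e
        r₁ = solve-∀
        r₂ : ∀ s q p → s * q + s * (p * q + 1) ≡ suc p * (s * q) + s
        r₂ = solve-∀
        r₃ : ∀ c u t s → c * (u + t) + s ≡ c * u + (s + c * t)
        r₃ = solve-∀
      cases : Dec (d z ≡ suc (d y)) → Dec (Inc z y) →
        b * (b * (b * rn y z)) + nr y z + s * b ^ D * ℓ ≡ b * (up y * ℓ + b * (rn y z * κ y z))
      cases (no ¬up) _ = trans
        (cong₂ (λ i j → b * (b * (b * i)) + j + s * b ^ D * ℓ) rn≡0 nr≡0)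
        (trans (cong (λ l → b * (b * (b * 0)) + 0 + s * b ^ D * l) ℓ≡0)
          (trans (r (s * b ^ D) b (up y) (κ y z)) (cong₂ (λ l i → b * (up y * l + b * (i * κ y z))) (sym ℓ≡0) (sym rn≡0))))
        where
        rn≡0 : rn y z ≡ 0
        rn≡0 = #-none (λ w ((_ , q) , (_ , q′)) → ¬up (trans q′ (cong suc q)))
        nr≡0 : nr y z ≡ 0
        nr≡0 = #-none (λ w ((_ , q) , (_ , q′)) → ¬up (suc-injective (trans q′ q)))
        ℓ≡0 : ℓ ≡ 0
        ℓ≡0 = ⟦⟧-no (λ (_ , q) → ¬up q) (L? y z)
        r : ∀ t c u k → c * (c * (c * 0)) + 0 + t * 0 ≡ c * (u * 0 + c * (0 * k))
        r = solve-∀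
      cases (yes up-z) (yes p) = begin
        b * (b * (b * rn y z)) + nr y z + s * b ^ D * ℓ
          ≡⟨ cong (λ t → b * (b * (b * rn y z)) + t + s * b ^ D * ℓ) (nr-inc p) ⟩
        b * (b * (b * rn y z)) + up z * ℓ + s * b ^ D * ℓ        ≡⟨ r₁ (b * (b * (b * rn y z))) (up z) (s * b ^ D) ℓ ⟩
        b * (b * (b * rn y z)) + (up z + s * b ^ D) * ℓ          ≡⟨ cong (b * (b * (b * rn y z)) +_) (ℓ-cong valencies) ⟩
        b * (b * (b * rn y z)) + b * up y * ℓ                    ≡⟨ r₂ b (rn y z) (up y) ℓ ⟩
        b * (up y * ℓ + b * (rn y z * b))
          ≡⟨ cong (λ k → b * (up y * ℓ + b * (rn y z * k))) (κ-yes p) ⟨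
        b * (up y * ℓ + b * (rn y z * κ y z))                    ∎
        where
        r₁ : ∀ a u t l → a + u * l + t * l ≡ a + (u + t) * l
        r₁ = solve-∀
        r₂ : ∀ c i u l → c * (c * (c * i)) + c * u * l ≡ c * (u * l + c * (i * c))
        r₂ = solve-∀
      cases (yes up-z) (no ¬p) = begin
        b * (b * (b * rn y z)) + nr y z + s * b ^ D * ℓ
          ≡⟨ cong₂ (λ t l → b * (b * (b * rn y z)) + t + s * b ^ D * l) (nr-not-inc up-z ¬p) ℓ≡0 ⟩
        b * (b * (b * rn y z)) + b * b * rn y z + s * b ^ D * 0  ≡⟨ r b (rn y z) (s * b ^ D) (up y) ⟩
        b * (up y * 0 + b * (rn y z * (1 + b)))
          ≡⟨ cong₂ (λ l k → b * (up y * l + b * (rn y z * k))) ℓ≡0 (κ-no ¬p) ⟨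
        b * (up y * ℓ + b * (rn y z * κ y z))                    ∎
        where
        ℓ≡0 : ℓ ≡ 0
        ℓ≡0 = ⟦⟧-no (λ l → ¬p (L⇒inc l)) (L? y z)
        r : ∀ c i t u → c * (c * (c * i)) + c * c * i + t * 0 ≡ c * (u * 0 + c * (i * (1 + c)))
        r = solve-∀

open Combinatorics

open import Data.Nat using (ℕ; _≤_; _^_; _∸_; suc; zero; NonZero)
import Data.Nat as ℕ
import Data.Nat.Properties as ℕ
open import Data.Nat.Tactic.RingSolver using (solve-∀)
open import Data.Bool using (if_then_else_)
open import Data.Fin using (Fin) renaming (zero to fzero; suc to fsuc)
import Data.Fin.Properties as Fin
open import Data.Integer using (+_)
import Data.Integer as ℤ
import Data.Integer.Properties as ℤ
import Data.List as List
open import Data.Product using (_×_; _,_)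
open import Data.Rational using (ℚ; 0ℚ; 1ℚ; _/_; _+_; _-_; -_; _*_; fromℚᵘ)
open import Data.Rational.Properties
open import Data.Rational.Solver using (module +-*-Solver)
open import Data.Rational.Unnormalised using (mkℚᵘ; *≡*)
import Data.Rational.Unnormalised as ℚᵘ
import Data.Rational.Unnormalised.Properties as ℚᵘ
open import Relation.Binary.PropositionalEquality
open import Relation.Nullary using (Dec; yes; no; contradiction; does)
open import Relation.Nullary.Decidable using (_×-dec_)

-- Rational matrices with natural entries

-- Normalised fractions do not compute with variable entries, so arithmetic of `ℕtoℚ` is done in the
-- unnormalised rationals and transported back.
fromℚᵘ-+ : ∀ p q → fromℚᵘ p + fromℚᵘ q ≡ fromℚᵘ (p ℚᵘ.+ q)
fromℚᵘ-+ p q = trans (sym (fromℚᵘ-toℚᵘ _)) (fromℚᵘ-cong (ℚᵘ.≃-trans (toℚᵘ-homo-+ (fromℚᵘ p) (fromℚᵘ q))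
  (ℚᵘ.+-cong (toℚᵘ-fromℚᵘ p) (toℚᵘ-fromℚᵘ q))))

fromℚᵘ-* : ∀ p q → fromℚᵘ p * fromℚᵘ q ≡ fromℚᵘ (p ℚᵘ.* q)
fromℚᵘ-* p q = trans (sym (fromℚᵘ-toℚᵘ _)) (fromℚᵘ-cong (ℚᵘ.≃-trans (toℚᵘ-homo-* (fromℚᵘ p) (fromℚᵘ q))
  (ℚᵘ.*-cong (toℚᵘ-fromℚᵘ p) (toℚᵘ-fromℚᵘ q))))

ℕtoℚ-+ : ∀ i j → ℕtoℚ (i ℕ.+ j) ≡ ℕtoℚ i + ℕtoℚ j
ℕtoℚ-+ i j = sym (trans (fromℚᵘ-+ (mkℚᵘ (+ i) 0) (mkℚᵘ (+ j) 0))
  (cong (_/ 1) (cong₂ ℤ._+_ (ℤ.*-identityʳ (+ i)) (ℤ.*-identityʳ (+ j)))))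

ℕtoℚ-* : ∀ i j → ℕtoℚ (i ℕ.* j) ≡ ℕtoℚ i * ℕtoℚ j
ℕtoℚ-* i j = sym (trans (fromℚᵘ-* (mkℚᵘ (+ i) 0) (mkℚᵘ (+ j) 0)) (cong (_/ 1) (sym (ℤ.pos-* i j))))

/-cancel : ∀ i n .{{_ : NonZero n}} → (+ i / n) * ℕtoℚ n ≡ ℕtoℚ i
/-cancel i (suc n) = trans (fromℚᵘ-* (mkℚᵘ (+ i) n) (mkℚᵘ (+ suc n) 0))
  (fromℚᵘ-cong {mkℚᵘ (+ i) n ℚᵘ.* mkℚᵘ (+ suc n) 0} {mkℚᵘ (+ i) 0} (*≡* (trans (ℤ.*-identityʳ (+ i ℤ.* + suc n))
  (cong (λ k → + i ℤ.* + k) (sym (ℕ.*-identityʳ (suc n)))))))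

*-inverse-unique : ∀ {p q} r → p * r ≡ 1ℚ → q * r ≡ 1ℚ → p ≡ q
*-inverse-unique {p} {q} r pr qr = begin
  p            ≡⟨ *-identityʳ p ⟨
  p * 1ℚ       ≡⟨ cong (p *_) (trans (sym qr) (*-comm q r)) ⟩
  p * (r * q)  ≡⟨ *-assoc p r q ⟨
  p * r * q    ≡⟨ cong (_* q) pr ⟩
  1ℚ * q       ≡⟨ *-identityˡ q ⟩
  q            ∎
  where open ≡-Reasoning

invPow-inverse : ∀ b .{{_ : NonZero b}} i → invPow b i * ℕtoℚ (b ℕ.^ i) ≡ 1ℚ
invPow-inverse b@(suc _) i = /-cancel 1 (b ℕ.^ i) {{ℕ.m^n≢0 b i}}

invPow-1 : ∀ b .{{_ : NonZero b}} → invPow b 1 * ℕtoℚ b ≡ 1ℚ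
invPow-1 b = trans (cong (λ k → invPow b 1 * ℕtoℚ k) (sym (ℕ.^-identityʳ b))) (invPow-inverse b 1)

invPow-suc : ∀ b .{{_ : NonZero b}} i → invPow b (suc i) ≡ invPow b 1 * invPow b i
invPow-suc b i = *-inverse-unique (ℕtoℚ (b ℕ.^ suc i)) (invPow-inverse b (suc i)) (begin
  invPow b 1 * invPow b i * ℕtoℚ (b ℕ.* b ℕ.^ i)          ≡⟨ cong (invPow b 1 * invPow b i *_) (ℕtoℚ-* b (b ℕ.^ i)) ⟩
  invPow b 1 * invPow b i * (ℕtoℚ b * ℕtoℚ (b ℕ.^ i))
    ≡⟨ *-interchange (invPow b 1) (invPow b i) (ℕtoℚ b) (ℕtoℚ (b ℕ.^ i)) ⟩
  (invPow b 1 * ℕtoℚ b) * (invPow b i * ℕtoℚ (b ℕ.^ i))   ≡⟨ cong₂ _*_ (invPow-1 b) (invPow-inverse b i) ⟩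
  1ℚ                                                      ∎)
  where
  open ≡-Reasoning
  *-interchange : ∀ p q r t → p * q * (r * t) ≡ (p * r) * (q * t)
  *-interchange = solve 4 (λ p q r t → p :* q :* (r :* t) := (p :* r) :* (q :* t)) refl
    where open +-*-Solver

invPow-pred : ∀ b .{{_ : NonZero b}} i → invPow b i ≡ ℕtoℚ b * invPow b (suc i)
invPow-pred b i = sym (begin
  ℕtoℚ b * invPow b (suc i)             ≡⟨ cong (ℕtoℚ b *_) (invPow-suc b i) ⟩
  ℕtoℚ b * (invPow b 1 * invPow b i)    ≡⟨ *-assoc (ℕtoℚ b) (invPow b 1) (invPow b i) ⟨
  ℕtoℚ b * invPow b 1 * invPow b i      ≡⟨ cong (_* invPow b i) (trans (*-comm (ℕtoℚ b) (invPow b 1)) (invPow-1 b)) ⟩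
  1ℚ * invPow b i                       ≡⟨ *-identityˡ _ ⟩
  invPow b i                            ∎)
  where open ≡-Reasoning

sumFin-cong : ∀ m {f g : Fin m → ℚ} → (∀ i → f i ≡ g i) → sumFin m f ≡ sumFin m g
sumFin-cong zero    eq = refl
sumFin-cong (suc m) eq = cong₂ _+_ (eq fzero) (sumFin-cong m (λ i → eq (fsuc i)))

sumFin-0 : ∀ m {f : Fin m → ℚ} → (∀ i → f i ≡ 0ℚ) → sumFin m f ≡ 0ℚ
sumFin-0 zero    eq = refl
sumFin-0 (suc m) eq = trans (cong₂ _+_ (eq fzero) (sumFin-0 m (λ i → eq (fsuc i)))) (+-identityˡ 0ℚ)

sumFin-single : ∀ {m} (i : Fin m) {f : Fin m → ℚ} → (∀ j → j ≢ i → f j ≡ 0ℚ) → sumFin m f ≡ f i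
sumFin-single {suc m} fzero    {f} off = trans (cong (λ t → f fzero + t) (sumFin-0 m (λ j → off (fsuc j) λ ())))
  (+-identityʳ _)
sumFin-single {suc m} (fsuc i) {f} off = trans (cong₂ _+_ (off fzero λ ())
  (sumFin-single i (λ j j≢i → off (fsuc j) (λ eq → j≢i (Fin.suc-injective eq))))) (+-identityˡ _)

sumFin-ℕtoℚ : ∀ m (f : Fin m → ℕ) → sumFin m (λ i → ℕtoℚ (f i)) ≡ ℕtoℚ (∑ f)
sumFin-ℕtoℚ m f = go m (λ i → i)
  where
  -- The enumeration of `Fin m` is a `tabulate` of the identity; the induction requires an arbitrary
  -- `g` in its place.
  go : ∀ k (g : Fin k → Fin m) → sumFin k (λ i → ℕtoℚ (f (g i))) ≡ ℕtoℚ (sumOver (List.tabulate g) f)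
  go zero    g = refl
  go (suc k) g = trans (cong (λ t → ℕtoℚ (f (g fzero)) + t) (go k (λ i → g (fsuc i))))
    (sym (ℕtoℚ-+ (f (g fzero)) (sumOver (List.tabulate (λ i → g (fsuc i))) f)))

-- The Boolean tests in the matrices compute to `does` of `L?`, `F?` and `R?`, so this lemma applies
-- to their entries directly.
if-does : {P : Set} (p : Dec P) → (if does p then 1ℚ else 0ℚ) ≡ ℕtoℚ ⟦ p ⟧
if-does (yes _) = refl
if-does (no _)  = refl

infixl 7 _∙_
_∙_ : ∀ {m} → (Fin m → Fin m → ℕ) → (Fin m → Fin m → ℕ) → Fin m → Fin m → ℕ
(f ∙ g) y z = ∑ (λ w → f y w ℕ.* g w z)

∙-assoc : ∀ {m} (f g h : Fin m → Fin m → ℕ) y z → ((f ∙ g) ∙ h) y z ≡ (f ∙ (g ∙ h)) y z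
∙-assoc f g h y z = begin
  ∑ (λ w → ∑ (λ v → f y v ℕ.* g v w) ℕ.* h w z)     ≡⟨ ∑-cong (λ w → ∑-*ʳ (λ v → f y v ℕ.* g v w) (h w z)) ⟨
  ∑ (λ w → ∑ (λ v → f y v ℕ.* g v w ℕ.* h w z))     ≡⟨ ∑-swap (λ w v → f y v ℕ.* g v w ℕ.* h w z) ⟩
  ∑ (λ v → ∑ (λ w → f y v ℕ.* g v w ℕ.* h w z))     ≡⟨ ∑-cong (λ v → ∑-cong (λ w → ℕ.*-assoc (f y v) (g v w) (h w z))) ⟩
  ∑ (λ v → ∑ (λ w → f y v ℕ.* (g v w ℕ.* h w z)))   ≡⟨ ∑-cong (λ v → ∑-*ˡ (f y v) (λ w → g v w ℕ.* h w z)) ⟩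
  ∑ (λ v → f y v ℕ.* ∑ (λ w → g v w ℕ.* h w z))     ∎
  where open ≡-Reasoning

∙-transpose : ∀ {m} {f f′ g g′ : Fin m → Fin m → ℕ} → (∀ y z → f y z ≡ f′ z y) → (∀ y z → g y z ≡ g′ z y) →
  ∀ y z → (f ∙ g) y z ≡ (g′ ∙ f′) z y
∙-transpose {f = f} {f′} {g} {g′} eq eq′ y z = ∑-cong (λ w →
  trans (cong₂ ℕ._*_ (eq y w) (eq′ w z)) (ℕ.*-comm (f′ w y) (g′ z w)))

-- Wrapped in a record so that `f` and `M` remain visible to unification.
record Represents {m} (f : Fin m → Fin m → ℕ) (M : Mat m) : Set where
  constructor represents
  field
    entry : ∀ y z → M y z ≡ ℕtoℚ (f y z)

open Represents

⊗-represents : ∀ {m} {f g : Fin m → Fin m → ℕ} {M N : Mat m} →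
  Represents f M → Represents g N → Represents (f ∙ g) (M ⊗ N)
⊗-represents {m} {f} {g} F G = represents λ y z → trans
  (sumFin-cong m (λ w → trans (cong₂ _*_ (entry F y w) (entry G w z)) (sym (ℕtoℚ-* (f y w) (g w z)))))
  (sumFin-ℕtoℚ m (λ w → f y w ℕ.* g w z))

quadratic-relation : ∀ b s {i j l : ℕ} → i ℕ.+ l ≡ b ℕ.* j ℕ.+ s ℕ.* l →
  ℕtoℚ i - ℕtoℚ b * ℕtoℚ j ≡ (ℕtoℚ s - 1ℚ) * ℕtoℚ l
quadratic-relation b s {i} {j} {l} eq = begin
  ℕtoℚ i - ℕtoℚ b * ℕtoℚ j                                    ≡⟨ r₁ (ℕtoℚ i) (ℕtoℚ b * ℕtoℚ j) (ℕtoℚ l) ⟩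
  ℕtoℚ i + ℕtoℚ l - (ℕtoℚ b * ℕtoℚ j + ℕtoℚ l)                ≡⟨ cong (_- (ℕtoℚ b * ℕtoℚ j + ℕtoℚ l)) eqℚ ⟩
  ℕtoℚ b * ℕtoℚ j + ℕtoℚ s * ℕtoℚ l - (ℕtoℚ b * ℕtoℚ j + ℕtoℚ l) ≡⟨ r₂ (ℕtoℚ b * ℕtoℚ j) (ℕtoℚ s) (ℕtoℚ l) ⟩
  (ℕtoℚ s - 1ℚ) * ℕtoℚ l                                      ∎
  where
  open ≡-Reasoning
  open +-*-Solver
  r₁ : ∀ p q r → p - q ≡ p + r - (q + r)
  r₁ = solve 3 (λ p q r → p :- q := p :+ r :- (q :+ r)) refl
  r₂ : ∀ q t r → q + t * r - (q + r) ≡ (t - 1ℚ) * r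
  r₂ = solve 3 (λ q t r → q :+ t :* r :- (q :+ r) := (t :- con 1ℚ) :* r) refl
  eqℚ : ℕtoℚ i + ℕtoℚ l ≡ ℕtoℚ b * ℕtoℚ j + ℕtoℚ s * ℕtoℚ l
  eqℚ = trans (sym (ℕtoℚ-+ i l))
    (trans (cong ℕtoℚ eq) (trans (ℕtoℚ-+ (b ℕ.* j) (s ℕ.* l)) (cong₂ _+_ (ℕtoℚ-* b j) (ℕtoℚ-* s l))))

-- The natural identity is divided by b through p = 1/b; `D` ≥ 1 allows b^D to be split as b ·
-- b^(D-1). The factors `suc b` from L² = (b + 1) N cancel the denominators.
cubic-relation : ∀ b .{{_ : NonZero b}} s D {i j k l : ℕ} → 1 ℕ.≤ D →
  b ℕ.* (b ℕ.* (b ℕ.* i)) ℕ.+ j ℕ.+ s ℕ.* b ℕ.^ D ℕ.* l ≡ b ℕ.* k →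
  (+ (b ℕ.^ 2) / suc b) * ℕtoℚ (suc b ℕ.* i) - ℕtoℚ k + (invPow b 1 * (+ 1 / suc b)) * ℕtoℚ (suc b ℕ.* j)
  ≡ (- (ℕtoℚ s * ℕtoℚ (b ℕ.^ (D ℕ.∸ 1)))) * ℕtoℚ l
cubic-relation b s (suc D) {i} {j} {k} {l} _ eq = begin
  c₁ * ℕtoℚ (suc b ℕ.* i) - X + p * c₀ * ℕtoℚ (suc b ℕ.* j)
    ≡⟨ cong₂ (λ u v → u - X + v)
         (trans (cong (c₁ *_) (ℕtoℚ-* (suc b) i))
           (trans (sym (*-assoc c₁ (ℕtoℚ (suc b)) I)) (cong (_* I) (trans (/-cancel (b ℕ.^ 2) (suc b)) b²))))
         (trans (cong (p * c₀ *_) (ℕtoℚ-* (suc b) j)) (trans (r₁ p c₀ (ℕtoℚ (suc b)) J′)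
           (trans (cong (λ u → p * u * J′) (/-cancel 1 (suc b))) (cong (_* J′) (*-identityʳ p))))) ⟩
  B * B * I - X + p * J′
    ≡⟨ cong (λ u → B * B * I - u + p * J′) X≡ ⟩
  B * B * I - (B * B * I + S * E * Λ + p * J′) + p * J′
    ≡⟨ r₃ (B * B * I) (S * E) Λ (p * J′) ⟩
  (- (S * E)) * Λ ∎
  where
  open ≡-Reasoning
  open +-*-Solver
  c₀ c₁ B S I J′ X Λ E p : ℚ
  c₀ = + 1 / suc b
  c₁ = + (b ℕ.^ 2) / suc b
  B = ℕtoℚ b
  S = ℕtoℚ s
  I = ℕtoℚ i
  J′ = ℕtoℚ j
  X = ℕtoℚ k
  Λ = ℕtoℚ l
  E = ℕtoℚ (b ℕ.^ D)
  p = invPow b 1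
  b² : ℕtoℚ (b ℕ.^ 2) ≡ B * B
  b² = trans (cong (λ t → ℕtoℚ (b ℕ.* t)) (ℕ.*-identityʳ b)) (ℕtoℚ-* b b)
  r₁ : ∀ p u v w → p * u * (v * w) ≡ p * (u * v) * w
  r₁ = solve 4 (λ p u v w → p :* u :* (v :* w) := p :* (u :* v) :* w) refl
  r₂ : ∀ p B I J S E Λ → p * (B * (B * (B * I)) + J + S * (B * E) * Λ) ≡ (p * B) * (B * B * I + S * E * Λ) + p * J
  r₂ = solve 7 (λ p B I J S E Λ → p :* (B :* (B :* (B :* I)) :+ J :+ S :* (B :* E) :* Λ)
         := (p :* B) :* (B :* B :* I :+ S :* E :* Λ) :+ p :* J) refl
  r₃ : ∀ u v w t → u - (u + v * w + t) + t ≡ (- v) * w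
  r₃ = solve 4 (λ u v w t → u :- (u :+ v :* w :+ t) :+ t := (:- v) :* w) refl
  eqℚ : B * X ≡ B * (B * (B * I)) + J′ + S * (B * E) * Λ
  eqℚ = begin
    B * X                                                            ≡⟨ ℕtoℚ-* b k ⟨
    ℕtoℚ (b ℕ.* k)                                                   ≡⟨ cong ℕtoℚ eq ⟨
    ℕtoℚ (b ℕ.* (b ℕ.* (b ℕ.* i)) ℕ.+ j ℕ.+ s ℕ.* b ℕ.^ suc D ℕ.* l)
      ≡⟨ trans (ℕtoℚ-+ (b ℕ.* (b ℕ.* (b ℕ.* i)) ℕ.+ j) (s ℕ.* b ℕ.^ suc D ℕ.* l))
           (cong (_+ ℕtoℚ (s ℕ.* b ℕ.^ suc D ℕ.* l)) (ℕtoℚ-+ (b ℕ.* (b ℕ.* (b ℕ.* i))) j)) ⟩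
    ℕtoℚ (b ℕ.* (b ℕ.* (b ℕ.* i))) + J′ + ℕtoℚ (s ℕ.* b ℕ.^ suc D ℕ.* l)
      ≡⟨ cong₂ (λ u v → u + J′ + v)
           (trans (ℕtoℚ-* b (b ℕ.* (b ℕ.* i))) (cong (B *_) (trans (ℕtoℚ-* b (b ℕ.* i)) (cong (B *_) (ℕtoℚ-* b i)))))
           (trans (ℕtoℚ-* (s ℕ.* b ℕ.^ suc D) l)
             (cong (_* Λ) (trans (ℕtoℚ-* s (b ℕ.^ suc D)) (cong (S *_) (ℕtoℚ-* b (b ℕ.^ D)))))) ⟩
    B * (B * (B * I)) + J′ + S * (B * E) * Λ                         ∎
  X≡ : X ≡ B * B * I + S * E * Λ + p * J′
  X≡ = begin
    X                                                ≡⟨ *-identityˡ X ⟨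
    1ℚ * X                                           ≡⟨ cong (_* X) (invPow-1 b) ⟨
    p * B * X                                        ≡⟨ *-assoc p B X ⟩
    p * (B * X)                                      ≡⟨ cong (p *_) eqℚ ⟩
    p * (B * (B * (B * I)) + J′ + S * (B * E) * Λ)   ≡⟨ r₂ p B I J′ S E Λ ⟩
    (p * B) * (B * B * I + S * E * Λ) + p * J′       ≡⟨ cong (λ u → u * (B * B * I + S * E * Λ) + p * J′) (invPow-1 b) ⟩
    1ℚ * (B * B * I + S * E * Λ) + p * J′            ≡⟨ cong (_+ p * J′) (*-identityˡ (B * B * I + S * E * Λ)) ⟩
    B * B * I + S * E * Λ + p * J′                   ∎

-- Multiplication by the diagonal matrix K

module _ (b m : ℕ) (dist : Fin m → Fin m → ℕ) (x : Fin m) where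
  open Matrices b m dist x

  Km-diagonal : ∀ y → Km y y ≡ invPow b (dist x y)
  Km-diagonal y with y Fin.≟ y
  ... | yes _ = refl
  ... | no ¬p = contradiction refl ¬p

  Km-off : ∀ {y z} → y ≢ z → Km y z ≡ 0ℚ
  Km-off {y} {z} y≢z with y Fin.≟ z
  ... | yes p = contradiction p y≢z
  ... | no _  = refl

  Km-⊗ : ∀ M y z → (Km ⊗ M) y z ≡ invPow b (dist x y) * M y z
  Km-⊗ M y z = trans
    (sumFin-single y (λ w w≢y → trans (cong (_* M w z) (Km-off (≢-sym w≢y))) (*-zeroˡ (M w z))))
    (cong (_* M y z) (Km-diagonal y))

  ⊗-Km : ∀ M y z → (M ⊗ Km) y z ≡ M y z * invPow b (dist x z)
  ⊗-Km M y z = trans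
    (sumFin-single z (λ w w≢z → trans (cong (M y w *_) (Km-off w≢z)) (*-zeroʳ (M y w))))
    (cong (M y z *_) (Km-diagonal z))

  -- K on the left scales row y by b^(-d y) and on the right scales column z by b^(-d z); the two
  -- need to be compared only on the support of `M`.
  Km-shift : ∀ {P : Fin m → Fin m → Set} (P? : ∀ y z → Dec (P y z)) {M} c →
    Represents (λ y z → ⟦ P? y z ⟧) M →
    (∀ y z → P y z → invPow b (dist x y) ≡ c * invPow b (dist x z)) → Km ⊗ M ≐ c ⊙ (M ⊗ Km)
  Km-shift P? {M} c rep shift y z = trans (Km-⊗ M y z)
    (trans (cases (P? y z) (entry rep y z)) (cong (c *_) (sym (⊗-Km M y z))))
    where
    cases : (p : Dec _) → M y z ≡ ℕtoℚ ⟦ p ⟧ → invPow b (dist x y) * M y z ≡ c * (M y z * invPow b (dist x z))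
    cases (no _)  eq rewrite eq = trans (*-zeroʳ (invPow b (dist x y)))
      (sym (trans (cong (c *_) (*-zeroˡ (invPow b (dist x z)))) (*-zeroʳ c)))
    cases (yes p) eq rewrite eq = trans (*-identityʳ _) (trans (shift y z p) (cong (c *_) (sym (*-identityˡ _))))

theorem1p10 :
    (b : ℕ) → IsPrimePower b → (D : ℕ) → 3 ≤ D →
    (𝔽 : FiniteField b) → (n : ℕ) → (P : LinAlg.PolarSpace 𝔽 D n) →
    (m : ℕ) → (sub : Fin m → LinAlg.SubsetV 𝔽 n) →
    LinAlg.DualPolarVertices 𝔽 P m sub →
    (dist : Fin m → Fin m → ℕ) → LinAlg.IsDistance 𝔽 D m sub dist →
    (x : Fin m) →
    let open Matrices b m dist x
        q2e = LinAlg.q^2e 𝔽 P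
        q² = ℕtoℚ b
        q⁻² = invPow b 1
        c₁ = + (b ^ 2) / suc b
        c₂ = q⁻² * (+ 1 / suc b)
        c₃ = q2e * ℕtoℚ (b ^ (D ∸ 1))
    in (Km ⊗ Lm ≐ q² ⊙ (Lm ⊗ Km)) ×
       (Km ⊗ Fm ≐ Fm ⊗ Km) ×
       (Km ⊗ Rm ≐ q⁻² ⊙ (Rm ⊗ Km)) ×
       (Lm ⊗ Fm ⊟ q² ⊙ (Fm ⊗ Lm) ≐ (q2e - 1ℚ) ⊙ Lm) ×
       (Fm ⊗ Rm ⊟ q² ⊙ (Rm ⊗ Fm) ≐ (q2e - 1ℚ) ⊙ Rm) ×
       (c₁ ⊙ (Rm ⊗ Lm ⊗ Lm) ⊟ Lm ⊗ Rm ⊗ Lm ⊞ c₂ ⊙ (Lm ⊗ Lm ⊗ Rm)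
          ≐ (- c₃) ⊙ Lm) ×
       (c₁ ⊙ (Rm ⊗ Rm ⊗ Lm) ⊟ Rm ⊗ Lm ⊗ Rm ⊞ c₂ ⊙ (Lm ⊗ Rm ⊗ Rm)
          ≐ (- c₃) ⊙ Rm)
theorem1p10 b _ D 3≤D 𝔽 n P m sub V dist isDistance x =
  Km-shift b m dist x L? (ℕtoℚ b) Lm≡ (λ y z (_ , up) →
    trans (invPow-pred b (dist x y)) (cong (λ i → ℕtoℚ b * invPow b i) (sym up))) ,
  (λ y z → trans
    (Km-shift b m dist x F? 1ℚ Fm≡ (λ y z (_ , same) → trans (cong (invPow b) (sym same)) (sym (*-identityˡ _))) y z)
    (*-identityˡ ((Fm ⊗ Km) y z))) ,
  Km-shift b m dist x R? (invPow b 1) Rm≡ (λ y z (_ , down) →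
    trans (cong (invPow b) (sym down)) (invPow-suc b (dist x z))) ,
  (λ y z → quadratic Lm≡ (⊗-represents Lm≡ Fm≡) (⊗-represents Fm≡ Lm≡) y z (LF-FL′ y z)) ,
  (λ y z → quadratic Rm≡ (⊗-represents Fm≡ Rm≡) (⊗-represents Rm≡ Fm≡) y z (begin
    (f ∙ r) y z ℕ.+ r y z             ≡⟨ cong₂ ℕ._+_ (∙-transpose fᵀ rᵀ y z) (rᵀ y z) ⟩
    (l ∙ f) z y ℕ.+ l z y             ≡⟨ LF-FL′ z y ⟩
    b ℕ.* (f ∙ l) z y ℕ.+ s ℕ.* l z y ≡⟨ cong₂ (λ i j → b ℕ.* i ℕ.+ s ℕ.* j) (∙-transpose rᵀ fᵀ y z) (rᵀ y z) ⟨
    b ℕ.* (r ∙ f) y z ℕ.+ s ℕ.* r y z ∎)) ,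
  (λ y z → cubicℚ Lm≡ (⊗-represents (⊗-represents Rm≡ Lm≡) Lm≡)
    (⊗-represents (⊗-represents Lm≡ Rm≡) Lm≡) (⊗-represents (⊗-represents Lm≡ Lm≡) Rm≡) y z
    (rn y z) (nr y z) (RLL y z) (LLR y z) (cubic′ y z)) ,
  (λ y z → cubicℚ Rm≡ (⊗-represents (⊗-represents Rm≡ Rm≡) Lm≡)
    (⊗-represents (⊗-represents Rm≡ Lm≡) Rm≡) (⊗-represents (⊗-represents Lm≡ Rm≡) Rm≡) y z
    (rn z y) (nr z y)
    -- Transposition turns (r ∙ r) ∙ l into r ∙ (l ∙ l), so the factors must be regrouped before the
    -- count for RL² applies.
    (trans (∙-transpose (∙-transpose rᵀ rᵀ) lᵀ y z) (trans (sym (∙-assoc r l l z y)) (RLL z y)))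
    (trans (∙-transpose (∙-transpose lᵀ rᵀ) rᵀ y z) (trans (sym (∙-assoc l l r z y)) (LLR z y)))
    (begin
      b ℕ.* (b ℕ.* (b ℕ.* rn z y)) ℕ.+ nr z y ℕ.+ s ℕ.* b ^ D ℕ.* r y z
        ≡⟨ cong (λ i → b ℕ.* (b ℕ.* (b ℕ.* rn z y)) ℕ.+ nr z y ℕ.+ s ℕ.* b ^ D ℕ.* i) (rᵀ y z) ⟩
      b ℕ.* (b ℕ.* (b ℕ.* rn z y)) ℕ.+ nr z y ℕ.+ s ℕ.* b ^ D ℕ.* l z y
        ≡⟨ cubic′ z y ⟩
      b ℕ.* ((l ∙ r) ∙ l) z y
        ≡⟨ cong (b ℕ.*_) (trans (∙-transpose (∙-transpose rᵀ lᵀ) rᵀ y z) (sym (∙-assoc l r l z y))) ⟨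
      b ℕ.* ((r ∙ l) ∙ r) y z ∎))
  where
  open ≡-Reasoning
  open Matrices b m dist x
  open LinAlg.DualPolarVertices V
  open FieldProperties 𝔽 using (b-nonZero)
  open FormProperties 𝔽 using (lineSize; q^2e≡; geometry)
  open LevelCounts 𝔽 (geometry P) vertex-dim vertex-iso injective surjective isDistance x
  s : ℕ
  s = lineSize P
  l f r : Fin m → Fin m → ℕ
  l y z = ⟦ L? y z ⟧
  f y z = ⟦ F? y z ⟧
  r y z = ⟦ R? y z ⟧
  Lm≡ : Represents l Lm
  Lm≡ = represents λ y z → if-does (L? y z)
  Fm≡ : Represents f Fm
  Fm≡ = represents λ y z → if-does (F? y z)
  Rm≡ : Represents r Rm
  Rm≡ = represents λ y z → if-does (R? y z)
  lᵀ : ∀ y z → l y z ≡ r z y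
  lᵀ y z = ⟦⟧-cong L⇒R R⇒L (L? y z) (R? z y)
  rᵀ : ∀ y z → r y z ≡ l z y
  rᵀ y z = sym (lᵀ z y)
  fᵀ : ∀ y z → f y z ≡ f z y
  fᵀ y z = ⟦⟧-cong F-sym F-sym (F? y z) (F? z y)
  #-∙ : ∀ {Q S : Fin m → Set} (Q? : ∀ w → Dec (Q w)) (S? : ∀ w → Dec (S w)) →
    # (λ w → Q? w ×-dec S? w) ≡ ∑ (λ w → ⟦ Q? w ⟧ ℕ.* ⟦ S? w ⟧)
  #-∙ Q? S? = trans (#-∑ (λ w → Q? w ×-dec S? w)) (∑-cong (λ w → ⟦⟧-× (Q? w) (S? w)))
  swap : ∀ i j k → i ℕ.* (j ℕ.* k) ≡ j ℕ.* (i ℕ.* k)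
  swap = solve-∀
  ll : ∀ y z → (l ∙ l) y z ≡ suc b ℕ.* ⟦ N? y z ⟧
  ll y z = trans (sym (#-∙ (L? y) (λ w → L? w z))) (#LL y z)
  LF-FL′ : ∀ y z → (l ∙ f) y z ℕ.+ l y z ≡ b ℕ.* (f ∙ l) y z ℕ.+ s ℕ.* l y z
  LF-FL′ y z = subst₂ (λ i j → i ℕ.+ l y z ≡ b ℕ.* j ℕ.+ s ℕ.* l y z)
    (#-∙ (L? y) (λ w → F? w z)) (#-∙ (F? y) (λ w → L? w z)) (LF-FL y z)
  RLL : ∀ y z → ((r ∙ l) ∙ l) y z ≡ suc b ℕ.* rn y z
  RLL y z = begin
    ((r ∙ l) ∙ l) y z                                ≡⟨ ∙-assoc r l l y z ⟩
    ∑ (λ w → r y w ℕ.* (l ∙ l) w z)                  ≡⟨ ∑-cong (λ w → cong (r y w ℕ.*_) (ll w z)) ⟩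
    ∑ (λ w → r y w ℕ.* (suc b ℕ.* ⟦ N? w z ⟧))       ≡⟨ ∑-cong (λ w → swap (r y w) (suc b) ⟦ N? w z ⟧) ⟩
    ∑ (λ w → suc b ℕ.* (r y w ℕ.* ⟦ N? w z ⟧))       ≡⟨ ∑-*ˡ (suc b) (λ w → r y w ℕ.* ⟦ N? w z ⟧) ⟩
    suc b ℕ.* ∑ (λ w → r y w ℕ.* ⟦ N? w z ⟧)         ≡⟨ cong (suc b ℕ.*_) (#-∙ (R? y) (λ w → N? w z)) ⟨
    suc b ℕ.* rn y z                                 ∎
  LLR : ∀ y z → ((l ∙ l) ∙ r) y z ≡ suc b ℕ.* nr y z
  LLR y z = begin
    ∑ (λ w → (l ∙ l) y w ℕ.* r w z)                  ≡⟨ ∑-cong (λ w → cong (ℕ._* r w z) (ll y w)) ⟩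
    ∑ (λ w → suc b ℕ.* ⟦ N? y w ⟧ ℕ.* r w z)         ≡⟨ ∑-cong (λ w → ℕ.*-assoc (suc b) ⟦ N? y w ⟧ (r w z)) ⟩
    ∑ (λ w → suc b ℕ.* (⟦ N? y w ⟧ ℕ.* r w z))       ≡⟨ ∑-*ˡ (suc b) (λ w → ⟦ N? y w ⟧ ℕ.* r w z) ⟩
    suc b ℕ.* ∑ (λ w → ⟦ N? y w ⟧ ℕ.* r w z)         ≡⟨ cong (suc b ℕ.*_) (#-∙ (N? y) (λ w → R? w z)) ⟨
    suc b ℕ.* nr y z                                 ∎
  cubic′ : ∀ y z → b ℕ.* (b ℕ.* (b ℕ.* rn y z)) ℕ.+ nr y z ℕ.+ s ℕ.* b ^ D ℕ.* l y z ≡ b ℕ.* ((l ∙ r) ∙ l) y z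
  cubic′ y z = trans (cubic y z) (cong (b ℕ.*_) (∑-cong (λ w → cong (ℕ._* l w z) (#-∙ (L? y) (λ v → R? v w)))))
  quadratic : ∀ {i j k : Fin m → Fin m → ℕ} {A B C} → Represents k C → Represents i A → Represents j B →
    ∀ y z → i y z ℕ.+ k y z ≡ b ℕ.* j y z ℕ.+ s ℕ.* k y z →
    A y z - ℕtoℚ b * B y z ≡ (LinAlg.q^2e 𝔽 P - 1ℚ) * C y z
  quadratic {i} {j} {k} C≡ A≡ B≡ y z eq = trans
    (cong₂ (λ p q → p - ℕtoℚ b * q) (entry A≡ y z) (entry B≡ y z))
    (trans (quadratic-relation b s {i y z} {j y z} {k y z} eq)
      (sym (cong₂ (λ p q → (p - 1ℚ) * q) (q^2e≡ P) (entry C≡ y z))))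
  cubicℚ : ∀ {f₁ f₂ f₃ k : Fin m → Fin m → ℕ} {A B C E} → Represents k E →
    Represents f₁ A → Represents f₂ B → Represents f₃ C →
    ∀ y z i j → f₁ y z ≡ suc b ℕ.* i → f₃ y z ≡ suc b ℕ.* j →
    b ℕ.* (b ℕ.* (b ℕ.* i)) ℕ.+ j ℕ.+ s ℕ.* b ^ D ℕ.* k y z ≡ b ℕ.* f₂ y z →
    (+ (b ^ 2) / suc b) * A y z - B y z + (invPow b 1 * (+ 1 / suc b)) * C y z
    ≡ (- (LinAlg.q^2e 𝔽 P * ℕtoℚ (b ^ (D ∸ 1)))) * E y z
  cubicℚ {f₁} {f₂} {f₃} {k} {A} {B} {C} {E} E≡ A≡ B≡ C≡ y z i j eq₁ eq₃ eq = begin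
    (+ (b ^ 2) / suc b) * A y z - B y z + (invPow b 1 * (+ 1 / suc b)) * C y z
      ≡⟨ cong₂ (λ p q → (+ (b ^ 2) / suc b) * p - B y z + (invPow b 1 * (+ 1 / suc b)) * q)
           (trans (entry A≡ y z) (cong ℕtoℚ eq₁)) (trans (entry C≡ y z) (cong ℕtoℚ eq₃)) ⟩
    (+ (b ^ 2) / suc b) * ℕtoℚ (suc b ℕ.* i) - B y z + (invPow b 1 * (+ 1 / suc b)) * ℕtoℚ (suc b ℕ.* j)
      ≡⟨ cong (λ p → (+ (b ^ 2) / suc b) * ℕtoℚ (suc b ℕ.* i) - p + (invPow b 1 * (+ 1 / suc b)) * ℕtoℚ (suc b ℕ.* j))
        (entry B≡ y z) ⟩
    (+ (b ^ 2) / suc b) * ℕtoℚ (suc b ℕ.* i) - ℕtoℚ (f₂ y z) + (invPow b 1 * (+ 1 / suc b)) * ℕtoℚ (suc b ℕ.* j)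
      ≡⟨ cubic-relation b s D {i} {j} {f₂ y z} {k y z} (ℕ.≤-trans (ℕ.s≤s ℕ.z≤n) 3≤D) eq ⟩
    (- (ℕtoℚ s * ℕtoℚ (b ^ (D ∸ 1)))) * ℕtoℚ (k y z)
      ≡⟨ cong₂ (λ p q → (- (p * ℕtoℚ (b ^ (D ∸ 1)))) * q) (q^2e≡ P) (entry E≡ y z) ⟨
    (- (LinAlg.q^2e 𝔽 P * ℕtoℚ (b ^ (D ∸ 1)))) * E y z ∎
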